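{- There is a deterministic algorithm which, given a directed graph $G$ on $n$ vertices and a positive integer $d$, computes exactly the number of simple cycles of length $d$ in $G$ in time $\binom{n}{\lfloor d/2\rfloor}\mathrm{poly}(n)$ and space $\mathrm{poly}(n)$.
   Context: A simple cycle of length $d$ is a closed walk $(v_{i_1},\ldots,v_{i_d})$ of length $d$ in $G$ (that is, a sequence of $d$ vertices with an edge from each vertex to the next and from the last to the first) with no repeated vertices; closed walks are counted as sequences.
   Formalization: When ⌊d/2⌋ > n the binomial coefficient is 0, so the stated time bound cannot hold; there the count is still computed exactly, but time and space are bounded by a polynomial in n plus the bit length of d. -}

module Defs where

open import Data.Bool.Base using (Bool; true; false)
open import Data.Bool.Properties using () renaming (_≟_ to _≟ᵇ_)
open import Data.Fin.Base using (Fin)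
open import Data.Fin.Properties using (_≟_)
open import Data.List.Base using (List; []; _∷_; [_]; map; length; filter; allFin; cartesianProductWith)
open import Data.Nat.Base using (ℕ; zero; suc; _+_; _*_; _∸_; _/_; _⊔_; NonZero)
open import Data.Nat.ListAction using (sum)
open import Data.Nat.Logarithm using (⌊log₂_⌋)
open import Data.Product.Base using (_×_; _,_)
open import Data.Vec.Base using (Vec; []; _∷_; head; last)
open import Data.Vec.Relation.Unary.AllPairs using (allPairs?)
open import Data.Vec.Relation.Unary.Linked using (Linked; linked?)
open import Data.Vec.Relation.Unary.Unique.Propositional using (Unique)
open import Relation.Binary.PropositionalEquality.Core using (_≡_; _≢_; refl)
open import Relation.Nullary.Decidable.Core using (Dec; _×-dec_; ¬?)
open import Relation.Nullary.Negation.Core using (contradiction)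

------------------------------------------------------------------------
-- Directed graphs and simple cycles

-- Adjacency of a directed graph on n vertices; loops are permitted.
Digraph : ℕ → Set
Digraph n = Fin n → Fin n → Bool

module _ {n : ℕ} (G : Digraph n) where

  Edge : Fin n → Fin n → Set
  Edge u v = G u v ≡ true

  edge? : ∀ u v → Dec (Edge u v)
  edge? u v = G u v ≟ᵇ true

  -- For d = 1 this asks for a loop at the only vertex.
  IsClosedWalk : ∀ {d} .{{_ : NonZero d}} → Vec (Fin n) d → Set
  IsClosedWalk {suc _} vs = Linked Edge vs × Edge (last vs) (head vs)

  IsSimpleCycle : ∀ {d} .{{_ : NonZero d}} → Vec (Fin n) d → Set
  IsSimpleCycle vs = IsClosedWalk vs × Unique vs

  isSimpleCycle? : ∀ {d} .{{_ : NonZero d}} (vs : Vec (Fin n) d) → Dec (IsSimpleCycle vs)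
  isSimpleCycle? {suc _} vs =
    (linked? edge? vs ×-dec edge? (last vs) (head vs))
      ×-dec allPairs? (λ u v → ¬? (u ≟ v)) vs

-- Every sequence of d vertices, each listed exactly once.
sequences : ∀ n d → List (Vec (Fin n) d)
sequences n zero    = [ [] ]
sequences n (suc d) = cartesianProductWith _∷_ (allFin n) (sequences n d)

-- A cycle is counted once for each choice of its starting vertex.
#simpleCycles : ∀ {n} → Digraph n → (d : ℕ) .{{_ : NonZero d}} → ℕ
#simpleCycles {n} G d = length (filter (isSimpleCycle? G) (sequences n d))

------------------------------------------------------------------------
-- Random access machine with logarithmic (bit) cost
--
-- Cells hold natural numbers of unbounded size. Every number that is
-- handled is charged its binary length, so time and space agree with
-- those of a Turing machine up to polynomial factors.

-- Number of bits, with ∥ 0 ∥ = 1.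
∥_∥ : ℕ → ℕ
∥ x ∥ = suc ⌊log₂ x ⌋

-- Cells beyond the end of the list contain 0 and have never been used.
Memory : Set
Memory = List ℕ

read : Memory → ℕ → ℕ
read []      _       = 0
read (x ∷ σ) zero    = x
read (x ∷ σ) (suc a) = read σ a

write : Memory → ℕ → ℕ → Memory
write []      zero    x = x ∷ []
write []      (suc a) x = 0 ∷ write [] a x
write (_ ∷ σ) zero    x = x ∷ σ
write (y ∷ σ) (suc a) x = y ∷ write σ a x

-- Every cell up to the highest address written costs at least one bit,
-- whatever its contents.
size : Memory → ℕ
size σ = sum (map ∥_∥ σ)

data Op : Set where
  add sub mul div : Op

⟦_⟧ᵒ : Op → ℕ → ℕ → ℕ
⟦ add ⟧ᵒ x y       = x + y
⟦ sub ⟧ᵒ x y       = x ∸ y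
⟦ mul ⟧ᵒ x y       = x * y
⟦ div ⟧ᵒ x zero    = 0
⟦ div ⟧ᵒ x (suc y) = x / suc y

data Expr : Set where
  lit  : ℕ → Expr
  load : Expr → Expr
  op   : Op → Expr → Expr → Expr

eval : Expr → Memory → ℕ
eval (lit k)      σ = k
eval (load e)     σ = read σ (eval e σ)
eval (op o e₁ e₂) σ = ⟦ o ⟧ᵒ (eval e₁ σ) (eval e₂ σ)

-- The total length of all numbers arising in the evaluation, including
-- addresses. It bounds the scratch space of the evaluation as well, and
-- is charged to both resources.
cost : Expr → Memory → ℕ
cost (lit k)        σ = ∥ k ∥
cost e@(load e₁)    σ = cost e₁ σ + ∥ eval e σ ∥
cost e@(op _ e₁ e₂) σ = cost e₁ σ + cost e₂ σ + ∥ eval e σ ∥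

infix  6 _≔_
infixr 5 _⨟_

data Program : Set where
  skip          : Program
  _≔_           : Expr → Expr → Program  -- e₁ ≔ e₂ stores e₂ at address e₁
  _⨟_           : Program → Program → Program
  if_then_else_ : Expr → Program → Program → Program
  while_loop_   : Expr → Program → Program

infix 4 ⟨_,_⟩⇓⟨_,_,_⟩

-- ⟨ P , σ ⟩⇓⟨ σ′ , t , s ⟩: started in memory σ, the program P halts in
-- memory σ′ after time t, using space s at its peak (σ included).
-- Nonzero values count as true.
data ⟨_,_⟩⇓⟨_,_,_⟩ : Program → Memory → Memory → ℕ → ℕ → Set where

  skip : ∀ {σ} → ⟨ skip , σ ⟩⇓⟨ σ , 1 , size σ ⟩

  assign : ∀ {e₁ e₂ σ} →
    let c  = cost e₁ σ + cost e₂ σ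
        σ′ = write σ (eval e₁ σ) (eval e₂ σ)
    in ⟨ e₁ ≔ e₂ , σ ⟩⇓⟨ σ′ , c , (size σ ⊔ size σ′) + c ⟩

  seq : ∀ {P Q σ σ′ σ″ t₁ t₂ s₁ s₂} →
    ⟨ P , σ ⟩⇓⟨ σ′ , t₁ , s₁ ⟩ →
    ⟨ Q , σ′ ⟩⇓⟨ σ″ , t₂ , s₂ ⟩ →
    ⟨ P ⨟ Q , σ ⟩⇓⟨ σ″ , t₁ + t₂ , s₁ ⊔ s₂ ⟩

  if-true : ∀ {e P Q σ σ′ t s} → eval e σ ≢ 0 →
    ⟨ P , σ ⟩⇓⟨ σ′ , t , s ⟩ →
    ⟨ if e then P else Q , σ ⟩⇓⟨ σ′ , cost e σ + t , (size σ + cost e σ) ⊔ s ⟩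

  if-false : ∀ {e P Q σ σ′ t s} → eval e σ ≡ 0 →
    ⟨ Q , σ ⟩⇓⟨ σ′ , t , s ⟩ →
    ⟨ if e then P else Q , σ ⟩⇓⟨ σ′ , cost e σ + t , (size σ + cost e σ) ⊔ s ⟩

  while-true : ∀ {e P σ σ′ σ″ t₁ t₂ s₁ s₂} → eval e σ ≢ 0 →
    ⟨ P , σ ⟩⇓⟨ σ′ , t₁ , s₁ ⟩ →
    ⟨ while e loop P , σ′ ⟩⇓⟨ σ″ , t₂ , s₂ ⟩ →
    ⟨ while e loop P , σ ⟩⇓⟨ σ″ , cost e σ + t₁ + t₂ , (size σ + cost e σ) ⊔ (s₁ ⊔ s₂) ⟩

  while-false : ∀ {e P σ} → eval e σ ≡ 0 →
    ⟨ while e loop P , σ ⟩⇓⟨ σ , cost e σ , size σ + cost e σ ⟩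

-- Programs are deterministic algorithms: the result and the resources
-- used are determined by the initial memory.
⇓-deterministic : ∀ {P σ σ₁ σ₂ t₁ t₂ s₁ s₂} →
  ⟨ P , σ ⟩⇓⟨ σ₁ , t₁ , s₁ ⟩ → ⟨ P , σ ⟩⇓⟨ σ₂ , t₂ , s₂ ⟩ →
  σ₁ ≡ σ₂ × t₁ ≡ t₂ × s₁ ≡ s₂
⇓-deterministic skip   skip   = refl , refl , refl
⇓-deterministic assign assign = refl , refl , refl
⇓-deterministic (seq p q) (seq p′ q′) with ⇓-deterministic p p′
... | refl , refl , refl with ⇓-deterministic q q′
... | refl , refl , refl = refl , refl , refl
⇓-deterministic (if-true _ p) (if-true _ p′) with ⇓-deterministic p p′
... | refl , refl , refl = refl , refl , refl
⇓-deterministic (if-true  b _) (if-false z _) = contradiction z b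
⇓-deterministic (if-false z _) (if-true  b _) = contradiction z b
⇓-deterministic (if-false _ p) (if-false _ p′) with ⇓-deterministic p p′
... | refl , refl , refl = refl , refl , refl
⇓-deterministic (while-true _ p q) (while-true _ p′ q′) with ⇓-deterministic p p′
... | refl , refl , refl with ⇓-deterministic q q′
... | refl , refl , refl = refl , refl , refl
⇓-deterministic (while-true b _ _) (while-false z)    = contradiction z b
⇓-deterministic (while-false z)    (while-true b _ _) = contradiction z b
⇓-deterministic (while-false _)    (while-false _)    = refl , refl , refl

bit : Bool → ℕ
bit true  = 1
bit false = 0

-- Initial memory: n, d, then the adjacency matrix row by row.
input : ∀ {n} → Digraph n → ℕ → Memory
input {n} G d =
  n ∷ d ∷ cartesianProductWith (λ u v → bit (G u v)) (allFin n) (allFin n)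

output : Memory → ℕ
output σ = read σ 0

------------------------------------------------------------------------
-- Polynomial bounds

-- Polynomials with natural coefficients, constant term first.
Poly : Set
Poly = List ℕ

poly : Poly → ℕ → ℕ
poly []      x = 0
poly (a ∷ p) x = a + x * poly p x

{-# OPTIONS --safe #-}
-- Let k = ⌊d/2⌋. For a set S of vertices let x_S be 1 off S and -1 on S, and let W(S) be the sum
-- over the closed walks of length d of the product of the weights x_S of their vertices: a trace
-- of a matrix power, computable in polynomial time. A closed walk w visiting v exactly α_v times
-- contributes ∏_{v ∈ S} z_v to W(S), where z_v = (-1)^α_v, so ∑_{|S| = s} W(S) is the sum over w of
-- the elementary symmetric polynomial e_s(z). Multiplication by ∑ z_v acts on the e_s by a
-- three-term recurrence (they are Krawtchouk polynomials in the number of odd α_v), and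
-- ∑ z_v = n - 2d + 4h, where h = ∑ ⌊α_v/2⌋ ≤ k is 0 exactly if w has no repeated vertex.
-- Hence the recurrence yields coefficients c_0, …, c_k such that ∑_{s ≤ k} c_s e_s(z) =
-- ∏_{1 ≤ j ≤ k} (n - 2d + 4j - ∑ z_v), which is 4^k k! for h = 0 and 0 otherwise. So the number
-- of simple cycles is ∑_{|S| ≤ k} c_{|S|} W(S) / (4^k k!). If d > n there are none; otherwise
-- 2k ≤ n, and the sum has at most (k + 1) (n C k) terms.
--
-- The program runs through the sets S by unranking. It computes modulo m = 4^k k! n^d + 1, where
-- m - 1 plays the role of -1; this keeps all numbers short, and the final sum lies below m.
module Submission where

open import Defs

-- Signs see only the parities of the α_v. They detect repetition because the total is fixed: ∑ α_v
-- = d and (-1)^α = 1 - 2α + 4⌊α/2⌋, so the only unknown in ∑ z_v is h. As h lies in {0, ..., k}, a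
-- polynomial of degree k in ∑ z_v separates 0 from the other values, and this degree is what limits
-- the sets to size k. Its coefficients in the basis e_s depend on n and d alone, so one list of
-- them serves all walks at once.
--
-- Resources are bounded through a single number V that no memory cell ever exceeds. Intermediate
-- values may exceed it, but an expression of fixed shape lengthens its operands only by a constant
-- factor. Each assignment or test thus costs a constant multiple of ∥V∥, and it remains to count
-- the steps and to show that ∥V∥ is polynomial in n.
--
-- If ⌊d/2⌋ > n, the binomial coefficient is 0, whereas merely comparing d with n already costs ∥d∥;
-- hence the separate bound in n + ∥d∥.

module SignedCount where

  open import Data.Bool.Base using (true; false; T) renaming (if_then_else_ to ifᵇ_then_else_)
  open import Data.Empty using (⊥; ⊥-elim)
  open import Data.Fin.Base using (Fin; toℕ)
  import Data.Fin.Base as Fin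
  import Data.Fin.Properties as Fin
  open import Data.Integer.Base using (ℤ; +_; 0ℤ; 1ℤ; -1ℤ; _+_; _*_; _-_; -_; _^_)
  import Data.Integer.Properties as ℤ
  open import Data.Integer.Tactic.RingSolver using (solve-∀)
  open import Data.List.Base using (List; []; _∷_; map; length; filter; allFin; tabulate; cartesianProductWith; _++_)
  open import Data.Nat.Base using (ℕ; zero; suc; _<_; _≤_; s≤s; z≤n; s<s; pred; _∸_; _<ᵇ_; _≡ᵇ_; ⌊_/2⌋)
  import Data.Nat.Base as ℕ
  import Data.Nat.Properties as ℕ
  open import Data.Product.Base using (_×_; _,_)
  open import Data.Sum.Base using (_⊎_; inj₁; inj₂)
  open import Data.Vec.Base using (Vec; []; _∷_; last)
  open import Data.Vec.Relation.Unary.All using (All; []; _∷_)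
  open import Data.Vec.Relation.Unary.AllPairs using ([]; _∷_)
  open import Data.Vec.Relation.Unary.Linked using (Linked; [-]; _∷_)
  open import Data.Vec.Relation.Unary.Unique.Propositional using (Unique)
  open import Function.Base using (_∘_)
  open import Relation.Binary.PropositionalEquality
  open import Relation.Nullary.Decidable.Core using (yes; no; Dec; does)
  open import Relation.Nullary.Negation.Core using (¬_; contradiction)
  open import Relation.Unary using (Decidable)
  open ≡-Reasoning

  -- Finite sums and products of integers

  ∑ : ℕ → (ℕ → ℤ) → ℤ
  ∑ zero    f = 0ℤ
  ∑ (suc n) f = ∑ n f + f n

  ∏ : ℕ → (ℕ → ℤ) → ℤ
  ∏ zero    f = 1ℤ
  ∏ (suc n) f = ∏ n f * f n

  ∑-cong : ∀ n {f g} → (∀ i → i < n → f i ≡ g i) → ∑ n f ≡ ∑ n g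
  ∑-cong zero    h = refl
  ∑-cong (suc n) h = cong₂ _+_ (∑-cong n λ i i<n → h i (ℕ.m<n⇒m<1+n i<n)) (h n (ℕ.n<1+n n))

  ∏-cong : ∀ n {f g} → (∀ i → i < n → f i ≡ g i) → ∏ n f ≡ ∏ n g
  ∏-cong zero    h = refl
  ∏-cong (suc n) h = cong₂ _*_ (∏-cong n λ i i<n → h i (ℕ.m<n⇒m<1+n i<n)) (h n (ℕ.n<1+n n))

  ∑-0 : ∀ n → ∑ n (λ _ → 0ℤ) ≡ 0ℤ
  ∑-0 zero = refl
  ∑-0 (suc n) = trans (ℤ.+-identityʳ _) (∑-0 n)

  ∏-1 : ∀ n → ∏ n (λ _ → 1ℤ) ≡ 1ℤ
  ∏-1 zero = refl
  ∏-1 (suc n) = trans (ℤ.*-identityʳ _) (∏-1 n)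

  +-interchange : ∀ a b c d → (a + b) + (c + d) ≡ (a + c) + (b + d)
  +-interchange = solve-∀

  *-interchange : ∀ a b c d → (a * b) * (c * d) ≡ (a * c) * (b * d)
  *-interchange = solve-∀

  ∑-+ : ∀ n f g → ∑ n (λ i → f i + g i) ≡ ∑ n f + ∑ n g
  ∑-+ zero    f g = refl
  ∑-+ (suc n) f g = trans (cong (_+ (f n + g n)) (∑-+ n f g)) (+-interchange (∑ n f) (∑ n g) (f n) (g n))

  ∏-* : ∀ n f g → ∏ n (λ i → f i * g i) ≡ ∏ n f * ∏ n g
  ∏-* zero    f g = refl
  ∏-* (suc n) f g = trans (cong (_* (f n * g n)) (∏-* n f g)) (*-interchange (∏ n f) (∏ n g) (f n) (g n))

  *-∑ : ∀ n a f → ∑ n (λ i → a * f i) ≡ a * ∑ n f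
  *-∑ zero    a f = sym (ℤ.*-zeroʳ a)
  *-∑ (suc n) a f = trans (cong (_+ (a * f n)) (*-∑ n a f)) (sym (ℤ.*-distribˡ-+ a (∑ n f) (f n)))

  ∑-split : ∀ m n f → ∑ (m ℕ.+ n) f ≡ ∑ m f + ∑ n (λ i → f (m ℕ.+ i))
  ∑-split m zero    f = trans (cong (λ l → ∑ l f) (ℕ.+-identityʳ m)) (sym (ℤ.+-identityʳ _))
  ∑-split m (suc n) f = begin
    ∑ (m ℕ.+ suc n) f                                        ≡⟨ cong (λ l → ∑ l f) (ℕ.+-suc m n) ⟩
    ∑ (m ℕ.+ n) f + f (m ℕ.+ n)                              ≡⟨ cong (_+ f (m ℕ.+ n)) (∑-split m n f) ⟩
    ∑ m f + ∑ n (λ i → f (m ℕ.+ i)) + f (m ℕ.+ n)            ≡⟨ ℤ.+-assoc (∑ m f) _ _ ⟩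
    ∑ m f + (∑ n (λ i → f (m ℕ.+ i)) + f (m ℕ.+ n))          ∎

  ∑-head : ∀ n f → ∑ (suc n) f ≡ f 0 + ∑ n (λ i → f (suc i))
  ∑-head n f = trans (∑-split 1 n f) (cong (_+ ∑ n (λ i → f (suc i))) (ℤ.+-identityˡ (f 0)))

  ∑-comm : ∀ m n (f : ℕ → ℕ → ℤ) → ∑ m (λ i → ∑ n (f i)) ≡ ∑ n (λ j → ∑ m (λ i → f i j))
  ∑-comm zero    n f = sym (∑-0 n)
  ∑-comm (suc m) n f = trans (cong (_+ ∑ n (f m)) (∑-comm m n f)) (sym (∑-+ n _ (f m)))

  δ : ℕ → ℕ → ℤ
  δ i j = ifᵇ i ≡ᵇ j then 1ℤ else 0ℤ

  T⇒≡true : ∀ {x} → T x → x ≡ true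
  T⇒≡true {true} _ = refl

  ¬T⇒≡false : ∀ {x} → (T x → ⊥) → x ≡ false
  ¬T⇒≡false {true}  h = ⊥-elim (h _)
  ¬T⇒≡false {false} h = refl

  ≡ᵇ-refl : ∀ i → (i ≡ᵇ i) ≡ true
  ≡ᵇ-refl zero = refl
  ≡ᵇ-refl (suc i) = ≡ᵇ-refl i

  ≡ᵇ-false : ∀ {i j} → i ≢ j → (i ≡ᵇ j) ≡ false
  ≡ᵇ-false {i} {j} h = ¬T⇒≡false λ t → h (ℕ.≡ᵇ⇒≡ i j t)

  δ-refl : ∀ i → δ i i ≡ 1ℤ
  δ-refl i rewrite ≡ᵇ-refl i = refl

  δ-≢ : ∀ {i j} → i ≢ j → δ i j ≡ 0ℤ
  δ-≢ i≢j rewrite ≡ᵇ-false i≢j = refl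

  ∑-δ : ∀ n (f : ℕ → ℤ) u → u < n → ∑ n (λ v → f v * δ u v) ≡ f u
  ∑-δ (suc n) f u u<1+n with u ℕ.≟ n
  ... | yes refl = begin
    ∑ u (λ v → f v * δ u v) + f u * δ u u
      ≡⟨ cong₂ _+_ (∑-cong u λ i i<u → trans (cong (f i *_) (δ-≢ (≢-sym (ℕ.<⇒≢ i<u)))) (ℤ.*-zeroʳ (f i)))
                   (cong (f u *_) (δ-refl u)) ⟩
    ∑ u (λ _ → 0ℤ) + f u * 1ℤ
      ≡⟨ cong₂ _+_ (∑-0 u) (ℤ.*-identityʳ (f u)) ⟩
    0ℤ + f u
      ≡⟨ ℤ.+-identityˡ (f u) ⟩
    f u ∎
  ... | no u≢n = begin
    ∑ n (λ v → f v * δ u v) + f n * δ u n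
      ≡⟨ cong₂ _+_ (∑-δ n f u (ℕ.≤∧≢⇒< (ℕ.s≤s⁻¹ u<1+n) u≢n)) (trans (cong (f n *_) (δ-≢ u≢n)) (ℤ.*-zeroʳ (f n))) ⟩
    f u + 0ℤ
      ≡⟨ ℤ.+-identityʳ (f u) ⟩
    f u ∎

  -- e z i (suc t) is the elementary symmetric polynomial of degree t in z 0, …, z (i - 1);
  -- the shift makes room for degree -1.
  e : (ℕ → ℤ) → ℕ → ℕ → ℤ
  e z _       zero          = 0ℤ
  e z zero    (suc zero)    = 1ℤ
  e z zero    (suc (suc t)) = 0ℤ
  e z (suc i) (suc t)       = e z i (suc t) + z i * e z i t

  -- Elementary symmetric polynomials in signs

  module Krawtchouk (z : ℕ → ℤ) (z²≡1 : ∀ i → z i * z i ≡ 1ℤ) where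

    -- Multiply the product over a t-set by some z v. If v lies outside, a (t + 1)-set results, and
    -- each arises t + 1 times. If v lies inside, z v cancels because its square is 1, and each (t -
    -- 1)-set arises once for each of the i - (t - 1) elements outside it.
    e-recurrence : ∀ i t →
      ∑ i z * e z i (suc t) ≡ (1ℤ + + t) * e z i (suc (suc t)) + (+ i - + t + 1ℤ) * e z i t
    e-recurrence zero    zero          = refl
    e-recurrence zero    (suc zero)    = refl
    e-recurrence zero    (suc (suc t)) = lem (+ t)
      where
      lem : ∀ t → 0ℤ ≡ (1ℤ + (1ℤ + (1ℤ + t))) * 0ℤ + (0ℤ - (1ℤ + (1ℤ + t)) + 1ℤ) * 0ℤ
      lem = solve-∀
    e-recurrence (suc i) zero          = begin
      (∑ i z + z i) * (e z i 1 + z i * 0ℤ)           ≡⟨ lem₁ (∑ i z) (z i) (e z i 1) ⟩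
      ∑ i z * e z i 1 + z i * e z i 1                ≡⟨ cong (_+ z i * e z i 1) (e-recurrence i 0) ⟩
      1ℤ * e z i 2 + (+ i - 0ℤ + 1ℤ) * 0ℤ + z i * e z i 1
        ≡⟨ lem₂ (e z i 2) (+ i) (z i * e z i 1) ⟩
      1ℤ * (e z i 2 + z i * e z i 1) + (+ suc i - 0ℤ + 1ℤ) * 0ℤ ∎
      where
      lem₁ : ∀ s z e → (s + z) * (e + z * 0ℤ) ≡ s * e + z * e
      lem₁ = solve-∀
      lem₂ : ∀ e i x → 1ℤ * e + (i - 0ℤ + 1ℤ) * 0ℤ + x ≡ 1ℤ * (e + x) + (1ℤ + i - 0ℤ + 1ℤ) * 0ℤ
      lem₂ = solve-∀
    e-recurrence (suc i) (suc t)       = begin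
      (s + y) * (e₂ + y * e₁)                                        ≡⟨ lem₁ s y e₂ e₁ ⟩
      s * e₂ + y * (s * e₁) + y * e₂ + (y * y) * e₁
        ≡⟨ cong₂ _+_ (cong₂ (λ a b → a + y * b + y * e₂) (e-recurrence i (suc t)) (e-recurrence i t))
                     (cong (_* e₁) (z²≡1 i)) ⟩
      (1ℤ + + suc t) * e₃ + (+ i - + suc t + 1ℤ) * e₁ + y * ((1ℤ + + t) * e₂ + (+ i - + t + 1ℤ) * e₀)
        + y * e₂ + 1ℤ * e₁
        ≡⟨ lem₂ (+ t) (+ i) y e₀ e₁ e₂ e₃ ⟩
      (1ℤ + + suc t) * (e₃ + y * e₂) + (+ suc i - + suc t + 1ℤ) * (e₁ + y * e₀) ∎
      where
      s y e₀ e₁ e₂ e₃ : ℤ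
      s  = ∑ i z
      y  = z i
      e₀ = e z i t
      e₁ = e z i (suc t)
      e₂ = e z i (suc (suc t))
      e₃ = e z i (suc (suc (suc t)))
      lem₁ : ∀ s y e₂ e₁ → (s + y) * (e₂ + y * e₁) ≡ s * e₂ + y * (s * e₁) + y * e₂ + (y * y) * e₁
      lem₁ = solve-∀
      lem₂ : ∀ t i y e₀ e₁ e₂ e₃ →
        (1ℤ + (1ℤ + t)) * e₃ + (i - (1ℤ + t) + 1ℤ) * e₁ + y * ((1ℤ + t) * e₂ + (i - t + 1ℤ) * e₀)
          + y * e₂ + 1ℤ * e₁
        ≡ (1ℤ + (1ℤ + t)) * (e₃ + y * e₂) + ((1ℤ + i) - (1ℤ + t) + 1ℤ) * (e₁ + y * e₀)
      lem₂ = solve-∀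

    -- By summation by parts, shift is multiplication by ∑ n z on coefficients in the basis e.
    shift : ℕ → (ℕ → ℤ) → ℕ → ℤ
    shift n c t = + t * c (pred t) + (+ n - + t) * c (suc t)

    -- The term after the `+` is what cutting off at T leaves over. It contains only `c T` and
    -- `c (pred T)`, so it disappears once T exceeds the degree of c by two.
    ∑-shift : ∀ n c T →
      ∑ T (λ t → e z n (suc t) * shift n c t) ≡
      ∑ n z * ∑ T (λ t → e z n (suc t) * c t)
        + ((+ n - + T + 1ℤ) * e z n T * c T - + T * e z n (suc T) * c (pred T))
    ∑-shift n c zero    = lem (∑ n z) (+ n) (e z n 1) (c 0)
      where
      lem : ∀ s n e c → 0ℤ ≡ s * 0ℤ + ((n - 0ℤ + 1ℤ) * 0ℤ * c - 0ℤ * e * c)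
      lem = solve-∀
    ∑-shift n c (suc T) = begin
      ∑ T (λ t → e z n (suc t) * shift n c t) + e₁ * (+ T * c₀ + (+ n - + T) * c₂)
        ≡⟨ cong (_+ e₁ * (+ T * c₀ + (+ n - + T) * c₂)) (∑-shift n c T) ⟩
      s * S + ((+ n - + T + 1ℤ) * e₀ * c₁ - + T * e₁ * c₀) + e₁ * (+ T * c₀ + (+ n - + T) * c₂)
        ≡⟨ lem₁ s S (+ n) (+ T) e₀ e₁ e₂ c₀ c₁ c₂ ⟩
      s * S + ((1ℤ + + T) * e₂ + (+ n - + T + 1ℤ) * e₀) * c₁
        + ((+ n - + suc T + 1ℤ) * e₁ * c₂ - + suc T * e₂ * c₁)
        ≡⟨ cong (λ x → s * S + x * c₁ + ((+ n - + suc T + 1ℤ) * e₁ * c₂ - + suc T * e₂ * c₁))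
                (sym (e-recurrence n T)) ⟩
      s * S + (s * e₁) * c₁ + ((+ n - + suc T + 1ℤ) * e₁ * c₂ - + suc T * e₂ * c₁)
        ≡⟨ cong (_+ ((+ n - + suc T + 1ℤ) * e₁ * c₂ - + suc T * e₂ * c₁)) (lem₂ s S e₁ c₁) ⟩
      s * (S + e₁ * c₁) + ((+ n - + suc T + 1ℤ) * e₁ * c₂ - + suc T * e₂ * c₁) ∎
      where
      s S e₀ e₁ e₂ c₀ c₁ c₂ : ℤ
      s  = ∑ n z
      S  = ∑ T (λ t → e z n (suc t) * c t)
      e₀ = e z n T
      e₁ = e z n (suc T)
      e₂ = e z n (suc (suc T))
      c₀ = c (pred T)
      c₁ = c T
      c₂ = c (suc T)
      lem₁ : ∀ s S n T e₀ e₁ e₂ c₀ c₁ c₂ →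
        s * S + ((n - T + 1ℤ) * e₀ * c₁ - T * e₁ * c₀) + e₁ * (T * c₀ + (n - T) * c₂)
        ≡ s * S + ((1ℤ + T) * e₂ + (n - T + 1ℤ) * e₀) * c₁
          + ((n - (1ℤ + T) + 1ℤ) * e₁ * c₂ - (1ℤ + T) * e₂ * c₁)
      lem₁ = solve-∀
      lem₂ : ∀ s S e c → s * S + (s * e) * c ≡ s * (S + e * c)
      lem₂ = solve-∀

  -- Expansion of a product of linear factors in ∑ z

  module _ (n d : ℕ) where

    root : ℕ → ℤ
    root j = + n - + 2 * + d + + 4 * + suc j

    -- Row j expands the product of the first j factors `root i - ∑ n z` in the basis `e`; the
    -- bracket is `shift`, that is, multiplication by `∑ n z`. No z occurs, which makes the
    -- coefficients common to all walks.
    coeff : ℕ → ℕ → ℤ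
    coeff zero    zero    = 1ℤ
    coeff zero    (suc s) = 0ℤ
    coeff (suc j) s       =
      root j * coeff j s - (+ s * coeff j (pred s) + (+ n - + s) * coeff j (suc s))

    -- Each factor raises the degree by one. This is what removes the boundary terms of `∑-shift`.
    coeff-zero : ∀ j s → j < s → coeff j s ≡ 0ℤ
    coeff-zero zero    (suc s) _ = refl
    coeff-zero (suc j) (suc s) (s<s j<s)
      rewrite coeff-zero j (suc s) (ℕ.m<n⇒m<1+n j<s)
            | coeff-zero j s j<s
            | coeff-zero j (suc (suc s)) (ℕ.m<n⇒m<1+n (ℕ.m<n⇒m<1+n j<s)) = lem (root j) (+ s) (+ n)
      where
      lem : ∀ r s n → r * 0ℤ - ((1ℤ + s) * 0ℤ + (n - (1ℤ + s)) * 0ℤ) ≡ 0ℤ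
      lem = solve-∀

    ∑-coeff : ∀ z → (∀ i → z i * z i ≡ 1ℤ) → ∀ j T → j < T →
      ∑ T (λ t → e z n (suc t) * coeff j t) ≡ ∏ j (λ i → root i - ∑ n z)
    ∑-coeff z z²≡1 zero (suc T) _ = begin
      ∑ (suc T) (λ t → e z n (suc t) * coeff 0 t)
        ≡⟨ ∑-head T (λ t → e z n (suc t) * coeff 0 t) ⟩
      e z n 1 * 1ℤ + ∑ T (λ t → e z n (suc (suc t)) * 0ℤ)
        ≡⟨ cong₂ _+_ (trans (ℤ.*-identityʳ (e z n 1)) (e₁≡1 n)) (trans (∑-cong T λ t _ → ℤ.*-zeroʳ (e z n (suc (suc t)))) (∑-0 T)) ⟩
      1ℤ ∎
      where
      e₁≡1 : ∀ i → e z i 1 ≡ 1ℤ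
      e₁≡1 zero    = refl
      e₁≡1 (suc i) = trans (cong₂ _+_ (e₁≡1 i) (ℤ.*-zeroʳ (z i))) refl
    ∑-coeff z z²≡1 (suc j) (suc T) (s<s j<T) = begin
      ∑ T′ (λ t → e z n (suc t) * (root j * c t - shift n c t))
        ≡⟨ ∑-cong T′ (λ t _ → lem₁ (e z n (suc t)) (root j) (c t) (shift n c t)) ⟩
      ∑ T′ (λ t → root j * (e z n (suc t) * c t) + -1ℤ * (e z n (suc t) * shift n c t))
        ≡⟨ ∑-+ T′ _ _ ⟩
      ∑ T′ (λ t → root j * (e z n (suc t) * c t)) + ∑ T′ (λ t → -1ℤ * (e z n (suc t) * shift n c t))
        ≡⟨ cong₂ _+_ (*-∑ T′ (root j) _) (*-∑ T′ -1ℤ _) ⟩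
      root j * S + -1ℤ * ∑ T′ (λ t → e z n (suc t) * shift n c t)
        ≡⟨ cong (λ x → root j * S + -1ℤ * x) (∑-shift n c T′) ⟩
      root j * S + -1ℤ * (s * S + ((+ n - + T′ + 1ℤ) * e z n T′ * c T′ - + T′ * e z n (suc T′) * c T))
        ≡⟨ cong₂ (λ x y → root j * S + -1ℤ * (s * S + ((+ n - + T′ + 1ℤ) * e z n T′ * x - + T′ * e z n (suc T′) * y)))
                 (coeff-zero j T′ (ℕ.m<n⇒m<1+n j<T)) (coeff-zero j T j<T) ⟩
      root j * S + -1ℤ * (s * S + ((+ n - + T′ + 1ℤ) * e z n T′ * 0ℤ - + T′ * e z n (suc T′) * 0ℤ))
        ≡⟨ lem₂ (root j) s S ((+ n - + T′ + 1ℤ) * e z n T′) (+ T′ * e z n (suc T′)) ⟩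
      S * (root j - s)
        ≡⟨ cong (_* (root j - s)) (∑-coeff z z²≡1 j T′ (ℕ.m<n⇒m<1+n j<T)) ⟩
      ∏ j (λ i → root i - s) * (root j - s) ∎
      where
      open Krawtchouk z z²≡1
      T′ : ℕ
      T′ = suc T
      c : ℕ → ℤ
      c = coeff j
      s S : ℤ
      s = ∑ n z
      S = ∑ T′ (λ t → e z n (suc t) * c t)
      lem₁ : ∀ e r c h → e * (r * c - h) ≡ r * (e * c) + -1ℤ * (e * h)
      lem₁ = solve-∀
      lem₂ : ∀ r s S x y → r * S + -1ℤ * (s * S + (x * 0ℤ - y * 0ℤ)) ≡ S * (r - s)
      lem₂ = solve-∀

  -- Sums of natural numbers and of alternating signs

  ∑ℕ : ℕ → (ℕ → ℕ) → ℕ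
  ∑ℕ zero    f = 0
  ∑ℕ (suc n) f = ∑ℕ n f ℕ.+ f n

  +-∑ℕ : ∀ n f → + ∑ℕ n f ≡ ∑ n (λ i → + f i)
  +-∑ℕ zero    f = refl
  +-∑ℕ (suc n) f = cong (_+ + f n) (+-∑ℕ n f)

  ∑ℕ-mono : ∀ n {f g : ℕ → ℕ} → (∀ i → f i ≤ g i) → ∑ℕ n f ≤ ∑ℕ n g
  ∑ℕ-mono zero    h = z≤n
  ∑ℕ-mono (suc n) h = ℕ.+-mono-≤ (∑ℕ-mono n h) (h n)

  term≤∑ℕ : ∀ n (f : ℕ → ℕ) i → i < n → f i ≤ ∑ℕ n f
  term≤∑ℕ (suc n) f i i<1+n with i ℕ.≟ n
  ... | yes refl = ℕ.m≤n+m (f n) (∑ℕ n f)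
  ... | no  i≢n  = ℕ.≤-trans (term≤∑ℕ n f i (ℕ.≤∧≢⇒< (ℕ.s≤s⁻¹ i<1+n) i≢n)) (ℕ.m≤m+n (∑ℕ n f) (f n))

  ∑ℕ-0 : ∀ n {f : ℕ → ℕ} → (∀ i → f i ≡ 0) → ∑ℕ n f ≡ 0
  ∑ℕ-0 zero    h = refl
  ∑ℕ-0 (suc n) h = cong₂ ℕ._+_ (∑ℕ-0 n h) (h n)

  ∑-const : ∀ n → ∑ n (λ _ → 1ℤ) ≡ + n
  ∑-const zero    = refl
  ∑-const (suc n) = trans (cong (_+ 1ℤ) (∑-const n)) (ℤ.+-comm (+ n) 1ℤ)

  -- Since a - 2⌊a/2⌋ is the parity p of a, the right-hand side is 1 - 2p. Written this way, the
  -- sign is linear in a except for the term that counts pairs of visits.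
  -1^ : ∀ a → -1ℤ ^ a ≡ 1ℤ - + 2 * + a + + 4 * + ⌊ a /2⌋
  -1^ zero          = refl
  -1^ (suc zero)    = refl
  -1^ (suc (suc a)) = trans (cong (λ x → -1ℤ * (-1ℤ * x)) (-1^ a)) (lem (+ a) (+ ⌊ a /2⌋))
    where
    lem : ∀ a h → -1ℤ * (-1ℤ * (1ℤ - + 2 * a + + 4 * h)) ≡ 1ℤ - + 2 * (1ℤ + (1ℤ + a)) + + 4 * (1ℤ + h)
    lem = solve-∀

  -1^-square : ∀ a → (-1ℤ ^ a) * (-1ℤ ^ a) ≡ 1ℤ
  -1^-square zero    = refl
  -1^-square (suc a) = trans (lem (-1ℤ ^ a)) (-1^-square a)
    where
    lem : ∀ x → (-1ℤ * x) * (-1ℤ * x) ≡ x * x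
    lem = solve-∀

  ∑-alternating : ∀ n (α : ℕ → ℕ) →
    ∑ n (λ v → -1ℤ ^ α v) ≡ + n - + 2 * + ∑ℕ n α + + 4 * + ∑ℕ n (λ v → ⌊ α v /2⌋)
  ∑-alternating n α = begin
    ∑ n (λ v → -1ℤ ^ α v)
      ≡⟨ ∑-cong n (λ v _ → trans (-1^ (α v)) (lem₁ (+ α v) (+ ⌊ α v /2⌋))) ⟩
    ∑ n (λ v → 1ℤ + (- (+ 2) * + α v + + 4 * + ⌊ α v /2⌋))
      ≡⟨ trans (∑-+ n _ _) (cong₂ _+_ (∑-const n) (∑-+ n _ _)) ⟩
    + n + (∑ n (λ v → - (+ 2) * + α v) + ∑ n (λ v → + 4 * + ⌊ α v /2⌋))
      ≡⟨ cong₂ (λ x y → + n + (x + y))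
           (trans (*-∑ n (- (+ 2)) (λ v → + α v)) (cong (- (+ 2) *_) (sym (+-∑ℕ n α))))
           (trans (*-∑ n (+ 4) (λ v → + ⌊ α v /2⌋)) (cong (+ 4 *_) (sym (+-∑ℕ n (λ v → ⌊ α v /2⌋))))) ⟩
    + n + (- (+ 2) * + ∑ℕ n α + + 4 * + ∑ℕ n (λ v → ⌊ α v /2⌋))
      ≡⟨ lem₂ (+ n) (+ ∑ℕ n α) (+ ∑ℕ n (λ v → ⌊ α v /2⌋)) ⟩
    + n - + 2 * + ∑ℕ n α + + 4 * + ∑ℕ n (λ v → ⌊ α v /2⌋) ∎
    where
    lem₁ : ∀ a h → 1ℤ - + 2 * a + + 4 * h ≡ 1ℤ + (- (+ 2) * a + + 4 * h)
    lem₁ = solve-∀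
    lem₂ : ∀ n a h → n + (- (+ 2) * a + + 4 * h) ≡ n - + 2 * a + + 4 * h
    lem₂ = solve-∀

  -- Multiplicity of a vertex in a sequence of vertices

  δℕ : ℕ → ℕ → ℕ
  δℕ i j = ifᵇ i ≡ᵇ j then 1 else 0

  δℕ-refl : ∀ i → δℕ i i ≡ 1
  δℕ-refl i rewrite ≡ᵇ-refl i = refl

  δℕ-≢ : ∀ {i j} → i ≢ j → δℕ i j ≡ 0
  δℕ-≢ i≢j rewrite ≡ᵇ-false i≢j = refl

  +-δℕ : ∀ i j → + δℕ i j ≡ δ i j
  +-δℕ i j with i ≡ᵇ j
  ... | true  = refl
  ... | false = refl

  multiplicity : ∀ {n m} → Vec (Fin n) m → ℕ → ℕ
  multiplicity []      v = 0
  multiplicity (u ∷ w) v = δℕ (toℕ u) v ℕ.+ multiplicity w v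

  ∑ℕ-multiplicity : ∀ {n m} (w : Vec (Fin n) m) → ∑ℕ n (multiplicity w) ≡ m
  ∑ℕ-multiplicity {n} []      = ∑ℕ-0 n λ _ → refl
  ∑ℕ-multiplicity {n} {suc m} (u ∷ w) = ℤ.+-injective (begin
    + ∑ℕ n (multiplicity (u ∷ w))
      ≡⟨ +-∑ℕ n _ ⟩
    ∑ n (λ v → + δℕ (toℕ u) v + + multiplicity w v)
      ≡⟨ ∑-+ n _ _ ⟩
    ∑ n (λ v → + δℕ (toℕ u) v) + ∑ n (λ v → + multiplicity w v)
      ≡⟨ cong₂ _+_ (∑-cong n λ v _ → trans (+-δℕ (toℕ u) v) (sym (ℤ.*-identityˡ (δ (toℕ u) v))))
                   (trans (sym (+-∑ℕ n (multiplicity w))) (cong +_ (∑ℕ-multiplicity w))) ⟩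
    ∑ n (λ v → 1ℤ * δ (toℕ u) v) + + m
      ≡⟨ cong (_+ + m) (∑-δ n (λ _ → 1ℤ) (toℕ u) (Fin.toℕ<n u)) ⟩
    1ℤ + + m ∎)

  fresh⇒multiplicity≡0 : ∀ {n m} {u : Fin n} {w : Vec (Fin n) m} → All (u ≢_) w → multiplicity w (toℕ u) ≡ 0
  fresh⇒multiplicity≡0 []           = refl
  fresh⇒multiplicity≡0 (u≢v ∷ u∉w) =
    cong₂ ℕ._+_ (δℕ-≢ λ eq → u≢v (sym (Fin.toℕ-injective eq))) (fresh⇒multiplicity≡0 u∉w)

  multiplicity≡0⇒fresh : ∀ {n m} {u : Fin n} (w : Vec (Fin n) m) → multiplicity w (toℕ u) ≡ 0 → All (u ≢_) w
  multiplicity≡0⇒fresh         []      eq = []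
  multiplicity≡0⇒fresh {u = u} (v ∷ w) eq =
    (λ { refl → contradiction (trans (sym (δℕ-refl (toℕ u))) (ℕ.m+n≡0⇒m≡0 (δℕ (toℕ u) (toℕ u)) eq)) λ () })
    ∷ multiplicity≡0⇒fresh w (ℕ.m+n≡0⇒n≡0 (δℕ (toℕ v) (toℕ u)) eq)

  Unique⇒multiplicity≤1 : ∀ {n m} {w : Vec (Fin n) m} → Unique w → ∀ v → multiplicity w v ≤ 1
  Unique⇒multiplicity≤1 [] v = z≤n
  Unique⇒multiplicity≤1 {w = u ∷ w} (u∉w ∷ uniq) v with toℕ u ℕ.≟ v
  ... | yes refl rewrite δℕ-refl (toℕ u) | fresh⇒multiplicity≡0 u∉w = s≤s z≤n
  ... | no  u≢v  rewrite δℕ-≢ u≢v = Unique⇒multiplicity≤1 uniq v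

  multiplicity≤1⇒Unique : ∀ {n m} (w : Vec (Fin n) m) → (∀ v → v < n → multiplicity w v ≤ 1) → Unique w
  multiplicity≤1⇒Unique []      h = []
  multiplicity≤1⇒Unique (u ∷ w) h =
    multiplicity≡0⇒fresh w (ℕ.n≤0⇒n≡0 (ℕ.+-cancelˡ-≤ 1 _ _
      (subst (λ x → x ℕ.+ multiplicity w (toℕ u) ≤ 1) (δℕ-refl (toℕ u)) (h (toℕ u) (Fin.toℕ<n u)))))
    ∷ multiplicity≤1⇒Unique w (λ v v<n → ℕ.≤-trans (ℕ.m≤n+m _ (δℕ (toℕ u) v)) (h v v<n))

  ⌊x/2⌋≡0⇒x≤1 : ∀ x → ⌊ x /2⌋ ≡ 0 → x ≤ 1
  ⌊x/2⌋≡0⇒x≤1 zero       _ = z≤n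
  ⌊x/2⌋≡0⇒x≤1 (suc zero) _ = s≤s z≤n

  x≤1⇒⌊x/2⌋≡0 : ∀ {x} → x ≤ 1 → ⌊ x /2⌋ ≡ 0
  x≤1⇒⌊x/2⌋≡0 z≤n       = refl
  x≤1⇒⌊x/2⌋≡0 (s≤s z≤n) = refl

  2*⌊x/2⌋≤x : ∀ x → 2 ℕ.* ⌊ x /2⌋ ≤ x
  2*⌊x/2⌋≤x zero          = z≤n
  2*⌊x/2⌋≤x (suc zero)    = z≤n
  2*⌊x/2⌋≤x (suc (suc x)) rewrite ℕ.*-suc 2 ⌊ x /2⌋ = s≤s (s≤s (2*⌊x/2⌋≤x x))

  *-∑ℕ : ∀ n a f → ∑ℕ n (λ i → a ℕ.* f i) ≡ a ℕ.* ∑ℕ n f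
  *-∑ℕ zero    a f = sym (ℕ.*-zeroʳ a)
  *-∑ℕ (suc n) a f = trans (cong (ℕ._+ (a ℕ.* f n)) (*-∑ℕ n a f)) (sym (ℕ.*-distribˡ-+ a (∑ℕ n f) (f n)))

  2*m≤n⇒m≤⌊n/2⌋ : ∀ {m n} → 2 ℕ.* m ≤ n → m ≤ ⌊ n /2⌋
  2*m≤n⇒m≤⌊n/2⌋ {m} {n} h =
    subst (_≤ ⌊ n /2⌋) (trans (cong ⌊_/2⌋ (cong (m ℕ.+_) (ℕ.+-identityʳ m))) (sym (ℕ.n≡⌊n+n/2⌋ m))) (ℕ.⌊n/2⌋-mono h)

  module _ {n d} (w : Vec (Fin n) d) where

    -- The h of the overview. Each unit uses up two visits to one vertex, whence the bound ⌊d/2⌋; a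
    -- vertex visited at most once adds nothing.
    repetitions : ℕ
    repetitions = ∑ℕ n (λ v → ⌊ multiplicity w v /2⌋)

    ∑-parity : ∑ n (λ v → -1ℤ ^ multiplicity w v) ≡ + n - + 2 * + d + + 4 * + repetitions
    ∑-parity = trans (∑-alternating n (multiplicity w))
      (cong (λ x → + n - + 2 * + x + + 4 * + repetitions) (∑ℕ-multiplicity w))

    repetitions≤⌊d/2⌋ : repetitions ≤ ⌊ d /2⌋
    repetitions≤⌊d/2⌋ = 2*m≤n⇒m≤⌊n/2⌋ (subst₂ _≤_ (*-∑ℕ n 2 _) (∑ℕ-multiplicity w)
      (∑ℕ-mono n λ v → 2*⌊x/2⌋≤x (multiplicity w v)))

    Unique⇒repetitions≡0 : Unique w → repetitions ≡ 0
    Unique⇒repetitions≡0 uniq = ∑ℕ-0 n λ v → x≤1⇒⌊x/2⌋≡0 (Unique⇒multiplicity≤1 uniq v)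

    repetitions≡0⇒Unique : repetitions ≡ 0 → Unique w
    repetitions≡0⇒Unique eq = multiplicity≤1⇒Unique w λ v v<n → ⌊x/2⌋≡0⇒x≤1 (multiplicity w v)
      (ℕ.n≤0⇒n≡0 (subst (⌊ multiplicity w v /2⌋ ≤_) eq (term≤∑ℕ n (λ v → ⌊ multiplicity w v /2⌋) v v<n)))

  -- In closed form 4^j j!, the product of the values 4 (i + 1) that the factors `root i - ∑ z` take
  -- on a sequence without repetition.
  factor : ℕ → ℕ
  factor zero    = 1
  factor (suc j) = factor j ℕ.* (4 ℕ.* suc j)

  ∏-zero : ∀ k i {f : ℕ → ℤ} → i < k → f i ≡ 0ℤ → ∏ k f ≡ 0ℤ
  ∏-zero (suc k) i {f} i<1+k eq with i ℕ.≟ k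
  ... | yes refl = trans (cong (∏ k f *_) eq) (ℤ.*-zeroʳ (∏ k f))
  ... | no  i≢k  = cong (_* f k) (∏-zero k i (ℕ.≤∧≢⇒< (ℕ.s≤s⁻¹ i<1+k) i≢k) eq)

  module _ {n d} (w : Vec (Fin n) d) where

    private
      root-∑ : ∀ i → root n d i - ∑ n (λ v → -1ℤ ^ multiplicity w v) ≡ + 4 * (+ suc i - + repetitions w)
      root-∑ i = trans (cong (λ x → root n d i - x) (∑-parity w)) (lem (+ n) (+ d) (+ suc i) (+ repetitions w))
        where
        lem : ∀ n d i h → (n - + 2 * d + + 4 * i) - (n - + 2 * d + + 4 * h) ≡ + 4 * (i - h)
        lem = solve-∀

    ∏-root-Unique : Unique w → ∀ k →
      ∏ k (λ i → root n d i - ∑ n (λ v → -1ℤ ^ multiplicity w v)) ≡ + factor k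
    ∏-root-Unique uniq zero    = refl
    ∏-root-Unique uniq (suc k) = begin
      _ ≡⟨ cong₂ _*_ (∏-root-Unique uniq k) (root-∑ k) ⟩
      + factor k * (+ 4 * (+ suc k - + repetitions w))
        ≡⟨ cong (λ x → + factor k * (+ 4 * (+ suc k - + x))) (Unique⇒repetitions≡0 w uniq) ⟩
      + factor k * (+ 4 * (+ suc k - 0ℤ))
        ≡⟨ cong (λ x → + factor k * (+ 4 * x)) (ℤ.+-identityʳ (+ suc k)) ⟩
      + factor k * (+ 4 * + suc k)
        ≡⟨ cong (+ factor k *_) (sym (ℤ.pos-* 4 (suc k))) ⟩
      + factor k * + (4 ℕ.* suc k)
        ≡⟨ sym (ℤ.pos-* (factor k) (4 ℕ.* suc k)) ⟩
      + factor (suc k) ∎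

    ∏-root-¬Unique : ¬ Unique w →
      ∏ ⌊ d /2⌋ (λ i → root n d i - ∑ n (λ v → -1ℤ ^ multiplicity w v)) ≡ 0ℤ
    ∏-root-¬Unique ¬uniq with repetitions w in eq
    ... | zero  = contradiction (repetitions≡0⇒Unique w eq) ¬uniq
    -- With suc h repetitions it is the factor of index h that vanishes; it is among the first ⌊d/2⌋
    -- because suc h ≤ ⌊d/2⌋.
    ... | suc h = ∏-zero ⌊ d /2⌋ h (subst (_≤ ⌊ d /2⌋) eq (repetitions≤⌊d/2⌋ w))
      (trans (root-∑ h) (trans (cong (λ x → + 4 * (+ suc h - + x)) eq)
        (trans (cong (+ 4 *_) (ℤ.+-inverseʳ (+ suc h))) refl)))

  -- Ranking of small subsets

  -- #subsets i (suc s) is the number of subsets of size at most s of a set of size i.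
  #subsets : ℕ → ℕ → ℕ
  #subsets _       zero    = 0
  #subsets zero    (suc s) = 1
  #subsets (suc i) (suc s) = #subsets i (suc s) ℕ.+ #subsets i s

  #subsets-0 : ∀ i → #subsets i 0 ≡ 0
  #subsets-0 zero    = refl
  #subsets-0 (suc i) = refl

  -- sign i s r is the characteristic function, with values ±1, of the subset of {0, …, i - 1}
  -- of rank r < #subsets i s, and rest i s r is s less its size.
  sign : ℕ → ℕ → ℕ → ℕ → ℤ
  sign zero    s r v = 1ℤ
  sign (suc i) s r v =
    ifᵇ r <ᵇ #subsets i s
    then (ifᵇ v ≡ᵇ i then 1ℤ else sign i s r v)
    else (ifᵇ v ≡ᵇ i then -1ℤ else sign i (pred s) (r ∸ #subsets i s) v)

  rest : ℕ → ℕ → ℕ → ℕ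
  rest zero    s r = s
  rest (suc i) s r = ifᵇ r <ᵇ #subsets i s then rest i s r else rest i (pred s) (r ∸ #subsets i s)

  private
    <ᵇ-true : ∀ {m n} → m < n → (m <ᵇ n) ≡ true
    <ᵇ-true m<n = T⇒≡true (ℕ.<⇒<ᵇ m<n)

    <ᵇ-false : ∀ {m n} → n ≤ m → (m <ᵇ n) ≡ false
    <ᵇ-false {m} {n} n≤m = ¬T⇒≡false λ t → ℕ.<⇒≱ (ℕ.<ᵇ⇒< m n t) n≤m

  module _ (α : ℕ → ℕ) (c : ℕ → ℤ) where

    private
      z : ℕ → ℤ
      z v = -1ℤ ^ α v

    subsetTerm : ℕ → ℕ → ℕ → ℤ
    subsetTerm i s r = c (rest i s r) * ∏ i (λ v → sign i s r v ^ α v)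

    subsetTerm-out : ∀ i s r → r < #subsets i s → subsetTerm (suc i) s r ≡ subsetTerm i s r
    subsetTerm-out i s r r<b rewrite <ᵇ-true r<b | ≡ᵇ-refl i = cong (c (rest i s r) *_)
      (trans (cong₂ _*_ (∏-cong i λ v v<i → cong (λ x → (ifᵇ x then 1ℤ else sign i s r v) ^ α v) (≡ᵇ-false (ℕ.<⇒≢ v<i)))
                        (ℤ.^-zeroˡ (α i)))
             (ℤ.*-identityʳ _))

    subsetTerm-in : ∀ i s r → subsetTerm (suc i) (suc s) (#subsets i (suc s) ℕ.+ r) ≡ z i * subsetTerm i s r
    subsetTerm-in i s r
      rewrite <ᵇ-false (ℕ.m≤m+n (#subsets i (suc s)) r) | ≡ᵇ-refl i | ℕ.m+n∸m≡n (#subsets i (suc s)) r =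
      trans (cong (λ x → c (rest i s r) * (x * z i))
              (∏-cong i λ v v<i → cong (λ x → (ifᵇ x then -1ℤ else sign i s r v) ^ α v) (≡ᵇ-false (ℕ.<⇒≢ v<i))))
            (lem (c (rest i s r)) (∏ i (λ v → sign i s r v ^ α v)) (z i))
      where
      lem : ∀ c p z → c * (p * z) ≡ z * (c * p)
      lem = solve-∀

    ∑-subsetTerm : ∀ i s → ∑ (#subsets i s) (subsetTerm i s) ≡ ∑ s (λ t → e z i (suc t) * c (s ∸ t))
    ∑-subsetTerm i       zero    = cong (λ m → ∑ m (subsetTerm i 0)) (#subsets-0 i)
    ∑-subsetTerm zero    (suc s) = begin
      0ℤ + c (suc s) * 1ℤ
        ≡⟨ lem (c (suc s)) ⟩
      1ℤ * c (suc s) + 0ℤ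
        ≡⟨ cong (λ y → 1ℤ * c (suc s) + y) (sym (∑-0 s)) ⟩
      1ℤ * c (suc s) + ∑ s (λ _ → 0ℤ)
        ≡⟨ sym (∑-head s (λ t → e z 0 (suc t) * c (suc s ∸ t))) ⟩
      ∑ (suc s) (λ t → e z 0 (suc t) * c (suc s ∸ t)) ∎
      where
      lem : ∀ x → 0ℤ + x * 1ℤ ≡ 1ℤ * x + 0ℤ
      lem = solve-∀
    ∑-subsetTerm (suc i) (suc s) = begin
      ∑ (#subsets i (suc s) ℕ.+ #subsets i s) (subsetTerm (suc i) (suc s))
        ≡⟨ ∑-split (#subsets i (suc s)) (#subsets i s) (subsetTerm (suc i) (suc s)) ⟩
      ∑ (#subsets i (suc s)) (subsetTerm (suc i) (suc s))
        + ∑ (#subsets i s) (λ r → subsetTerm (suc i) (suc s) (#subsets i (suc s) ℕ.+ r))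
        ≡⟨ cong₂ _+_ (∑-cong (#subsets i (suc s)) λ r → subsetTerm-out i (suc s) r)
                     (∑-cong (#subsets i s) λ r _ → subsetTerm-in i s r) ⟩
      ∑ (#subsets i (suc s)) (subsetTerm i (suc s)) + ∑ (#subsets i s) (λ r → z i * subsetTerm i s r)
        ≡⟨ cong₂ _+_ (∑-subsetTerm i (suc s)) (trans (*-∑ (#subsets i s) (z i) (subsetTerm i s)) (cong (z i *_) (∑-subsetTerm i s))) ⟩
      ∑ (suc s) f + z i * ∑ s (λ t → e z i (suc t) * c (s ∸ t))
        -- A term of degree -1, which is 0, is put in front, so that both sums run over the same
        -- range.
        ≡⟨ cong (λ x → ∑ (suc s) f + z i * x)
             (trans (sym (ℤ.+-identityˡ _)) (sym (∑-head s (λ t → e z i t * c (suc s ∸ t))))) ⟩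
      ∑ (suc s) f + z i * ∑ (suc s) (λ t → e z i t * c (suc s ∸ t))
        ≡⟨ cong (λ y → ∑ (suc s) f + y) (sym (*-∑ (suc s) (z i) _)) ⟩
      ∑ (suc s) f + ∑ (suc s) (λ t → z i * (e z i t * c (suc s ∸ t)))
        ≡⟨ sym (∑-+ (suc s) f _) ⟩
      ∑ (suc s) (λ t → e z i (suc t) * c (suc s ∸ t) + z i * (e z i t * c (suc s ∸ t)))
        ≡⟨ ∑-cong (suc s) (λ t _ → lem (e z i (suc t)) (z i) (e z i t) (c (suc s ∸ t))) ⟩
      ∑ (suc s) (λ t → e z (suc i) (suc t) * c (suc s ∸ t)) ∎
      where
      f : ℕ → ℤ
      f t = e z i (suc t) * c (suc s ∸ t)
      lem : ∀ e₁ z e₀ c → e₁ * c + z * (e₀ * c) ≡ (e₁ + z * e₀) * c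
      lem = solve-∀

  -- Sums over lists

  ∑ₗ : ∀ {A : Set} → List A → (A → ℤ) → ℤ
  ∑ₗ []       f = 0ℤ
  ∑ₗ (x ∷ xs) f = f x + ∑ₗ xs f

  module _ {A : Set} where

    ∑ₗ-cong : ∀ (xs : List A) {f g} → (∀ x → f x ≡ g x) → ∑ₗ xs f ≡ ∑ₗ xs g
    ∑ₗ-cong []       h = refl
    ∑ₗ-cong (x ∷ xs) h = cong₂ _+_ (h x) (∑ₗ-cong xs h)

    *-∑ₗ : ∀ (xs : List A) a f → ∑ₗ xs (λ x → a * f x) ≡ a * ∑ₗ xs f
    *-∑ₗ []       a f = sym (ℤ.*-zeroʳ a)
    *-∑ₗ (x ∷ xs) a f = trans (cong (λ y → a * f x + y) (*-∑ₗ xs a f)) (sym (ℤ.*-distribˡ-+ a (f x) (∑ₗ xs f)))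

    ∑ₗ-++ : ∀ (xs ys : List A) f → ∑ₗ (xs ++ ys) f ≡ ∑ₗ xs f + ∑ₗ ys f
    ∑ₗ-++ []       ys f = sym (ℤ.+-identityˡ (∑ₗ ys f))
    ∑ₗ-++ (x ∷ xs) ys f = trans (cong (λ y → f x + y) (∑ₗ-++ xs ys f)) (sym (ℤ.+-assoc (f x) (∑ₗ xs f) (∑ₗ ys f)))

    ∑ₗ-map : ∀ {B : Set} (g : B → A) xs f → ∑ₗ (map g xs) f ≡ ∑ₗ xs (f ∘ g)
    ∑ₗ-map g []       f = refl
    ∑ₗ-map g (x ∷ xs) f = cong (λ y → f (g x) + y) (∑ₗ-map g xs f)

    ∑-∑ₗ-comm : ∀ m (xs : List A) (f : ℕ → A → ℤ) → ∑ m (λ i → ∑ₗ xs (f i)) ≡ ∑ₗ xs (λ x → ∑ m (λ i → f i x))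
    ∑-∑ₗ-comm m []       f = ∑-0 m
    ∑-∑ₗ-comm m (x ∷ xs) f = trans (∑-+ m (λ i → f i x) _) (cong (λ y → ∑ m (λ i → f i x) + y) (∑-∑ₗ-comm m xs f))

    ∑ₗ-filter : ∀ {P : A → Set} (P? : Decidable P) xs →
      ∑ₗ xs (λ x → ifᵇ does (P? x) then 1ℤ else 0ℤ) ≡ + length (filter P? xs)
    ∑ₗ-filter P? [] = refl
    ∑ₗ-filter P? (x ∷ xs) with P? x
    ... | yes _ = cong (λ y → 1ℤ + y) (∑ₗ-filter P? xs)
    ... | no  _ = trans (ℤ.+-identityˡ _) (∑ₗ-filter P? xs)

  ∑ₗ-cartesianProductWith : ∀ {A B C : Set} (g : A → B → C) xs ys f →
    ∑ₗ (cartesianProductWith g xs ys) f ≡ ∑ₗ xs (λ x → ∑ₗ ys (λ y → f (g x y)))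
  ∑ₗ-cartesianProductWith g []       ys f = refl
  ∑ₗ-cartesianProductWith g (x ∷ xs) ys f = trans (∑ₗ-++ (map (g x) ys) _ f)
    (cong₂ _+_ (∑ₗ-map (g x) ys f) (∑ₗ-cartesianProductWith g xs ys f))

  ∑ₗ-tabulate : ∀ {A : Set} m (g : Fin m → A) (F : A → ℤ) (f : ℕ → ℤ) →
    (∀ i → F (g i) ≡ f (toℕ i)) → ∑ₗ (tabulate g) F ≡ ∑ m f
  ∑ₗ-tabulate zero    g F f h = refl
  ∑ₗ-tabulate (suc m) g F f h = trans
    (cong₂ _+_ (h Fin.zero) (∑ₗ-tabulate m (g ∘ Fin.suc) F (f ∘ suc) (h ∘ Fin.suc)))
    (sym (∑-head m f))

  ∑ₗ-sequences-suc : ∀ n m (F : Vec (Fin n) (suc m) → ℤ) (f : ℕ → ℤ) →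
    (∀ u → ∑ₗ (sequences n m) (λ w → F (u ∷ w)) ≡ f (toℕ u)) →
    ∑ₗ (sequences n (suc m)) F ≡ ∑ n f
  ∑ₗ-sequences-suc n m F f h = trans
    (∑ₗ-cartesianProductWith _∷_ (allFin n) (sequences n m) F)
    (∑ₗ-tabulate n (λ u → u) _ f h)

  -- Walks

  -- The sum over the walks of length j from u to v of the product of the weights x of the
  -- vertices after u.
  walks : ℕ → (ℕ → ℕ → ℕ) → (ℕ → ℤ) → ℕ → ℕ → ℕ → ℤ
  walks n a x v zero    u = δ u v
  walks n a x v (suc j) u = ∑ n (λ w → + a u w * x w * walks n a x v j w)

  weight : ∀ {n m} → (ℕ → ℤ) → Vec (Fin n) m → ℤ
  weight x []      = 1ℤ
  weight x (u ∷ w) = x (toℕ u) * weight x w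

  ∏-δℕ : ∀ n (x : ℕ → ℤ) u → u < n → ∏ n (λ v → x v ^ δℕ u v) ≡ x u
  ∏-δℕ (suc n) x u u<1+n with u ℕ.≟ n
  ... | yes refl rewrite δℕ-refl u = trans
    (cong₂ _*_ (trans (∏-cong u λ v v<u → cong (x v ^_) (δℕ-≢ (≢-sym (ℕ.<⇒≢ v<u)))) (∏-1 u)) (ℤ.*-identityʳ (x u)))
    (ℤ.*-identityˡ (x u))
  ... | no  u≢n rewrite δℕ-≢ u≢n = trans (ℤ.*-identityʳ _) (∏-δℕ n x u (ℕ.≤∧≢⇒< (ℕ.s≤s⁻¹ u<1+n) u≢n))

  weight-∏ : ∀ {n m} x (w : Vec (Fin n) m) → weight x w ≡ ∏ n (λ v → x v ^ multiplicity w v)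
  weight-∏ {n} x []      = sym (∏-1 n)
  weight-∏ {n} x (u ∷ w) = begin
    x (toℕ u) * weight x w
      ≡⟨ cong₂ _*_ (sym (∏-δℕ n x (toℕ u) (Fin.toℕ<n u))) (weight-∏ x w) ⟩
    ∏ n (λ v → x v ^ δℕ (toℕ u) v) * ∏ n (λ v → x v ^ multiplicity w v)
      ≡⟨ sym (∏-* n _ _) ⟩
    ∏ n (λ v → x v ^ δℕ (toℕ u) v * x v ^ multiplicity w v)
      ≡⟨ ∏-cong n (λ v _ → sym (ℤ.^-distribˡ-+-* (x v) (δℕ (toℕ u) v) (multiplicity w v))) ⟩
    ∏ n (λ v → x v ^ multiplicity (u ∷ w) v) ∎

  -- The matrix is a parameter so that it can later be the function that reads the input cells of
  -- the machine.
  module _ {n} (G : Digraph n) (a : ℕ → ℕ → ℕ) (a≡G : ∀ u v → a (toℕ u) (toℕ v) ≡ bit (G u v)) where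

    path : ∀ {m} → Fin n → Vec (Fin n) m → ℤ
    path u []      = 1ℤ
    path u (v ∷ w) = + a (toℕ u) (toℕ v) * path v w

    walks-∑ₗ : ∀ x v m (u : Fin n) →
      ∑ₗ (sequences n m) (λ w → path u w * weight x w * δ (toℕ (last (u ∷ w))) v) ≡ walks n a x v m (toℕ u)
    walks-∑ₗ x v zero    u = trans (ℤ.+-identityʳ _) (ℤ.*-identityˡ (δ (toℕ u) v))
    walks-∑ₗ x v (suc m) u = ∑ₗ-sequences-suc n m _ _ λ u₁ → begin
      ∑ₗ (sequences n m) (λ w → A u₁ * path u₁ w * (x (toℕ u₁) * weight x w) * δ (toℕ (last (u₁ ∷ w))) v)
        ≡⟨ ∑ₗ-cong (sequences n m) (λ w → lem (A u₁) (path u₁ w) (x (toℕ u₁)) (weight x w) _) ⟩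
      ∑ₗ (sequences n m) (λ w → A u₁ * x (toℕ u₁) * (path u₁ w * weight x w * δ (toℕ (last (u₁ ∷ w))) v))
        ≡⟨ *-∑ₗ (sequences n m) (A u₁ * x (toℕ u₁)) _ ⟩
      A u₁ * x (toℕ u₁) * ∑ₗ (sequences n m) (λ w → path u₁ w * weight x w * δ (toℕ (last (u₁ ∷ w))) v)
        ≡⟨ cong (A u₁ * x (toℕ u₁) *_) (walks-∑ₗ x v m u₁) ⟩
      A u₁ * x (toℕ u₁) * walks n a x v m (toℕ u₁) ∎
      where
      A : Fin n → ℤ
      A u₁ = + a (toℕ u) (toℕ u₁)
      lem : ∀ a p x w δ → a * p * (x * w) * δ ≡ a * x * (p * w * δ)
      lem = solve-∀

    closed : ∀ {m} → Vec (Fin n) (suc m) → ℤ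
    closed (u ∷ w) = + a (toℕ (last (u ∷ w))) (toℕ u) * path u w

    -- A closed walk v → u → ... → v is recorded as the sequence that starts at u and ends at v.
    -- `walks` leaves its starting vertex unweighted, but here it is also the last one, so every
    -- entry of the sequence is weighted exactly once.
    ∑-walks : ∀ x m →
      ∑ n (λ v → walks n a x v (suc m) v) ≡ ∑ₗ (sequences n (suc m)) (λ w → closed w * weight x w)
    ∑-walks x m = begin
      ∑ n (λ v → ∑ n (λ u → + a v u * x u * walks n a x v m u))
        ≡⟨ ∑-comm n n _ ⟩
      ∑ n (λ u → ∑ n (λ v → + a v u * x u * walks n a x v m u))
        ≡⟨ sym (∑ₗ-sequences-suc n m _ _ from) ⟩
      ∑ₗ (sequences n (suc m)) (λ w → closed w * weight x w) ∎
      where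
      lem : ∀ a x p w δ → a * x * (p * w * δ) ≡ p * (x * w) * (a * δ)
      lem = solve-∀
      lem′ : ∀ p y a → p * y * a ≡ a * p * y
      lem′ = solve-∀
      from : ∀ u → ∑ₗ (sequences n m) (λ w → closed (u ∷ w) * weight x (u ∷ w)) ≡
        ∑ n (λ v → + a v (toℕ u) * x (toℕ u) * walks n a x v m (toℕ u))
      from u = begin
        ∑ₗ (sequences n m) (λ w → closed (u ∷ w) * weight x (u ∷ w))
          ≡⟨ ∑ₗ-cong (sequences n m) (λ w → sym (end w)) ⟩
        ∑ₗ (sequences n m) (λ w → ∑ n (λ v → + a v (toℕ u) * x (toℕ u) * (path u w * weight x w * δ (toℕ (last (u ∷ w))) v)))
          ≡⟨ sym (∑-∑ₗ-comm n (sequences n m) _) ⟩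
        ∑ n (λ v → ∑ₗ (sequences n m) (λ w → + a v (toℕ u) * x (toℕ u) * (path u w * weight x w * δ (toℕ (last (u ∷ w))) v)))
          ≡⟨ ∑-cong n (λ v _ → trans (*-∑ₗ (sequences n m) (+ a v (toℕ u) * x (toℕ u)) _)
               (cong (+ a v (toℕ u) * x (toℕ u) *_) (walks-∑ₗ x v m u))) ⟩
        ∑ n (λ v → + a v (toℕ u) * x (toℕ u) * walks n a x v m (toℕ u)) ∎
        where
        end : ∀ w → ∑ n (λ v → + a v (toℕ u) * x (toℕ u) * (path u w * weight x w * δ (toℕ (last (u ∷ w))) v)) ≡
          closed (u ∷ w) * weight x (u ∷ w)
        end w = begin
          ∑ n (λ v → + a v (toℕ u) * x (toℕ u) * (path u w * weight x w * δ (toℕ (last (u ∷ w))) v))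
            ≡⟨ ∑-cong n (λ v _ → lem (+ a v (toℕ u)) (x (toℕ u)) (path u w) (weight x w) _) ⟩
          ∑ n (λ v → path u w * weight x (u ∷ w) * (+ a v (toℕ u) * δ (toℕ (last (u ∷ w))) v))
            ≡⟨ *-∑ n (path u w * weight x (u ∷ w)) _ ⟩
          path u w * weight x (u ∷ w) * ∑ n (λ v → + a v (toℕ u) * δ (toℕ (last (u ∷ w))) v)
            ≡⟨ cong (path u w * weight x (u ∷ w) *_)
                 (∑-δ n (λ v → + a v (toℕ u)) (toℕ (last (u ∷ w))) (Fin.toℕ<n (last (u ∷ w)))) ⟩
          path u w * weight x (u ∷ w) * + a (toℕ (last (u ∷ w))) (toℕ u)
            ≡⟨ lem′ (path u w) (weight x (u ∷ w)) (+ a (toℕ (last (u ∷ w))) (toℕ u)) ⟩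
          closed (u ∷ w) * weight x (u ∷ w) ∎

    edge-cases : ∀ u v → (Edge G u v × + a (toℕ u) (toℕ v) ≡ 1ℤ) ⊎ (¬ Edge G u v × + a (toℕ u) (toℕ v) ≡ 0ℤ)
    edge-cases u v with G u v in eq
    ... | true  = inj₁ (refl , cong +_ (trans (a≡G u v) (cong bit eq)))
    ... | false = inj₂ ((λ ()) , cong +_ (trans (a≡G u v) (cong bit eq)))

    path-cases : ∀ {m} u (w : Vec (Fin n) m) →
      (Linked (Edge G) (u ∷ w) × path u w ≡ 1ℤ) ⊎ (¬ Linked (Edge G) (u ∷ w) × path u w ≡ 0ℤ)
    path-cases u []      = inj₁ ([-] , refl)
    path-cases u (v ∷ w) with edge-cases u v | path-cases v w
    ... | inj₁ (uv , p) | inj₁ (vw , q) = inj₁ (uv ∷ vw , cong₂ _*_ p q)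
    ... | inj₁ (uv , p) | inj₂ (vw , q) = inj₂ ((λ { (_ ∷ l) → vw l }) , cong₂ _*_ p q)
    ... | inj₂ (uv , p) | _             = inj₂ ((λ { (l ∷ _) → uv l }) , cong (_* path v w) p)

    closed-cases : ∀ {m} (w : Vec (Fin n) (suc m)) →
      (IsClosedWalk G w × closed w ≡ 1ℤ) ⊎ (¬ IsClosedWalk G w × closed w ≡ 0ℤ)
    closed-cases (u ∷ w) with edge-cases (last (u ∷ w)) u | path-cases u w
    ... | inj₁ (uv , p) | inj₁ (vw , q) = inj₁ ((vw , uv) , cong₂ _*_ p q)
    ... | inj₁ (uv , p) | inj₂ (vw , q) = inj₂ ((λ (l , _) → vw l) , cong₂ _*_ p q)
    ... | inj₂ (uv , p) | _             = inj₂ ((λ (_ , l) → uv l) , cong (_* path u w) p)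

    -- Budgets are one more than the allowed size, as in `#subsets`; subtracting the rest from the
    -- full budget recovers the size of the subset.
    signedSum : ℕ → ℤ
    signedSum d = ∑ (#subsets n (suc ⌊ d /2⌋)) λ r →
      coeff n d ⌊ d /2⌋ (suc ⌊ d /2⌋ ∸ rest n (suc ⌊ d /2⌋) r) *
      ∑ n (λ v → walks n a (sign n (suc ⌊ d /2⌋) r) v d v)

    ∑-subsets : ∀ {d} (w : Vec (Fin n) d) →
      ∑ (#subsets n (suc ⌊ d /2⌋)) (λ r →
        coeff n d ⌊ d /2⌋ (suc ⌊ d /2⌋ ∸ rest n (suc ⌊ d /2⌋) r) * weight (sign n (suc ⌊ d /2⌋) r) w) ≡
      ∏ ⌊ d /2⌋ (λ i → root n d i - ∑ n (λ v → -1ℤ ^ multiplicity w v))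
    ∑-subsets {d} w = begin
      ∑ (#subsets n K) (λ r → c (rest n K r) * weight (sign n K r) w)
        ≡⟨ ∑-cong (#subsets n K) (λ r _ → cong (c (rest n K r) *_) (weight-∏ (sign n K r) w)) ⟩
      ∑ (#subsets n K) (subsetTerm (multiplicity w) c n K)
        ≡⟨ ∑-subsetTerm (multiplicity w) c n K ⟩
      ∑ K (λ t → e z n (suc t) * coeff n d ⌊ d /2⌋ (K ∸ (K ∸ t)))
        ≡⟨ ∑-cong K (λ t t<K → cong (λ s → e z n (suc t) * coeff n d ⌊ d /2⌋ s) (ℕ.m∸[m∸n]≡n (ℕ.<⇒≤ t<K))) ⟩
      ∑ K (λ t → e z n (suc t) * coeff n d ⌊ d /2⌋ t)
        ≡⟨ ∑-coeff n d z (λ v → -1^-square (multiplicity w v)) ⌊ d /2⌋ K (ℕ.n<1+n ⌊ d /2⌋) ⟩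
      ∏ ⌊ d /2⌋ (λ i → root n d i - ∑ n z) ∎
      where
      K : ℕ
      K = suc ⌊ d /2⌋
      c z : ℕ → ℤ
      c s = coeff n d ⌊ d /2⌋ (K ∸ s)
      z v = -1ℤ ^ multiplicity w v

    -- After interchanging the sums, the sum over the subsets stands inside and acts on one sequence
    -- at a time, where it becomes the product that vanishes on repetitions.
    signedSum≡ : ∀ m → signedSum (suc m) ≡ + factor ⌊ suc m /2⌋ * + #simpleCycles G (suc m)
    signedSum≡ m = begin
      ∑ B (λ r → c r * ∑ n (λ v → walks n a (x r) v d v))
        ≡⟨ ∑-cong B (λ r _ → trans (cong (c r *_) (∑-walks (x r) m)) (sym (*-∑ₗ W (c r) _))) ⟩
      ∑ B (λ r → ∑ₗ W (λ w → c r * (closed w * weight (x r) w)))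
        ≡⟨ ∑-∑ₗ-comm B W _ ⟩
      ∑ₗ W (λ w → ∑ B (λ r → c r * (closed w * weight (x r) w)))
        ≡⟨ ∑ₗ-cong W (λ w → trans (∑-cong B λ r _ → lem (c r) (closed w) (weight (x r) w)) (*-∑ B (closed w) _)) ⟩
      ∑ₗ W (λ w → closed w * ∑ B (λ r → c r * weight (x r) w))
        ≡⟨ ∑ₗ-cong W (λ w → trans (cong (closed w *_) (∑-subsets w)) (contribution w (isSimpleCycle? G w))) ⟩
      ∑ₗ W (λ w → + factor k * (ifᵇ does (isSimpleCycle? G w) then 1ℤ else 0ℤ))
        ≡⟨ *-∑ₗ W (+ factor k) _ ⟩
      + factor k * ∑ₗ W (λ w → ifᵇ does (isSimpleCycle? G w) then 1ℤ else 0ℤ)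
        ≡⟨ cong (+ factor k *_) (∑ₗ-filter (isSimpleCycle? G) W) ⟩
      + factor k * + #simpleCycles G d ∎
      where
      d k B : ℕ
      d = suc m
      k = ⌊ d /2⌋
      B = #subsets n (suc k)
      W : List (Vec (Fin n) d)
      W = sequences n d
      c : ℕ → ℤ
      c r = coeff n d k (suc k ∸ rest n (suc k) r)
      x : ℕ → ℕ → ℤ
      x r = sign n (suc k) r
      lem : ∀ c p w → c * (p * w) ≡ p * (c * w)
      lem = solve-∀
      contribution : ∀ (w : Vec (Fin n) d) (simple? : Dec (IsSimpleCycle G w)) →
        closed w * ∏ k (λ i → root n d i - ∑ n (λ v → -1ℤ ^ multiplicity w v)) ≡
        + factor k * (ifᵇ does simple? then 1ℤ else 0ℤ)
      contribution w simple? with simple? | closed-cases w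
      ... | yes (_ , uniq) | inj₁ (_ , eq) = trans (cong₂ _*_ eq (∏-root-Unique w uniq k))
                                                   (ℤ.*-comm 1ℤ (+ factor k))
      ... | yes (cl , _)   | inj₂ (¬cl , _) = contradiction cl ¬cl
      ... | no ¬simple     | inj₁ (cl , eq) = trans (cong₂ _*_ eq (∏-root-¬Unique w λ uniq → ¬simple (cl , uniq)))
                                                    (sym (ℤ.*-zeroʳ (+ factor k)))
      ... | no _           | inj₂ (_ , eq)  = trans (cong (_* ∏ k (λ i → root n d i - ∑ n (λ v → -1ℤ ^ multiplicity w v))) eq)
                                                    (sym (ℤ.*-zeroʳ (+ factor k)))

open import Data.Bool.Base using (T; true; false) renaming (if_then_else_ to ifᵇ_then_else_)
open import Data.Fin.Base using (Fin; zero; suc; toℕ)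
import Data.Fin.Properties as Fin
open import Data.Integer.Base using (ℤ; -[1+_]; 0ℤ; 1ℤ; -1ℤ) renaming (+_ to pos; _+_ to _+ᶻ_; _*_ to _*ᶻ_; _-_ to _-ᶻ_; -_ to -ᶻ_)
import Data.Integer.Properties as ℤ
import Data.Integer.Tactic.RingSolver as ℤ-Solver
open import Data.List.Base using (List; []; _∷_; _++_; map; length; filter; tabulate; allFin; cartesianProductWith)
import Data.List.Properties as List
import Data.List.Relation.Unary.All as All
open import Data.Nat.Base
open import Data.Nat.Combinatorics using (_C_; nCk+nC[k+1]≡[n+1]C[k+1]; nC1≡n; nCk≡nC[n∸k]; nCn≡1)
open import Data.Nat.DivMod using ([m+kn]%n≡m%n; m<n⇒m%n≡m; m/n≤m; m/n<m; m*n/n≡m; m%n<n; m≡m%n+[m/n]*n; m%n≡m∸m/n*n; m/n≡1+[m∸n]/n)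
open import Data.Nat.Induction using (<-rec)
open import Data.Nat.Logarithm
open import Data.Nat.Properties
open import Data.Nat.Tactic.RingSolver using (solve-∀)
open import Data.Product.Base using (_×_; _,_; proj₁; proj₂; ∃-syntax)
open import Data.Unit.Base using (⊤; tt)
open import Data.Vec.Base using (Vec; []; _∷_; lookup)
open import Data.Vec.Relation.Unary.Unique.Propositional using (Unique)
open import Function.Base using (_∘_)
open import Relation.Binary.Definitions using (tri<; tri≈; tri>)
open import Relation.Binary.PropositionalEquality
open import Relation.Nullary.Decidable.Core using (Dec; yes; no)
open import Relation.Nullary.Negation.Core using (¬_; contradiction)
open SignedCount

-- Binary length

x<2^∥x∥ : ∀ x → x < 2 ^ ∥ x ∥
x<2^∥x∥ = <-rec _ step
  where
  step : ∀ x → (∀ {y} → y < x → y < 2 ^ ∥ y ∥) → x < 2 ^ ∥ x ∥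
  step zero          _   = s≤s z≤n
  step (suc zero)    _   = s≤s (s≤s z≤n)
  step (suc (suc x)) rec = begin-strict
    suc (suc x)                             ≤⟨ n≤1+2⌊n/2⌋ (suc (suc x)) ⟩
    suc (2 * ⌊ suc (suc x) /2⌋)             <⟨ n<1+n _ ⟩
    suc (suc (2 * h))                       ≡⟨ *-suc 2 h ⟨
    2 * suc h                               ≤⟨ *-monoʳ-≤ 2 (rec (⌊n/2⌋<n (suc x))) ⟩
    2 * 2 ^ suc ⌊log₂ h ⌋                   ≡⟨ cong (λ l → 2 ^ suc (suc l)) (⌊log₂⌊n/2⌋⌋≡⌊log₂n⌋∸1 (suc (suc x))) ⟩
    2 ^ suc (suc (⌊log₂ suc (suc x) ⌋ ∸ 1)) ≡⟨ cong (λ l → 2 ^ suc l) (m+[n∸m]≡n (⌊log₂⌋-mono-≤ {2} {suc (suc x)} (s≤s (s≤s z≤n)))) ⟩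
    2 ^ ∥ suc (suc x) ∥                     ∎
    where
    open ≤-Reasoning
    h : ℕ
    h = ⌊ suc (suc x) /2⌋
    n≤1+2⌊n/2⌋ : ∀ n → n ≤ suc (2 * ⌊ n /2⌋)
    n≤1+2⌊n/2⌋ zero          = z≤n
    n≤1+2⌊n/2⌋ (suc zero)    = s≤s z≤n
    n≤1+2⌊n/2⌋ (suc (suc n)) rewrite *-suc 2 ⌊ n /2⌋ = s≤s (s≤s (n≤1+2⌊n/2⌋ n))

x<2^m⇒∥x∥≤m : ∀ {x m} → 1 ≤ m → x < 2 ^ m → ∥ x ∥ ≤ m
x<2^m⇒∥x∥≤m {x} {suc m} _ x<2^m = s≤s (go m x x<2^m)
  where
  go : ∀ m x → x < 2 ^ suc m → ⌊log₂ x ⌋ ≤ m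
  go zero    zero          _ = z≤n
  go zero    (suc zero)    _ = z≤n
  go zero    (suc (suc x)) (s≤s (s≤s ()))
  go (suc m) x             h = ≤-trans (m≤n+m∸n ⌊log₂ x ⌋ 1) (s≤s (begin
    ⌊log₂ x ⌋ ∸ 1     ≡⟨ ⌊log₂⌊n/2⌋⌋≡⌊log₂n⌋∸1 x ⟨
    ⌊log₂ ⌊ x /2⌋ ⌋   ≤⟨ go m ⌊ x /2⌋ (*-cancelˡ-< 2 _ _ (≤-<-trans (2*⌊x/2⌋≤x x) h)) ⟩
    m                 ∎))
    where
    open ≤-Reasoning

∥∥-mono : ∀ {x y} → x ≤ y → ∥ x ∥ ≤ ∥ y ∥
∥∥-mono x≤y = s≤s (⌊log₂⌋-mono-≤ x≤y)

∥*∥ : ∀ x y → ∥ x * y ∥ ≤ ∥ x ∥ + ∥ y ∥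
∥*∥ x y = x<2^m⇒∥x∥≤m (s≤s z≤n) (begin-strict
  x * y                   <⟨ *-mono-< (x<2^∥x∥ x) (x<2^∥x∥ y) ⟩
  2 ^ ∥ x ∥ * 2 ^ ∥ y ∥   ≡⟨ ^-distribˡ-+-* 2 ∥ x ∥ ∥ y ∥ ⟨
  2 ^ (∥ x ∥ + ∥ y ∥)     ∎)
  where open ≤-Reasoning

∥+∥ : ∀ x y → ∥ x + y ∥ ≤ ∥ x ∥ + ∥ y ∥
∥+∥ x y = x<2^m⇒∥x∥≤m (s≤s z≤n) (begin-strict
  x + y                             <⟨ +-mono-< (x<2^∥x∥ x) (x<2^∥x∥ y) ⟩
  2 ^ ∥ x ∥ + 2 ^ ∥ y ∥             ≤⟨ +-mono-≤ (^-monoʳ-≤ 2 (s≤s (m≤m+n ⌊log₂ x ⌋ ⌊log₂ y ⌋))) (^-monoʳ-≤ 2 (s≤s (m≤n+m ⌊log₂ y ⌋ ⌊log₂ x ⌋))) ⟩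
  2 ^ suc l + 2 ^ suc l             ≡⟨ cong (2 ^ suc l +_) (+-identityʳ (2 ^ suc l)) ⟨
  2 ^ suc (suc l)                   ≡⟨ cong (2 ^_) (cong suc (+-suc ⌊log₂ x ⌋ ⌊log₂ y ⌋)) ⟨
  2 ^ (∥ x ∥ + ∥ y ∥)               ∎)
  where
  open ≤-Reasoning
  l : ℕ
  l = ⌊log₂ x ⌋ + ⌊log₂ y ⌋

∥x∥≤1+x : ∀ x → ∥ x ∥ ≤ suc x
∥x∥≤1+x x = x<2^m⇒∥x∥≤m (s≤s z≤n) (x<2^1+x x)
  where
  x<2^1+x : ∀ x → x < 2 ^ suc x
  x<2^1+x zero    = s≤s z≤n
  x<2^1+x (suc x) = begin-strict
    suc x                     <⟨ s≤s (x<2^1+x x) ⟩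
    1 + 2 ^ suc x             ≤⟨ +-monoˡ-≤ (2 ^ suc x) (m^n>0 2 (suc x)) ⟩
    2 ^ suc x + 2 ^ suc x     ≡⟨ cong (2 ^ suc x +_) (+-identityʳ (2 ^ suc x)) ⟨
    2 ^ suc (suc x)           ∎
    where open ≤-Reasoning

-- One bound for all four operations suffices, as the product is the worst case. Lengths therefore
-- add up along an expression, and its shape alone determines the constant.
∥op∥ : ∀ o x y → ∥ ⟦ o ⟧ᵒ x y ∥ ≤ ∥ x ∥ + ∥ y ∥
∥op∥ add x y       = ∥+∥ x y
∥op∥ sub x y       = ≤-trans (∥∥-mono (m∸n≤m x y)) (m≤m+n ∥ x ∥ ∥ y ∥)
∥op∥ mul x y       = ∥*∥ x y
∥op∥ div x zero    = ≤-trans (∥∥-mono {0} {x} z≤n) (m≤m+n ∥ x ∥ 1)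
∥op∥ div x (suc y) = ≤-trans (∥∥-mono (m/n≤m x (suc y))) (m≤m+n ∥ x ∥ ∥ suc y ∥)

-- The length of the value of an expression and its cost, in multiples of the length of the
-- largest number in memory

lengthFactor : Expr → ℕ
lengthFactor (lit k)      = suc k
lengthFactor (load e)     = 1
lengthFactor (op _ e₁ e₂) = lengthFactor e₁ + lengthFactor e₂

costFactor : Expr → ℕ
costFactor (lit k)      = suc k
costFactor (load e)     = costFactor e + 1
costFactor (op _ e₁ e₂) = costFactor e₁ + costFactor e₂ + (lengthFactor e₁ + lengthFactor e₂)

module _ {V σ} (σ≤V : ∀ a → read σ a ≤ V) where

  open ≤-Reasoning

  private
    lit≤ : ∀ k → ∥ k ∥ ≤ suc k * ∥ V ∥
    lit≤ k = ≤-trans (∥x∥≤1+x k) (m≤m*n (suc k) ∥ V ∥)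

  -- Only cell contents are bounded by V. A load brings the length back to a single ∥ V ∥, whatever
  -- the length of its address, while an operation adds the lengths of its operands.
  ∥eval∥≤ : ∀ e → ∥ eval e σ ∥ ≤ lengthFactor e * ∥ V ∥
  ∥eval∥≤ (lit k)      = lit≤ k
  ∥eval∥≤ (load e)     = ≤-trans (∥∥-mono (σ≤V (eval e σ))) (m≤m+n ∥ V ∥ 0)
  ∥eval∥≤ (op o e₁ e₂) = begin
    ∥ ⟦ o ⟧ᵒ (eval e₁ σ) (eval e₂ σ) ∥               ≤⟨ ∥op∥ o (eval e₁ σ) (eval e₂ σ) ⟩
    ∥ eval e₁ σ ∥ + ∥ eval e₂ σ ∥                    ≤⟨ +-mono-≤ (∥eval∥≤ e₁) (∥eval∥≤ e₂) ⟩
    lengthFactor e₁ * ∥ V ∥ + lengthFactor e₂ * ∥ V ∥ ≡⟨ *-distribʳ-+ ∥ V ∥ (lengthFactor e₁) (lengthFactor e₂) ⟨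
    (lengthFactor e₁ + lengthFactor e₂) * ∥ V ∥      ∎

  cost≤ : ∀ e → cost e σ ≤ costFactor e * ∥ V ∥
  cost≤ (lit k)        = lit≤ k
  cost≤ e@(load e₁)    = begin
    cost e₁ σ + ∥ eval e σ ∥                         ≤⟨ +-mono-≤ (cost≤ e₁) (∥eval∥≤ e) ⟩
    costFactor e₁ * ∥ V ∥ + 1 * ∥ V ∥                ≡⟨ *-distribʳ-+ ∥ V ∥ (costFactor e₁) 1 ⟨
    (costFactor e₁ + 1) * ∥ V ∥                      ∎
  cost≤ e@(op _ e₁ e₂) = begin
    cost e₁ σ + cost e₂ σ + ∥ eval e σ ∥
      ≤⟨ +-mono-≤ (+-mono-≤ (cost≤ e₁) (cost≤ e₂)) (∥eval∥≤ e) ⟩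
    costFactor e₁ * ∥ V ∥ + costFactor e₂ * ∥ V ∥ + lengthFactor e * ∥ V ∥
      ≡⟨ cong (_+ lengthFactor e * ∥ V ∥) (*-distribʳ-+ ∥ V ∥ (costFactor e₁) (costFactor e₂)) ⟨
    (costFactor e₁ + costFactor e₂) * ∥ V ∥ + lengthFactor e * ∥ V ∥
      ≡⟨ *-distribʳ-+ ∥ V ∥ (costFactor e₁ + costFactor e₂) (lengthFactor e) ⟨
    costFactor e * ∥ V ∥                             ∎

size≤ : ∀ {V} σ → (∀ a → read σ a ≤ V) → size σ ≤ length σ * ∥ V ∥
size≤ []      h = z≤n
size≤ (x ∷ σ) h = +-mono-≤ (∥∥-mono (h 0)) (size≤ σ (h ∘ suc))

-- Memory

read-write-≡ : ∀ σ a x → read (write σ a x) a ≡ x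
read-write-≡ []      zero    x = refl
read-write-≡ []      (suc a) x = read-write-≡ [] a x
read-write-≡ (_ ∷ σ) zero    x = refl
read-write-≡ (_ ∷ σ) (suc a) x = read-write-≡ σ a x

read-write-≢ : ∀ σ a x {a′} → a′ ≢ a → read (write σ a x) a′ ≡ read σ a′
read-write-≢ []      zero    x {zero}   h = contradiction refl h
read-write-≢ []      zero    x {suc a′} h = refl
read-write-≢ []      (suc a) x {zero}   h = refl
read-write-≢ []      (suc a) x {suc a′} h = read-write-≢ [] a x (h ∘ cong suc)
read-write-≢ (y ∷ σ) zero    x {zero}   h = contradiction refl h
read-write-≢ (y ∷ σ) zero    x {suc a′} h = refl
read-write-≢ (y ∷ σ) (suc a) x {zero}   h = refl
read-write-≢ (y ∷ σ) (suc a) x {suc a′} h = read-write-≢ σ a x (h ∘ cong suc)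

length-write : ∀ {l} σ a x → length σ ≤ l → a < l → length (write σ a x) ≤ l
length-write []      zero    x _         a<l       = a<l
length-write []      (suc a) x z≤n       (s≤s a<l) = s≤s (length-write [] a x z≤n a<l)
length-write (_ ∷ σ) zero    x σ≤l       _         = σ≤l
length-write (_ ∷ σ) (suc a) x (s≤s σ≤l) (s≤s a<l) = s≤s (length-write σ a x σ≤l a<l)

write-≤ : ∀ {V} σ a x → (∀ a′ → read σ a′ ≤ V) → x ≤ V → ∀ a′ → read (write σ a x) a′ ≤ V
write-≤ {V} σ a x σ≤V x≤V a′ with a′ ≟ a
... | yes refl = subst (_≤ V) (sym (read-write-≡ σ a x)) x≤V
... | no  a′≢a = subst (_≤ V) (sym (read-write-≢ σ a x a′≢a)) (σ≤V a′)

-- A small language on top of the machine: registers (r , i) with r < 15, and for-loops,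
-- whose limits and counters are kept in the registers (15 , i).

infixl 9 _[_↦_]

_[_↦_] : (ℕ → ℕ) → ℕ → ℕ → ℕ → ℕ
(f [ i ↦ x ]) i′ = ifᵇ i ≡ᵇ i′ then x else f i′

State : Set
State = ℕ → ℕ → ℕ

update : State → ℕ → ℕ → ℕ → State
update st r i x r′ = ifᵇ r ≡ᵇ r′ then st r′ [ i ↦ x ] else st r′

[↦]-≡ : ∀ (f : ℕ → ℕ) i {x} → (f [ i ↦ x ]) i ≡ x
[↦]-≡ f i rewrite ≡ᵇ-refl i = refl

[↦]-≢ : ∀ (f : ℕ → ℕ) {i i′} {x} → i ≢ i′ → (f [ i ↦ x ]) i′ ≡ f i′
[↦]-≢ f i≢i′ rewrite ≡ᵇ-false i≢i′ = refl

data Exp (k : ℕ) : Set where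
  lit   : ℕ → Exp k
  n′ d′ : Exp k
  var   : Fin k → Exp k
  arr   : (r : ℕ) {_ : T (r <ᵇ 15)} → Exp k → Exp k
  adj   : Exp k → Exp k
  op    : Op → Exp k → Exp k → Exp k

nᵉ : Expr
nᵉ = load (lit 0)

-- Sixteen arrays are interleaved behind the input, so none needs a length fixed in advance; the
-- residue modulo 16 tells them apart. The base of the addresses depends on n, which is read from
-- cell 0 each time.
registerᵉ : ℕ → Expr → Expr
registerᵉ r e = op add (op add (op mul nᵉ nᵉ) (lit 2)) (op add (op mul e (lit 16)) (lit r))

-- From de Bruijn indices to levels: cells are numbered from the outermost loop, so entering an
-- inner loop does not move the variables of the enclosing ones.
level : ∀ {k} → Fin k → ℕ
level {suc k} zero    = k
level {suc k} (suc j) = level j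

-- The index of adj is truncated to the size of the adjacency matrix.
compile : ∀ {k} → Exp k → Expr
compile (lit m)      = lit m
compile n′           = nᵉ
compile d′           = load (lit 1)
compile (var j)      = load (registerᵉ 15 (lit (level j)))
compile (arr r e)    = load (registerᵉ r (compile e))
compile (adj e)      = load (op add (lit 2)
  (op sub (compile e) (op sub (compile e) (op sub (op mul nᵉ nᵉ) (lit 1)))))
compile (op o e₁ e₂) = op o (compile e₁) (compile e₂)

infix 6 _⟪_⟫≔_

_⟪_⟫≔_ : ∀ {k} → ℕ → Exp k → Exp k → Program
r ⟪ e₁ ⟫≔ e₂ = registerᵉ r (compile e₁) ≔ compile e₂

module Loop (k : ℕ) where

  limitᵉ counterᵉ : Expr
  limitᵉ   = registerᵉ 15 (lit k)
  counterᵉ = registerᵉ 15 (lit (suc k))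

  conditionᵉ : Expr
  conditionᵉ = op sub (load limitᵉ) (load counterᵉ)

  countUp : Program → Program
  countUp P = while conditionᵉ loop (P ⨟ counterᵉ ≔ op add (load counterᵉ) (lit 1))

for_loop_ : ∀ {k} → Exp k → Program → Program
for_loop_ {k} e P = limitᵉ ≔ compile e ⨟ counterᵉ ≔ lit 0 ⨟ countUp P
  where open Loop k

-- A program logic with time and space bounds

module Machine (n d : ℕ) (σ₀ : Memory) (V X W : ℕ) (n>0 : 1 ≤ n) (n≤V : n ≤ V)
  (σ₀-n : read σ₀ 0 ≡ n) (σ₀-d : read σ₀ 1 ≡ d)
  where

  register : ℕ → ℕ → ℕ
  register r i = n * n + 2 + (i * 16 + r)

  register-injective : ∀ r r′ i i′ → r < 16 → r′ < 16 → register r i ≡ register r′ i′ → r ≡ r′ × i ≡ i′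
  register-injective r r′ i i′ r<16 r′<16 eq = r≡r′ , *-cancelʳ-≡ i i′ 16 (+-cancelʳ-≡ r (i * 16) (i′ * 16)
      (trans eq′ (cong (i′ * 16 +_) (sym r≡r′))))
    where
    eq′ : i * 16 + r ≡ i′ * 16 + r′
    eq′ = +-cancelˡ-≡ (n * n + 2) _ _ eq
    mod : ∀ r i → r < 16 → (i * 16 + r) % 16 ≡ r
    mod r i r<16 = trans (cong (_% 16) (+-comm (i * 16) r)) (trans ([m+kn]%n≡m%n r i 16) (m<n⇒m%n≡m r<16))
    r≡r′ : r ≡ r′
    r≡r′ = trans (sym (mod r i r<16)) (trans (cong (_% 16) eq′) (mod r′ i′ r′<16))

  L : ℕ
  L = n * n + 2 + X * 16

  register<L : ∀ {r i} → r < 16 → i < X → register r i < L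
  register<L {r} {i} r<16 i<X = +-monoʳ-< (n * n + 2) (begin-strict
    i * 16 + r   <⟨ +-monoʳ-< (i * 16) r<16 ⟩
    i * 16 + 16  ≡⟨ +-comm (i * 16) 16 ⟩
    suc i * 16   ≤⟨ *-monoˡ-≤ 16 i<X ⟩
    X * 16       ∎)
    where open ≤-Reasoning

  input<register : ∀ r i {a} → a < n * n + 2 → a ≢ register r i
  input<register r i a< refl = <⇒≱ a< (m≤m+n _ _)

  EnvironmentAt : ∀ {k} → Vec ℕ k → Memory → Set
  EnvironmentAt []               σ = ⊤
  EnvironmentAt {suc k} (x ∷ ρ) σ = read σ (register 15 k) ≡ x × EnvironmentAt ρ σ

  -- The input has to survive, since n enters every address and the matrix is read again and again.
  -- `reg` makes a claim about all indices, which is possible because cells never written read as 0.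
  record Represents {k} (ρ : Vec ℕ k) (st : State) (σ : Memory) : Set where
    field
      inp : ∀ {a} → a < n * n + 2 → read σ a ≡ read σ₀ a
      reg : ∀ {r} i → r < 15 → read σ (register r i) ≡ st r i
      env : EnvironmentAt ρ σ
      len : length σ ≤ L
      bnd : ∀ a → read σ a ≤ V

  ⟦_⟧ : ∀ {k} → Exp k → Vec ℕ k → State → ℕ
  ⟦ lit m ⟧      ρ st = m
  ⟦ n′ ⟧         ρ st = n
  ⟦ d′ ⟧         ρ st = d
  ⟦ var j ⟧      ρ st = lookup ρ j
  ⟦ arr r e ⟧    ρ st = st r (⟦ e ⟧ ρ st)
  ⟦ adj e ⟧      ρ st = read σ₀ (2 + (⟦ e ⟧ ρ st ∸ (⟦ e ⟧ ρ st ∸ (n * n ∸ 1))))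
  ⟦ op o e₁ e₂ ⟧ ρ st = ⟦ o ⟧ᵒ (⟦ e₁ ⟧ ρ st) (⟦ e₂ ⟧ ρ st)

  private
    m∸[m∸l]≤l : ∀ m l → m ∸ (m ∸ l) ≤ l
    m∸[m∸l]≤l m l = m≤n+o⇒m∸n≤o m (m ∸ l) (≤-trans (m≤n+m∸n m l) (≤-reflexive (+-comm l (m ∸ l))))

    n*n∸1<n*n : n * n ∸ 1 < n * n
    n*n∸1<n*n = ∸-monoʳ-< {n * n} {1} {0} (s≤s z≤n) (*-mono-≤ n>0 n>0)

  module _ {k} {ρ : Vec ℕ k} {st σ} (rep : Represents ρ st σ) where
    open Represents rep

    eval-n : read σ 0 ≡ n
    eval-n = trans (inp (m≤n⇒m≤o+n (n * n) (s≤s z≤n))) σ₀-n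

    eval-register : ∀ r e → eval (registerᵉ r e) σ ≡ register r (eval e σ)
    eval-register r e = cong (λ m → m * m + 2 + (eval e σ * 16 + r)) eval-n

    eval-var : ∀ {k} {ρ : Vec ℕ k} → EnvironmentAt ρ σ → ∀ j → read σ (register 15 (level j)) ≡ lookup ρ j
    eval-var {ρ = x ∷ ρ} (eq , _)  zero    = eq
    eval-var {ρ = x ∷ ρ} (_ , env) (suc j) = eval-var env j

    -- No side condition on indices is needed: the two subtractions in `adj` form the minimum with n
    -- * n - 1, so the cell that is read always belongs to the untouched input.
    eval-compile : ∀ e → eval (compile e) σ ≡ ⟦ e ⟧ ρ st
    eval-compile (lit m)      = refl
    eval-compile n′           = eval-n
    eval-compile d′           = trans (inp (m≤n⇒m≤o+n (n * n) (s≤s (s≤s z≤n)))) σ₀-d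
    eval-compile (var j)      = trans (cong (read σ) (eval-register 15 (lit (level j)))) (eval-var env j)
    eval-compile (arr r {r<15} e) = begin
      read σ (eval (registerᵉ r (compile e)) σ)   ≡⟨ cong (read σ) (eval-register r (compile e)) ⟩
      read σ (register r (eval (compile e) σ))    ≡⟨ cong (read σ ∘ register r) (eval-compile e) ⟩
      read σ (register r (⟦ e ⟧ ρ st))            ≡⟨ reg _ (<ᵇ⇒< r 15 r<15) ⟩
      st r (⟦ e ⟧ ρ st)                           ∎
      where open ≡-Reasoning
    eval-compile (adj e)      = trans
      (cong (read σ) (cong₂ (λ x m → 2 + (x ∸ (x ∸ (m * m ∸ 1)))) (eval-compile e) eval-n))
      (inp (subst (2 + (⟦ e ⟧ ρ st ∸ (⟦ e ⟧ ρ st ∸ (n * n ∸ 1))) <_) (+-comm 2 (n * n)) (s≤s (s≤s (≤-<-trans (m∸[m∸l]≤l (⟦ e ⟧ ρ st) (n * n ∸ 1)) n*n∸1<n*n)))))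
    eval-compile (op o e₁ e₂) = cong₂ ⟦ o ⟧ᵒ (eval-compile e₁) (eval-compile e₂)

  unit : ℕ
  unit = W * ∥ V ∥

  space : ℕ
  space = L * ∥ V ∥ + W * ∥ V ∥

  -- τ counts assignments and tests, each of which costs at most `unit`. The space bound is the same
  -- for all programs, because a peak is a maximum and composition does not increase it.
  record Outcome {k} (P : Program) (ρ : Vec ℕ k) (τ : ℕ) (σ : Memory) (Q : State → Set) : Set where
    field
      {final}  : Memory
      {t s}    : ℕ
      run      : ⟨ P , σ ⟩⇓⟨ final , t , s ⟩
      state    : State
      rep      : Represents ρ state final
      post     : Q state
      t≤       : t ≤ τ * unit
      s≤       : s ≤ space

  Run : ∀ {k} → Program → Vec ℕ k → ℕ → State → (State → Set) → Set
  Run P ρ τ st Q = ∀ {σ} → Represents ρ st σ → Outcome P ρ τ σ Q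

  private
    cost≤unit : ∀ {σ} e → (∀ a → read σ a ≤ V) → costFactor e ≤ W → cost e σ ≤ unit
    cost≤unit e σ≤V e≤W = ≤-trans (cost≤ σ≤V e) (*-monoˡ-≤ ∥ V ∥ e≤W)

    size≤L : ∀ {k} {ρ : Vec ℕ k} {st σ} → Represents ρ st σ → size σ ≤ L * ∥ V ∥
    size≤L {σ = σ} rep = ≤-trans (size≤ σ (Represents.bnd rep)) (*-monoˡ-≤ ∥ V ∥ (Represents.len rep))

    -- Two environments are allowed because setting a limit or counter enlarges or changes the
    -- environment, whereas an ordinary assignment keeps it.
    assign-outcome : ∀ {k l} {ρ : Vec ℕ k} {ρ′ : Vec ℕ l} {st st′ σ} {e₁ e₂ a x} {Q : State → Set} →
      Represents ρ st σ → eval e₁ σ ≡ a → eval e₂ σ ≡ x → costFactor e₁ + costFactor e₂ ≤ W →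
      Represents ρ′ st′ (write σ a x) → Q st′ → Outcome (e₁ ≔ e₂) ρ′ 1 σ Q
    assign-outcome {ρ′ = ρ′} {st′ = st′} {σ} {e₁} {e₂} rep eq₁ eq₂ ≤W rep′ q = record
      { run  = assign
      ; rep  = rep″
      ; post = q
      ; t≤   = ≤-trans c≤ (m≤m+n unit 0)
      ; s≤   = +-mono-≤ (⊔-lub (size≤L rep) (size≤L rep″)) c≤
      }
      where
      rep″ : Represents ρ′ st′ (write σ (eval e₁ σ) (eval e₂ σ))
      rep″ = subst₂ (λ a x → Represents ρ′ st′ (write σ a x)) (sym eq₁) (sym eq₂) rep′
      c≤ : cost e₁ σ + cost e₂ σ ≤ unit
      c≤ = ≤-trans (+-mono-≤ (cost≤ (Represents.bnd rep) e₁) (cost≤ (Represents.bnd rep) e₂))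
        (≤-trans (≤-reflexive (sym (*-distribʳ-+ ∥ V ∥ (costFactor e₁) (costFactor e₂)))) (*-monoˡ-≤ ∥ V ∥ ≤W))

    env-frame : ∀ {k} {ρ : Vec ℕ k} {σ σ′} → (∀ {i} → i < k → read σ′ (register 15 i) ≡ read σ (register 15 i)) →
      EnvironmentAt ρ σ → EnvironmentAt ρ σ′
    env-frame {ρ = []}    h _          = tt
    env-frame {ρ = _ ∷ ρ} h (eq , env) = trans (h (n<1+n _)) eq , env-frame (λ i<k → h (m<n⇒m<1+n i<k)) env

    represents-update : ∀ {k} {ρ : Vec ℕ k} {st σ r i x} → Represents ρ st σ → r < 15 → i < X → x ≤ V →
      Represents ρ (update st r i x) (write σ (register r i) x)
    represents-update {st = st} {σ} {r} {i} {x} rep r<15 i<X x≤V = record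
      { inp = λ a< → trans (read-write-≢ σ _ x (input<register r i a<)) (inp a<)
      ; reg = reg′
      ; env = env-frame (λ {j} _ → read-write-≢ σ _ x λ eq → <⇒≢ r<15 (sym (proj₁ (register-injective 15 r j i (n<1+n 15) r<16 eq)))) env
      ; len = length-write σ _ x len (register<L r<16 i<X)
      ; bnd = write-≤ σ _ x bnd x≤V
      }
      where
      open Represents rep
      r<16 : r < 16
      r<16 = m<n⇒m<1+n r<15
      reg′ : ∀ {r′} i′ → r′ < 15 → read (write σ (register r i) x) (register r′ i′) ≡ update st r i x r′ i′
      reg′ {r′} i′ r′<15 with r ≟ r′
      ... | no r≢r′ rewrite ≡ᵇ-false r≢r′ = trans
        (read-write-≢ σ _ x λ eq → r≢r′ (sym (proj₁ (register-injective r′ r i′ i (m<n⇒m<1+n r′<15) r<16 eq)))) (reg i′ r′<15)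
      ... | yes refl rewrite ≡ᵇ-refl r with i ≟ i′
      ...   | no i≢i′ rewrite ≡ᵇ-false i≢i′ = trans
        (read-write-≢ σ _ x λ eq → i≢i′ (sym (proj₂ (register-injective r r i′ i r<16 r<16 eq)))) (reg i′ r′<15)
      ...   | yes refl rewrite ≡ᵇ-refl i = read-write-≡ σ _ x

    represents-loop : ∀ {k} {ρ : Vec ℕ k} {st σ j x} → Represents ρ st σ → k ≤ j → j < X → x ≤ V →
      Represents ρ st (write σ (register 15 j) x)
    represents-loop {st = st} {σ} {j} {x} rep k≤j j<X x≤V = record
      { inp = λ a< → trans (read-write-≢ σ _ x (input<register 15 j a<)) (inp a<)
      ; reg = λ {r} i r<15 → trans (read-write-≢ σ _ x λ eq →
          <⇒≢ r<15 (proj₁ (register-injective r 15 i j (m<n⇒m<1+n r<15) (n<1+n 15) eq))) (reg i r<15)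
      ; env = env-frame (λ {i} i<k → read-write-≢ σ _ x λ eq →
          <⇒≢ (<-≤-trans i<k k≤j) (proj₂ (register-injective 15 15 i j (n<1+n 15) (n<1+n 15) eq))) env
      ; len = length-write σ _ x len (register<L (n<1+n 15) j<X)
      ; bnd = write-≤ σ _ x bnd x≤V
      }
      where open Represents rep

    -- The cell of level k is free, as ρ occupies only the levels below k.
    push : ∀ {k} {ρ : Vec ℕ k} {st σ x} → Represents ρ st σ → k < X → x ≤ V →
      Represents (x ∷ ρ) st (write σ (register 15 k) x)
    push {σ = σ} {x} rep k<X x≤V = record
      { Represents (represents-loop rep ≤-refl k<X x≤V)
      ; env = read-write-≡ σ _ x , Represents.env (represents-loop rep ≤-refl k<X x≤V)
      }

    pop : ∀ {k} {ρ : Vec ℕ k} {st σ x} → Represents (x ∷ ρ) st σ → Represents ρ st σ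
    pop rep = record { Represents rep ; env = proj₂ (Represents.env rep) }

  -- The conditions on r and W are Boolean tests: once W is a numeral and the program is given, they
  -- compute to `true` and fill themselves in.
  run-assign : ∀ {k} {ρ : Vec ℕ k} {st} r e₁ e₂ {Q : State → Set} →
    {_ : T (r <ᵇ 15)} {_ : T (costFactor (registerᵉ r (compile e₁)) + costFactor (compile e₂) ≤ᵇ W)} →
    ⟦ e₁ ⟧ ρ st < X → ⟦ e₂ ⟧ ρ st ≤ V → Q (update st r (⟦ e₁ ⟧ ρ st) (⟦ e₂ ⟧ ρ st)) →
    Run (r ⟪ e₁ ⟫≔ e₂) ρ 1 st Q
  run-assign r e₁ e₂ {Q} {r<15} {≤W} i<X x≤V q rep = assign-outcome {Q = Q} rep
    (trans (eval-register rep r (compile e₁)) (cong (register r) (eval-compile rep e₁)))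
    (eval-compile rep e₂) (≤ᵇ⇒≤ _ W ≤W) (represents-update rep (<ᵇ⇒< r 15 r<15) i<X x≤V) q

  run-seq : ∀ {k} {ρ : Vec ℕ k} {st P₁ P₂ τ₁ τ₂ Q} {R : State → Set} →
    Run P₁ ρ τ₁ st Q → (∀ {st′} → Q st′ → Run P₂ ρ τ₂ st′ R) → Run (P₁ ⨟ P₂) ρ (τ₁ + τ₂) st R
  run-seq {τ₁ = τ₁} {τ₂} run₁ run₂ rep = record
    { run  = seq O₁.run O₂.run
    ; rep  = O₂.rep
    ; post = O₂.post
    ; t≤   = ≤-trans (+-mono-≤ O₁.t≤ O₂.t≤) (≤-reflexive (sym (*-distribʳ-+ unit τ₁ τ₂)))
    ; s≤   = ⊔-lub O₁.s≤ O₂.s≤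
    }
    where
    module O₁ = Outcome (run₁ rep)
    module O₂ = Outcome (run₂ O₁.post O₁.rep)

  run-conseq : ∀ {k} {ρ : Vec ℕ k} {st P τ τ′ Q} {R : State → Set} →
    Run P ρ τ st Q → τ ≤ τ′ → (∀ {st′} → Q st′ → R st′) → Run P ρ τ′ st R
  run-conseq run₁ τ≤τ′ h rep = record
    { run = Outcome.run (run₁ rep) ; rep = Outcome.rep (run₁ rep) ; s≤ = Outcome.s≤ (run₁ rep)
    ; post = h (Outcome.post (run₁ rep)) ; t≤ = ≤-trans (Outcome.t≤ (run₁ rep)) (*-monoˡ-≤ unit τ≤τ′) }

  run-if : ∀ {k} {ρ : Vec ℕ k} {st} e {P₁ P₂ τ} {Q : State → Set} →
    {_ : T (costFactor (compile e) ≤ᵇ W)} →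
    (⟦ e ⟧ ρ st ≢ 0 → Run P₁ ρ τ st Q) → (⟦ e ⟧ ρ st ≡ 0 → Run P₂ ρ τ st Q) →
    Run (if compile e then P₁ else P₂) ρ (suc τ) st Q
  run-if {ρ = ρ} {st} e {P₁} {P₂} {τ} {Q} {≤W} run₁ run₂ {σ} rep = go (⟦ e ⟧ ρ st ≟ 0)
    where
    c≤ : cost (compile e) σ ≤ unit
    c≤ = cost≤unit (compile e) (Represents.bnd rep) (≤ᵇ⇒≤ _ W ≤W)
    go : Dec (⟦ e ⟧ ρ st ≡ 0) → Outcome (if compile e then P₁ else P₂) ρ (suc τ) σ Q
    go (yes ≡0) = record
      { run  = if-false (trans (eval-compile rep e) ≡0) O.run
      ; rep  = O.rep
      ; post = O.post
      ; t≤   = +-mono-≤ c≤ O.t≤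
      ; s≤   = ⊔-lub (+-mono-≤ (size≤L rep) c≤) O.s≤
      }
      where module O = Outcome (run₂ ≡0 rep)
    go (no ≢0) = record
      { run  = if-true (≢0 ∘ trans (sym (eval-compile rep e))) O.run
      ; rep  = O.rep
      ; post = O.post
      ; t≤   = +-mono-≤ c≤ O.t≤
      ; s≤   = ⊔-lub (+-mono-≤ (size≤L rep) c≤) O.s≤
      }
      where module O = Outcome (run₁ ≢0 rep)

  -- The body of a loop runs in an environment with the counter i and the limit.
  run-for : ∀ {k} {ρ : Vec ℕ k} {st} e {P} τ (I : ℕ → State → Set) →
    let open Loop k in
    {_ : T (suc (suc k) ≤ᵇ X)} {_ : T (costFactor limitᵉ + costFactor (compile e) ≤ᵇ W)}
    {_ : T (costFactor counterᵉ + costFactor (op add (load counterᵉ) (lit 1)) ≤ᵇ W)}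
    {_ : T (costFactor conditionᵉ ≤ᵇ W)} →
    ⟦ e ⟧ ρ st ≤ V → I 0 st →
    (∀ {i st′} → i < ⟦ e ⟧ ρ st → I i st′ → Run P (i ∷ ⟦ e ⟧ ρ st ∷ ρ) τ st′ (I (suc i))) →
    Run (for e loop P) ρ (3 + ⟦ e ⟧ ρ st * (τ + 2)) st (I (⟦ e ⟧ ρ st))
  run-for {k} {ρ} {st} e {P} τ I {k<X} {c₁} {c₂} {c₃} N≤V I₀ body {σ} rep = record
    { run  = seq O₁.run (seq O₂.run O₃.run)
    ; rep  = pop (pop O₃.rep)
    ; post = O₃.post
    ; t≤   = +-mono-≤ (≤-trans O₁.t≤ (≤-reflexive (+-identityʳ unit))) (+-mono-≤ (≤-trans O₂.t≤ (≤-reflexive (+-identityʳ unit))) O₃.t≤)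
    ; s≤   = ⊔-lub O₁.s≤ (⊔-lub O₂.s≤ O₃.s≤)
    }
    where
    open Loop k
    N : ℕ
    N = ⟦ e ⟧ ρ st
    1+k<X : suc k < X
    1+k<X = ≤ᵇ⇒≤ _ X k<X
    module O₁ = Outcome (assign-outcome {st′ = st} {e₁ = limitᵉ} {compile e} {Q = λ st′ → st′ ≡ st} rep
      (eval-register rep 15 (lit k)) (eval-compile rep e) (≤ᵇ⇒≤ _ W c₁) (push rep (<-trans (n<1+n k) 1+k<X) N≤V) refl)
    module O₂ = Outcome (assign-outcome {st′ = st} {e₁ = counterᵉ} {lit 0} {Q = λ st′ → st′ ≡ st} O₁.rep
      (eval-register O₁.rep 15 (lit (suc k))) refl
      (≤-trans (+-monoʳ-≤ (costFactor counterᵉ) (s≤s z≤n)) (≤ᵇ⇒≤ _ W c₂))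
      (push O₁.rep 1+k<X z≤n) refl)
    cond≡ : ∀ {i st′ σ′} → Represents (i ∷ N ∷ ρ) st′ σ′ → eval conditionᵉ σ′ ≡ N ∸ i
    cond≡ {σ′ = σ′} rep′ = cong₂ _∸_
      (trans (cong (read σ′) (eval-register rep′ 15 (lit k))) (proj₁ (proj₂ (Represents.env rep′))))
      (trans (cong (read σ′) (eval-register rep′ 15 (lit (suc k)))) (proj₁ (Represents.env rep′)))
    -- Induction on the number m of rounds to come. The 1 in the time is the final failing test; a
    -- round costs its test, its body and the increment, hence τ + 2.
    iterate : ∀ m {i st′ σ′} → i + m ≡ N → Represents (i ∷ N ∷ ρ) st′ σ′ → I i st′ →
      Outcome (countUp P) (N ∷ N ∷ ρ) (1 + m * (τ + 2)) σ′ (I N)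
    iterate zero {i} {σ′ = σ′} i+m≡N rep′ q rewrite trans (sym (+-identityʳ i)) i+m≡N = record
      { run  = while-false (trans (cond≡ rep′) (n∸n≡0 N))
      ; rep  = rep′
      ; post = q
      ; t≤   = ≤-trans c≤ (m≤m+n unit 0)
      ; s≤   = +-mono-≤ (size≤L rep′) c≤
      }
      where
      c≤ : cost conditionᵉ σ′ ≤ unit
      c≤ = cost≤unit {σ′} conditionᵉ (Represents.bnd rep′) (≤ᵇ⇒≤ _ W c₃)
    iterate (suc m) {i} {σ′ = σ′} i+m≡N rep′ q = record
      { run  = while-true (λ ≡0 → <⇒≱ i<N (m∸n≡0⇒m≤n (trans (sym (cond≡ rep′)) ≡0))) (seq B₁.run B₂.run) B₃.run
      ; rep  = B₃.rep
      ; post = B₃.post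
      ; t≤   = ≤-trans (+-mono-≤ (+-mono-≤ c≤ (+-mono-≤ B₁.t≤ B₂.t≤)) B₃.t≤) (≤-reflexive (arithmetic unit τ m))
      ; s≤   = ⊔-lub (+-mono-≤ (size≤L rep′) c≤) (⊔-lub (⊔-lub B₁.s≤ B₂.s≤) B₃.s≤)
      }
      where
      c≤ : cost conditionᵉ σ′ ≤ unit
      c≤ = cost≤unit {σ′} conditionᵉ (Represents.bnd rep′) (≤ᵇ⇒≤ _ W c₃)
      i<N : i < N
      i<N = subst (i <_) i+m≡N (m<m+n i (s≤s z≤n))
      module B₁ = Outcome (body i<N q rep′)
      module B₂ = Outcome (assign-outcome {st′ = B₁.state} {e₁ = counterᵉ} {op add (load counterᵉ) (lit 1)}
        {Q = λ st′ → st′ ≡ B₁.state} B₁.rep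
        (eval-register B₁.rep 15 (lit (suc k)))
        (trans (cong (_+ 1) (trans (cong (read B₁.final) (eval-register B₁.rep 15 (lit (suc k)))) (proj₁ (Represents.env B₁.rep))))
          (+-comm i 1))
        (≤ᵇ⇒≤ _ W c₂) (push (pop B₁.rep) 1+k<X (≤-trans i<N N≤V)) refl)
      module B₃ = Outcome (iterate m (trans (sym (+-suc i m)) i+m≡N) B₂.rep B₁.post)
      arithmetic : ∀ u τ m → u + (τ * u + 1 * u) + (1 + m * (τ + 2)) * u ≡ (1 + suc m * (τ + 2)) * u
      arithmetic = solve-∀
    module O₃ = Outcome (iterate N refl O₂.rep I₀)

  -- With a bound N̂ on the number of rounds, the time can be stated in terms of n where the limit
  -- is k or d.
  run-for′ : ∀ {k} {ρ : Vec ℕ k} {st} e N N̂ {P} τ (I : ℕ → State → Set) {Q : State → Set} →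
    let open Loop k in
    {_ : T (suc (suc k) ≤ᵇ X)} {_ : T (costFactor limitᵉ + costFactor (compile e) ≤ᵇ W)}
    {_ : T (costFactor counterᵉ + costFactor (op add (load counterᵉ) (lit 1)) ≤ᵇ W)}
    {_ : T (costFactor conditionᵉ ≤ᵇ W)} →
    ⟦ e ⟧ ρ st ≡ N → N ≤ V → N ≤ N̂ → I 0 st →
    (∀ {i st′} → i < N → I i st′ → Run P (i ∷ N ∷ ρ) τ st′ (I (suc i))) →
    (∀ {st′} → I N st′ → Q st′) →
    Run (for e loop P) ρ (3 + N̂ * (τ + 2)) st Q
  run-for′ e _ N̂ τ I {_} {c₀} {c₁} {c₂} {c₃} refl N≤V N≤N̂ I₀ body post =
    run-conseq (run-for e τ I {c₀} {c₁} {c₂} {c₃} N≤V I₀ body) (+-monoʳ-≤ 3 (*-monoˡ-≤ (τ + 2) N≤N̂)) post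

  -- The output overwrites n in cell 0, after which `Represents` no longer holds; so the last
  -- assignment needs a notion of its own.
  Outputs : Program → ℕ → Memory → ℕ → Set
  Outputs P τ σ x = ∃[ σ′ ] ∃[ t ] ∃[ s ] ⟨ P , σ ⟩⇓⟨ σ′ , t , s ⟩ × output σ′ ≡ x × t ≤ τ * unit × s ≤ space

  run-output : ∀ {k} {ρ : Vec ℕ k} {st σ} e → {_ : T (1 + costFactor (compile e) ≤ᵇ W)} →
    Represents ρ st σ → ⟦ e ⟧ ρ st ≤ V → Outputs (lit 0 ≔ compile e) 1 σ (⟦ e ⟧ ρ st)
  run-output {σ = σ} e {≤W} rep ≤V = _ , _ , _ , assign ,
    trans (read-write-≡ σ 0 (eval (compile e) σ)) (eval-compile rep e) ,
    ≤-trans c≤ (m≤m+n unit 0) , +-mono-≤ (⊔-lub (size≤L rep) size′≤) c≤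
    where
    open Represents rep
    x : ℕ
    x = eval (compile e) σ
    c≤ : cost (lit 0) σ + cost (compile e) σ ≤ unit
    c≤ = ≤-trans (+-mono-≤ (cost≤ {σ = σ} bnd (lit 0)) (cost≤ {σ = σ} bnd (compile e)))
      (≤-trans (≤-reflexive (sym (*-distribʳ-+ ∥ V ∥ 1 (costFactor (compile e))))) (*-monoˡ-≤ ∥ V ∥ (≤ᵇ⇒≤ _ W ≤W)))
    size′≤ : size (write σ 0 x) ≤ L * ∥ V ∥
    size′≤ = ≤-trans (size≤ (write σ 0 x) (write-≤ σ 0 x bnd (subst (_≤ V) (sym (eval-compile rep e)) ≤V)))
      (*-monoˡ-≤ ∥ V ∥ (length-write σ 0 x len (≤-trans (m≤n⇒m≤o+n (n * n) (s≤s z≤n)) (m≤m+n _ (X * 16)))))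

d/2≡⌊d/2⌋ : ∀ d → d / 2 ≡ ⌊ d /2⌋
d/2≡⌊d/2⌋ zero          = refl
d/2≡⌊d/2⌋ (suc zero)    = refl
d/2≡⌊d/2⌋ (suc (suc d)) = trans (m/n≡1+[m∸n]/n {suc (suc d)} {2} (s≤s (s≤s z≤n))) (cong suc (d/2≡⌊d/2⌋ d))

-- Residues

module Residue (m-1 : ℕ) where

  m : ℕ
  m = suc m-1

  infix 4 _∼_

  -- Congruence modulo m between the natural number in a register and the integer it stands for.
  -- With the quotient as data, closure under the operations is a ring identity.
  record _∼_ (a : ℕ) (z : ℤ) : Set where
    constructor quotient
    field
      q  : ℤ
      eq : pos a ≡ z +ᶻ q *ᶻ pos m

  ∼-refl : ∀ {a} → a ∼ pos a
  ∼-refl {a} = quotient (pos 0) (sym (ℤ.+-identityʳ (pos a)))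

  ∼-reflexive : ∀ {a z} → pos a ≡ z → a ∼ z
  ∼-reflexive refl = ∼-refl

  ∼-resp : ∀ {a y z} → y ≡ z → a ∼ y → a ∼ z
  ∼-resp refl a∼y = a∼y

  ∼-+ : ∀ {a b y z} → a ∼ y → b ∼ z → a + b ∼ y +ᶻ z
  ∼-+ {y = y} {z} (quotient p eq) (quotient q eq′) = quotient (p +ᶻ q) (trans (cong₂ _+ᶻ_ eq eq′) (lem y z p q (pos m)))
    where
    lem : ∀ y z p q m → (y +ᶻ p *ᶻ m) +ᶻ (z +ᶻ q *ᶻ m) ≡ (y +ᶻ z) +ᶻ (p +ᶻ q) *ᶻ m
    lem = ℤ-Solver.solve-∀

  ∼-* : ∀ {a b y z} → a ∼ y → b ∼ z → a * b ∼ y *ᶻ z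
  ∼-* {a} {b} {y} {z} (quotient p eq) (quotient q eq′) = quotient (y *ᶻ q +ᶻ p *ᶻ z +ᶻ p *ᶻ q *ᶻ pos m)
    (trans (ℤ.pos-* a b) (trans (cong₂ _*ᶻ_ eq eq′) (lem y z p q (pos m))))
    where
    lem : ∀ y z p q m → (y +ᶻ p *ᶻ m) *ᶻ (z +ᶻ q *ᶻ m) ≡ (y *ᶻ z) +ᶻ (y *ᶻ q +ᶻ p *ᶻ z +ᶻ p *ᶻ q *ᶻ m) *ᶻ m
    lem = ℤ-Solver.solve-∀

  -1∼ : m-1 ∼ -1ℤ
  -1∼ = quotient (pos 1) (sym (cong (-1ℤ +ᶻ_) (ℤ.*-identityˡ (pos m))))

  ∼-% : ∀ {a z} → a ∼ z → a % m ∼ z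
  ∼-% {a} {z} (quotient q eq) = quotient (q -ᶻ pos (a / m)) (begin
    pos (a % m)                                             ≡⟨ lem₁ (pos (a % m)) (pos (a / m)) (pos m) ⟩
    (pos (a % m) +ᶻ pos (a / m) *ᶻ pos m) -ᶻ pos (a / m) *ᶻ pos m
      ≡⟨ cong (λ x → (pos (a % m) +ᶻ x) -ᶻ pos (a / m) *ᶻ pos m) (sym (ℤ.pos-* (a / m) m)) ⟩
    pos (a % m + (a / m) * m) -ᶻ pos (a / m) *ᶻ pos m
      ≡⟨ cong (λ x → pos x -ᶻ pos (a / m) *ᶻ pos m) (sym (m≡m%n+[m/n]*n a m)) ⟩
    pos a -ᶻ pos (a / m) *ᶻ pos m                           ≡⟨ cong (_-ᶻ pos (a / m) *ᶻ pos m) eq ⟩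
    (z +ᶻ q *ᶻ pos m) -ᶻ pos (a / m) *ᶻ pos m               ≡⟨ lem₂ z q (pos (a / m)) (pos m) ⟩
    z +ᶻ (q -ᶻ pos (a / m)) *ᶻ pos m                        ∎)
    where
    open ≡-Reasoning
    lem₁ : ∀ r d m → r ≡ (r +ᶻ d *ᶻ m) -ᶻ d *ᶻ m
    lem₁ = ℤ-Solver.solve-∀
    lem₂ : ∀ z q d m → (z +ᶻ q *ᶻ m) -ᶻ d *ᶻ m ≡ z +ᶻ (q -ᶻ d) *ᶻ m
    lem₂ = ℤ-Solver.solve-∀

  ∼-injective : ∀ {a c} → a < m → c < m → a ∼ pos c → a ≡ c
  ∼-injective {a} {c} a<m c<m (quotient (pos zero) eq)    = ℤ.+-injective (trans eq (ℤ.+-identityʳ (pos c)))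
  ∼-injective {a} {c} a<m c<m (quotient (pos (suc q)) eq) = contradiction a<m (≤⇒≯ (subst (m ≤_)
    (sym (ℤ.+-injective (trans eq (cong (pos c +ᶻ_) (sym (ℤ.pos-* (suc q) m))))))
    (≤-trans (m≤m+n m (q * m)) (m≤n+m _ c))))
  ∼-injective {a} {c} a<m c<m (quotient -[1+ q ] eq) = contradiction c<m (≤⇒≯ (subst (m ≤_) c≡
    (≤-trans (m≤m+n m (q * m)) (m≤n+m _ a))))
    where
    lem : ∀ c q m → (c +ᶻ (-ᶻ q) *ᶻ m) +ᶻ q *ᶻ m ≡ c
    lem = ℤ-Solver.solve-∀
    c≡ : a + suc q * m ≡ c
    c≡ = ℤ.+-injective (trans (cong₂ _+ᶻ_ eq (ℤ.pos-* (suc q) m)) (lem (pos c) (pos (suc q)) (pos m)))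

  Residue : ℕ → ℤ → Set
  Residue a z = a < m × a ∼ z

  residue-% : ∀ {a z} → a ∼ z → Residue (a % m) z
  residue-% {a} a∼z = m%n<n a m , ∼-% a∼z

  -- The machine has no remainder operation, so the program subtracts the modulus times the
  -- quotient. The modulus is a register content y, known only propositionally to be m.
  residue-reduce : ∀ {y x z} → y ≡ m → x ∼ z → Residue (x ∸ y * ⟦ div ⟧ᵒ x y) z
  residue-reduce {x = x} {z} refl x∼z = subst (λ r → Residue r z)
    (trans (m%n≡m∸m/n*n x m) (cong (x ∸_) (*-comm (x / m) m))) (residue-% x∼z)

-- An injective index for tables, with no row length in it. The value lies between the squares of i
-- + s and i + s + 1, so it determines i + s, and the excess over the square is i.
pair : ℕ → ℕ → ℕ
pair i s = (i + s) * (i + s) + i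

pairᵉ : ∀ {k} → Exp k → Exp k → Exp k
pairᵉ e₁ e₂ = op add (op mul (op add e₁ e₂) (op add e₁ e₂)) e₁

pair-< : ∀ {i i′ s s′} → i + s < i′ + s′ → pair i s < pair i′ s′
pair-< {i} {i′} {s} {s′} h = begin-strict
  a * a + i        ≤⟨ +-monoʳ-≤ (a * a) (m≤m+n i s) ⟩
  a * a + a        <⟨ n<1+n _ ⟩
  suc (a * a + a)  ≤⟨ m≤m+n _ a ⟩
  suc (a * a + a) + a ≡⟨ lem a ⟩
  suc a * suc a    ≤⟨ *-mono-≤ h h ⟩
  a′ * a′          ≤⟨ m≤m+n _ i′ ⟩
  pair i′ s′       ∎
  where
  open ≤-Reasoning
  a a′ : ℕ
  a  = i + s
  a′ = i′ + s′
  lem : ∀ a → suc (a * a + a) + a ≡ suc a * suc a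
  lem = solve-∀

pair-injective : ∀ i i′ s s′ → pair i s ≡ pair i′ s′ → i ≡ i′ × s ≡ s′
pair-injective i i′ s s′ eq with <-cmp (i + s) (i′ + s′)
... | tri< h _ _ = contradiction eq (<⇒≢ (pair-< {i} {i′} h))
... | tri> _ _ h = contradiction (sym eq) (<⇒≢ (pair-< {i′} {i} h))
... | tri≈ _ h _ = i≡i′ , +-cancelˡ-≡ i s s′ (trans h (cong (_+ s′) (sym i≡i′)))
  where
  i≡i′ : i ≡ i′
  i≡i′ = +-cancelˡ-≡ ((i + s) * (i + s)) i i′ (trans eq (cong (λ a → a * a + i′) (sym h)))

pair-bound : ∀ {i s a} → i + s < a → pair i s < a * a
pair-bound {i} {s} {a} h = subst (pair i s <_) (+-identityʳ (a * a)) (pair-< {i} {0} {s} {a} h)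

-- Tables

-- Row 0 comes from `first`, and each later row from the one before it by `next`. `width` and
-- `width′` are meant as the same number, outside and inside the scope of the row counter.
table : ∀ {k} → Exp k → Exp k → Exp (2 + k) → Program → Program → Program
table width height width′ first next = for width loop first ⨟ for height loop (for width′ loop next)

module Tables (n d : ℕ) (σ₀ : Memory) (V X W : ℕ) (n>0 : 1 ≤ n) (n≤V : n ≤ V)
  (σ₀-n : read σ₀ 0 ≡ n) (σ₀-d : read σ₀ 1 ≡ d) where

  open Machine n d σ₀ V X W n>0 n≤V σ₀-n σ₀-d

  -- What the body of a table loop has to guarantee. `Ok` speaks of the entry alone and not of the
  -- state, so entries already made stay correct as long as their cells do not change.
  Sets : (r j s : ℕ) (Ok : ℕ → Set) (Frame : State → Set) → State → State → Set
  Sets r j s Ok Frame st st′ = Frame st′ × ∃[ x ] Ok x × (∀ i → st′ r i ≡ (st r [ pair j s ↦ x ]) i)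

  module _ {k} (r : ℕ) (ρ : Vec ℕ k) (wᵉ hᵉ : Exp k) (w′ᵉ : Exp (2 + k)) (w w′ h h′ : ℕ)
    (Ok : ℕ → ℕ → ℕ → Set) (Frame : State → Set)
    where

    private
      Filled : ℕ → State → Set
      Filled j st = ∀ j′ s → j′ ≤ j → s < w → Ok j′ s (st r (pair j′ s))

      Partial : ℕ → ℕ → State → Set
      Partial j s st = ∀ s′ → s′ < s → Ok j s′ (st r (pair j s′))

      extend : ∀ {j s st st′} → Partial j s st → Sets r j s (Ok j s) Frame st st′ → Partial j (suc s) st′
      extend {j} {s} {st} {st′} old (_ , x , ok , eq) s′ s′<1+s with s′ ≟ s
      ... | yes refl = subst (Ok j s) (sym (trans (eq (pair j s)) ([↦]-≡ (st r) (pair j s)))) ok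
      ... | no s′≢s  = subst (Ok j s′) (sym (trans (eq (pair j s′))
        ([↦]-≢ (st r) {pair j s} λ e → s′≢s (sym (proj₂ (pair-injective j j s s′ e))))))
        (old s′ (≤∧≢⇒< (s≤s⁻¹ s′<1+s) s′≢s))

      keep : ∀ {j s st st′} → Filled j st → Sets r (suc j) s (Ok (suc j) s) Frame st st′ → Filled j st′
      keep {j} {s} {st} old (_ , x , _ , eq) j′ s′ j′≤j s′<w = subst (Ok j′ s′) (sym (trans (eq (pair j′ s′))
        ([↦]-≢ (st r) {pair (suc j) s} λ e → <⇒≢ (s≤s j′≤j) (sym (proj₁ (pair-injective (suc j) j′ s s′ e))))))
        (old j′ s′ j′≤j s′<w)

    run-table : ∀ {st first next τ₀ τ}
      {_ : T (4 + k ≤ᵇ X)}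
      {_ : T (costFactor (registerᵉ 15 (lit k)) + costFactor (compile wᵉ) ≤ᵇ W)}
      {_ : T (costFactor (registerᵉ 15 (lit k)) + costFactor (compile hᵉ) ≤ᵇ W)}
      {_ : T (costFactor (registerᵉ 15 (lit (2 + k))) + costFactor (compile w′ᵉ) ≤ᵇ W)}
      {_ : T (costFactor (Loop.counterᵉ k) + costFactor (op add (load (Loop.counterᵉ k)) (lit 1)) ≤ᵇ W)}
      {_ : T (costFactor (Loop.counterᵉ (2 + k)) + costFactor (op add (load (Loop.counterᵉ (2 + k))) (lit 1)) ≤ᵇ W)}
      {_ : T (costFactor (Loop.conditionᵉ k) ≤ᵇ W)}
      {_ : T (costFactor (Loop.conditionᵉ (2 + k)) ≤ᵇ W)} →
      (∀ st → ⟦ wᵉ ⟧ ρ st ≡ w) → (∀ st → ⟦ hᵉ ⟧ ρ st ≡ h) → (∀ j st → ⟦ w′ᵉ ⟧ (j ∷ h ∷ ρ) st ≡ w) →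
      w ≤ V → w ≤ w′ → h ≤ V → h ≤ h′ →
      Frame st →
      (∀ {s st} → s < w → Frame st → Run first (s ∷ w ∷ ρ) τ₀ st (Sets r 0 s (Ok 0 s) Frame st)) →
      (∀ {j s st} → j < h → s < w → Frame st → (∀ s → s < w → Ok j s (st r (pair j s))) →
        Run next (s ∷ w ∷ j ∷ h ∷ ρ) τ st (Sets r (suc j) s (Ok (suc j) s) Frame st)) →
      Run (table wᵉ hᵉ w′ᵉ first next) ρ (3 + w′ * (τ₀ + 2) + (3 + h′ * (3 + w′ * (τ + 2) + 2))) st
        (λ st′ → Frame st′ × (∀ j s → j ≤ h → s < w → Ok j s (st′ r (pair j s))))
    run-table {τ₀ = τ₀} {τ} {X₁} {W₁} {W₂} {W₃} {W₄} {W₅} {W₆} {W₇} w≡ h≡ w′≡ w≤V w≤w′ h≤V h≤h′ frame first next = run-seq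
      (run-for′ wᵉ w w′ τ₀ (λ s st → Frame st × Partial 0 s st) {_} {X₂} {W₁} {W₄} {W₆} (w≡ _) w≤V w≤w′
        (frame , λ _ ())
        (λ {s} {st₁} s<w (fr , old) → run-conseq (first s<w fr) ≤-refl λ {st₂} sets →
          proj₁ sets , extend {0} {s} {st₁} {st₂} old sets)
        λ q → q)
      (λ (fr , row₀) → run-for′ hᵉ h h′ _ (λ j st → Frame st × Filled j st) {_} {X₂} {W₂} {W₄} {W₆} (h≡ _) h≤V h≤h′
        (fr , λ { zero s z≤n s<w → row₀ s s<w })
        (λ {j} j<h (fr , rows) → run-for′ w′ᵉ w w′ τ (λ s st → Frame st × Filled j st × Partial (suc j) s st)
          {_} {X₁} {W₃} {W₅} {W₇} (w′≡ j _) w≤V w≤w′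
          (fr , rows , λ _ ())
          (λ {s} {st₁} s<w (fr , rows , old) → run-conseq (next j<h s<w fr (λ s s<w → rows j s ≤-refl s<w)) ≤-refl
            λ {st₂} sets → proj₁ sets , keep {j} {s} {st₁} {st₂} rows sets , extend {suc j} {s} {st₁} {st₂} old sets)
          λ {st₁} (fr , rows , row) → fr , filled {j} {st₁} rows row)
        λ q → q)
      where
      X₂ : T (2 + k ≤ᵇ X)
      X₂ = ≤⇒≤ᵇ (≤-trans (m≤n+m (2 + k) 2) (≤ᵇ⇒≤ (4 + k) X X₁))
      filled : ∀ {j st} → Filled j st → Partial (suc j) w st → Filled (suc j) st
      filled {j} rows row j′ s j′≤1+j s<w with j′ ≟ suc j
      ... | yes refl = row s s<w
      ... | no j′≢  = rows j′ s (s≤s⁻¹ (≤∧≢⇒< j′≤1+j j′≢)) s<w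

-- The program

modulusʳ factorʳ countʳ coeffʳ signʳ restʳ rankʳ walksʳ entryʳ traceʳ totalʳ powerʳ : ℕ
modulusʳ = 0
factorʳ  = 1
countʳ   = 2
coeffʳ   = 3
signʳ    = 4
restʳ    = 5
rankʳ    = 6
walksʳ   = 7
entryʳ   = 8
traceʳ   = 9
totalʳ   = 10
powerʳ   = 11

-- The counters of the enclosing loops, from the inside; the odd variables are their limits.
v₀ : ∀ {k} → Exp (1 + k)
v₀ = var zero

v₂ : ∀ {k} → Exp (3 + k)
v₂ = var (suc (suc zero))

v₄ : ∀ {k} → Exp (5 + k)
v₄ = var (suc (suc (suc (suc zero))))

module _ {k : ℕ} where

  infixl 7 _⊕_ _⊖_
  infixl 8 _⊗_

  _⊕_ _⊖_ _⊗_ : Exp k → Exp k → Exp k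
  _⊕_ = op add
  _⊖_ = op sub
  _⊗_ = op mul

  scalar : (r : ℕ) {_ : T (r <ᵇ 15)} → Exp k
  scalar r {r<15} = arr r {r<15} (lit 0)

  halfᵉ -1ᵉ : Exp k
  halfᵉ = op div d′ (lit 2)
  -1ᵉ   = scalar modulusʳ ⊖ lit 1

  modᵉ : Exp k → Exp k
  modᵉ e = e ⊖ scalar modulusʳ ⊗ op div e (scalar modulusʳ)

initᵖ countᵖ coeffᵖ unrankᵖ entryᵖ walksᵖ traceᵖ mainᵖ : Program

initᵖ =
  factorʳ ⟪ lit {0} 0 ⟫≔ lit 1 ⨟
  (for halfᵉ {0} loop (factorʳ ⟪ lit 0 ⟫≔ scalar factorʳ ⊗ (lit 4 ⊗ (lit 1 ⊕ v₀ {1})))) ⨟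
  powerʳ ⟪ lit {0} 0 ⟫≔ lit 1 ⨟
  (for d′ {0} loop (powerʳ ⟪ lit {2} 0 ⟫≔ n′ ⊗ scalar powerʳ)) ⨟
  modulusʳ ⟪ lit {0} 0 ⟫≔ lit 1 ⊕ scalar factorʳ ⊗ scalar powerʳ

countᵖ = table (lit 2 ⊕ n′) (n′ {0}) (lit 2 ⊕ n′)
  -- The value is 0 in column 0 and 1 in all others. In later rows the truncated predecessor of
  -- column 0 is column 0 itself, whose entries are 0, so no case distinction is needed.
  (countʳ ⟪ pairᵉ (lit 0) (v₀ {1}) ⟫≔ lit 1 ⊖ (lit 1 ⊖ v₀))
  (countʳ ⟪ pairᵉ (lit 1 ⊕ v₂ {1}) v₀ ⟫≔ arr countʳ (pairᵉ v₂ v₀) ⊕ arr countʳ (pairᵉ v₂ (v₀ ⊖ lit 1)))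

coeffᵖ = table (lit 1 ⊕ n′) (halfᵉ {0}) (lit 1 ⊕ n′)
  (coeffʳ ⟪ pairᵉ (lit 0) (v₀ {1}) ⟫≔ lit 1 ⊖ v₀)
  (coeffʳ ⟪ pairᵉ (lit 1 ⊕ v₂ {1}) v₀ ⟫≔ modᵉ
    -- Truncated subtraction would lose negative values, so these signs are supplied by the residue
    -- `-1ᵉ`. The factor `n′ ⊖ v₀` is a genuine difference, since the column is at most n.
    ((n′ ⊕ -1ᵉ ⊗ (lit 2 ⊗ d′) ⊕ lit 4 ⊗ (lit 1 ⊕ v₂)) ⊗ arr coeffʳ (pairᵉ v₂ v₀) ⊕
     -1ᵉ ⊗ (v₀ ⊗ arr coeffʳ (pairᵉ v₂ (v₀ ⊖ lit 1)) ⊕ (n′ ⊖ v₀) ⊗ arr coeffʳ (pairᵉ v₂ (lit 1 ⊕ v₀)))))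

-- Positions are visited from n - 1 downwards, in the order in which `sign` recurses.
positionᵉ countᵉ : Exp 4
positionᵉ = n′ ⊖ lit 1 ⊖ v₀
countᵉ    = arr countʳ (pairᵉ positionᵉ (scalar restʳ))

unrankᵖ =
  restʳ ⟪ lit {2} 0 ⟫≔ lit 1 ⊕ halfᵉ ⨟
  rankʳ ⟪ lit {2} 0 ⟫≔ v₀ ⨟
  (for n′ {2} loop
    -- The truncated difference is nonzero exactly if the rank is below the number of subsets that
    -- avoid this position.
    (if compile (countᵉ ⊖ scalar rankʳ)
    then (signʳ ⟪ positionᵉ ⟫≔ lit 1)
    else (signʳ ⟪ positionᵉ ⟫≔ -1ᵉ ⨟
          -- The rank is updated before the budget, because `countᵉ` reads the budget.
          rankʳ ⟪ lit 0 ⟫≔ scalar rankʳ ⊖ countᵉ ⨟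
          restʳ ⟪ lit {4} 0 ⟫≔ scalar restʳ ⊖ lit 1)))

entryᵖ =
  entryʳ ⟪ lit {8} 0 ⟫≔ lit 0 ⨟
  (for n′ {8} loop (entryʳ ⟪ lit 0 ⟫≔ modᵉ
    (scalar entryʳ ⊕ adj (v₂ ⊗ n′ ⊕ v₀) ⊗ arr signʳ v₀ ⊗ arr walksʳ (pairᵉ (v₄ {5}) v₀)))) ⨟
  walksʳ ⟪ pairᵉ (lit 1 ⊕ v₂ {5}) v₀ ⟫≔ scalar entryʳ

walksᵖ = table n′ (d′ {4}) n′
  -- The sum of the two truncated differences is the distance of the vertices, so this row is the
  -- Kronecker delta. The table is rebuilt in the same cells for every end vertex and every subset,
  -- which keeps the space polynomial.
  (walksʳ ⟪ pairᵉ (lit 0) (v₀ {5}) ⟫≔ lit 1 ⊖ ((v₀ ⊖ v₂) ⊕ (v₂ ⊖ v₀)))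
  entryᵖ

traceᵖ =
  traceʳ ⟪ lit {2} 0 ⟫≔ lit 0 ⨟
  (for n′ {2} loop
    (walksᵖ ⨟ traceʳ ⟪ lit 0 ⟫≔ modᵉ (scalar traceʳ ⊕ arr walksʳ (pairᵉ d′ (v₀ {3})))))

mainᵖ =
  initᵖ ⨟ countᵖ ⨟ coeffᵖ ⨟
  for arr countʳ (pairᵉ (n′ {0}) (lit 1 ⊕ halfᵉ)) loop
    (unrankᵖ ⨟ traceᵖ ⨟
     totalʳ ⟪ lit {2} 0 ⟫≔ modᵉ
       (scalar totalʳ ⊕ arr coeffʳ (pairᵉ halfᵉ (lit 1 ⊕ halfᵉ ⊖ scalar restʳ)) ⊗ scalar traceʳ))

-- Exceeds costFactor for all expressions in the program.
costCap : ℕ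
costCap = 50000

#subsets≤2^ : ∀ i s → #subsets i s ≤ 2 ^ i
#subsets≤2^ i       zero    = ≤-trans (≤-reflexive (#subsets-0 i)) z≤n
#subsets≤2^ zero    (suc s) = s≤s z≤n
#subsets≤2^ (suc i) (suc s) = +-mono-≤ (#subsets≤2^ i (suc s)) (≤-trans (#subsets≤2^ i s) (m≤m+n (2 ^ i) 0))

factor-mono : ∀ {i j} → i ≤ j → factor i ≤ factor j
factor-mono {i} {j} i≤j with m≤n⇒∃[o]m+o≡n i≤j
... | o , refl = go o
  where
  go : ∀ o → factor i ≤ factor (i + o)
  go zero    = ≤-reflexive (cong factor (sym (+-identityʳ i)))
  go (suc o) = ≤-trans (go o) (≤-trans (m≤m*n (factor (i + o)) (4 * suc (i + o))) (≤-reflexive (cong factor (sym (+-suc i o)))))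

1≤factor : ∀ j → 1 ≤ factor j
1≤factor j = factor-mono {0} {j} z≤n

-- Correctness of the program for d ≤ n

module Main (n d : ℕ) (G : Digraph n) (0<d : 1 ≤ d) (d≤n : d ≤ n) where

  k : ℕ
  k = d / 2

  k≤d : k ≤ d
  k≤d = m/n≤m d 2

  k≤n : k ≤ n
  k≤n = ≤-trans k≤d d≤n

  n>0 : 1 ≤ n
  n>0 = ≤-trans 0<d d≤n

  open Residue (factor k * n ^ d)

  -- In V, the summand m covers the residues and the partial products that build up the modulus, 2 ^
  -- n the counts and ranks of subsets, and 2 + n the budgets and the other loop limits. Each of the
  -- three has length polynomial in n.
  V X : ℕ
  V = m + (2 ^ n + (2 + n))
  X = 20 + (3 + 2 * n) * (3 + 2 * n)  -- 20 for the loop registers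

  m≤V : m ≤ V
  m≤V = m≤m+n m _

  2^n≤V : 2 ^ n ≤ V
  2^n≤V = ≤-trans (m≤m+n (2 ^ n) (2 + n)) (m≤n+m _ m)

  2+n≤V : 2 + n ≤ V
  2+n≤V = ≤-trans (m≤n+m (2 + n) (2 ^ n)) (m≤n+m _ m)

  n≤V : n ≤ V
  n≤V = ≤-trans (m≤n+m n 2) 2+n≤V

  residue≤V : ∀ {a z} → Residue a z → a ≤ V
  residue≤V (a<m , _) = ≤-trans (<⇒≤ a<m) m≤V

  σ₀ : Memory
  σ₀ = input G d

  open Machine n d σ₀ V X costCap n>0 n≤V refl refl
  open Tables n d σ₀ V X costCap n>0 n≤V refl refl

  pair<X : ∀ {i s} → i ≤ n → s < 2 + n → pair i s < X
  pair<X {i} {s} i≤n s<2+n = ≤-trans (pair-bound {i} {s} (begin-strict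
    i + s          <⟨ +-mono-≤-< i≤n s<2+n ⟩
    n + (2 + n)    ≡⟨ lem n ⟩
    2 + 2 * n      ≤⟨ n≤1+n _ ⟩
    3 + 2 * n      ∎)) (m≤n+m _ 20)
    where
    open ≤-Reasoning
    lem : ∀ n → n + (2 + n) ≡ 2 + 2 * n
    lem = solve-∀

  run-assign-⨟ : ∀ {l} {ρ : Vec ℕ l} {st} r e₁ e₂ {P τ} {Q : State → Set} →
    {_ : T (r <ᵇ 15)} {_ : T (costFactor (registerᵉ r (compile e₁)) + costFactor (compile e₂) ≤ᵇ costCap)} →
    ⟦ e₁ ⟧ ρ st < X → ⟦ e₂ ⟧ ρ st ≤ V → Run P ρ τ (update st r (⟦ e₁ ⟧ ρ st) (⟦ e₂ ⟧ ρ st)) Q →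
    Run (r ⟪ e₁ ⟫≔ e₂ ⨟ P) ρ (1 + τ) st Q
  run-assign-⨟ {ρ = ρ} {st} r e₁ e₂ {Q = Q} {c₁} {c₂} i<X x≤V run = run-seq
    (run-assign r e₁ e₂ {λ st′ → st′ ≡ update st r (⟦ e₁ ⟧ ρ st) (⟦ e₂ ⟧ ρ st)} {c₁} {c₂} i<X x≤V refl)
    λ { refl → run }

  private
    0<X : 0 < X
    0<X = s≤s z≤n

    1≤V : 1 ≤ V
    1≤V = ≤-trans (s≤s z≤n) 2+n≤V

  Initialised : State → Set
  Initialised st = st modulusʳ 0 ≡ m × st factorʳ 0 ≡ factor k × st totalʳ 0 ≡ 0

  instance
    n-nonZero : NonZero n
    n-nonZero = >-nonZero n>0

  n^i≤n^d : ∀ {i} → i ≤ d → n ^ i ≤ n ^ d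
  n^i≤n^d = ^-monoʳ-≤ n

  factor≤V : ∀ {i} → i ≤ k → factor i ≤ V
  factor≤V {i} i≤k = begin
    factor i           ≤⟨ factor-mono i≤k ⟩
    factor k           ≤⟨ m≤m*n (factor k) (n ^ d) {{m^n≢0 n d}} ⟩
    factor k * n ^ d   ≤⟨ n≤1+n _ ⟩
    m                  ≤⟨ m≤V ⟩
    V                  ∎
    where open ≤-Reasoning

  n^i≤V : ∀ {i} → i ≤ d → n ^ i ≤ V
  n^i≤V {i} i≤d = begin
    n ^ i              ≤⟨ n^i≤n^d i≤d ⟩
    n ^ d              ≤⟨ m≤n*m (n ^ d) (factor k) {{>-nonZero (1≤factor k)}} ⟩
    factor k * n ^ d   ≤⟨ n≤1+n _ ⟩
    m                  ≤⟨ m≤V ⟩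
    V                  ∎
    where open ≤-Reasoning

  init-time : ℕ
  init-time = 1 + ((3 + n * 3) + (1 + ((3 + n * 3) + 1)))

  run-init : Run initᵖ [] init-time (λ _ _ → 0) Initialised
  run-init = run-assign-⨟ factorʳ (lit 0) (lit 1) 0<X 1≤V (run-seq
    (run-for′ halfᵉ k n 1 (λ i st → st factorʳ 0 ≡ factor i × st totalʳ 0 ≡ 0) refl (≤-trans k≤n n≤V) k≤n (refl , refl)
      (λ {i} {st} i<k (K≡ , Z≡) → run-assign factorʳ (lit 0) (scalar factorʳ ⊗ (lit 4 ⊗ (lit 1 ⊕ v₀)))
        0<X (≤-trans (≤-reflexive (cong (_* (4 * suc i)) K≡)) (factor≤V i<k)) (cong (_* (4 * suc i)) K≡ , Z≡))
      (λ q → q))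
    λ (K≡ , Z≡) → run-assign-⨟ powerʳ (lit 0) (lit 1) 0<X 1≤V (run-seq
    (run-for′ d′ d n 1 (λ i st → st powerʳ 0 ≡ n ^ i × st factorʳ 0 ≡ factor k × st totalʳ 0 ≡ 0) refl (≤-trans d≤n n≤V) d≤n
      (refl , K≡ , Z≡)
      (λ {i} {st} i<d (P≡ , K≡ , Z≡) → run-assign powerʳ (lit 0) (n′ ⊗ scalar powerʳ) 0<X
        (≤-trans (≤-reflexive (cong (n *_) P≡)) (n^i≤V i<d)) (cong (n *_) P≡ , K≡ , Z≡))
      (λ q → q))
    λ (P≡ , K≡ , Z≡) → let M≡ = cong suc (cong₂ _*_ K≡ P≡) in
      run-assign modulusʳ (lit 0) (lit 1 ⊕ scalar factorʳ ⊗ scalar powerʳ) 0<X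
        (≤-trans (≤-reflexive M≡) m≤V) (M≡ , K≡ , Z≡)))

  Counts : (ℕ → ℕ) → Set
  Counts f = ∀ i s → i ≤ n → s < 2 + n → f (pair i s) ≡ #subsets i s

  count-time : ℕ
  count-time = 3 + (2 + n) * (1 + 2) + (3 + n * (3 + (2 + n) * (1 + 2) + 2))

  run-count : ∀ {st} → Initialised st →
    Run countᵖ [] count-time st (λ st′ → Initialised st′ × Counts (st′ countʳ))
  run-count init = run-table countʳ [] (lit 2 ⊕ n′) n′ (lit 2 ⊕ n′) (2 + n) (2 + n) n n (λ i s x → x ≡ #subsets i s) Initialised
    (λ _ → refl) (λ _ → refl) (λ _ _ → refl) 2+n≤V ≤-refl n≤V ≤-refl init
    (λ {s} {st} s<w init → run-assign countʳ (pairᵉ (lit 0) v₀) (lit 1 ⊖ (lit 1 ⊖ v₀))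
      {Sets countʳ 0 s (λ x → x ≡ #subsets 0 s) Initialised st}
      (pair<X {0} z≤n s<w) (≤-trans (m∸n≤m 1 (1 ∸ s)) 1≤V) (init , _ , row₀ s , λ _ → refl))
    (λ {j} {s} {st} j<n s<w init row → run-assign countʳ (pairᵉ (lit 1 ⊕ v₂) v₀) (arr countʳ (pairᵉ v₂ v₀) ⊕ arr countʳ (pairᵉ v₂ (v₀ ⊖ lit 1)))
      {Sets countʳ (suc j) s (λ x → x ≡ #subsets (suc j) s) Initialised st}
      (pair<X {suc j} j<n s<w)
      (≤-trans (≤-reflexive (row₊ {f = st countʳ} row s<w)) (≤-trans (#subsets≤2^ (suc j) s) (≤-trans (^-monoʳ-≤ 2 j<n) 2^n≤V)))
      (init , _ , row₊ {f = st countʳ} row s<w , λ _ → refl))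
    where
    row₀ : ∀ s → 1 ∸ (1 ∸ s) ≡ #subsets 0 s
    row₀ zero    = refl
    row₀ (suc s) = cong (1 ∸_) (0∸n≡0 s)
    #subsets-suc : ∀ j s → #subsets j s + #subsets j (s ∸ 1) ≡ #subsets (suc j) s
    #subsets-suc zero    zero    = refl
    #subsets-suc (suc j) zero    = refl
    #subsets-suc j       (suc s) = refl
    row₊ : ∀ {j s} {f : ℕ → ℕ} → (∀ s → s < 2 + n → f (pair j s) ≡ #subsets j s) → s < 2 + n →
      f (pair j s) + f (pair j (s ∸ 1)) ≡ #subsets (suc j) s
    row₊ {j} {s} row s<w = trans (cong₂ _+_ (row s s<w) (row (s ∸ 1) (≤-<-trans (m∸n≤m s 1) s<w))) (#subsets-suc j s)

  private
    1<m : 1 < m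
    1<m = s≤s (*-mono-≤ (1≤factor k) (≤-trans (≤-reflexive (sym (^-zeroˡ d))) (^-monoˡ-≤ d n>0)))

    residue-0 : Residue 0 0ℤ
    residue-0 = s≤s z≤n , ∼-refl

    residue-1 : Residue 1 1ℤ
    residue-1 = 1<m , ∼-refl

    residue--1 : ∀ {y} → y ≡ m → Residue (y ∸ 1) -1ℤ
    residue--1 refl = n<1+n _ , -1∼

    n∸s∼n-s : ∀ {s} → s ≤ n → n ∸ s ∼ pos n -ᶻ pos s
    n∸s∼n-s {s} s≤n = ∼-reflexive (trans (sym (ℤ.⊖-≥ s≤n)) (sym (ℤ.m-n≡m⊖n n s)))

  Coefficients : (ℕ → ℕ) → Set
  Coefficients f = ∀ s → s < 1 + n → Residue (f (pair k s)) (coeff n d k s)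

  Counted : State → Set
  Counted st = Initialised st × Counts (st countʳ)

  coeff-time : ℕ
  coeff-time = 3 + (1 + n) * (1 + 2) + (3 + n * (3 + (1 + n) * (1 + 2) + 2))

  run-coeff : ∀ {st} → Counted st →
    Run coeffᵖ [] coeff-time st (λ st′ → Counted st′ × Coefficients (st′ coeffʳ))
  run-coeff counted = run-conseq
    (run-table coeffʳ [] (lit 1 ⊕ n′) halfᵉ (lit 1 ⊕ n′) (1 + n) (1 + n) k n (λ j s x → Residue x (coeff n d j s)) Counted
      (λ _ → refl) (λ _ → refl) (λ _ _ → refl) (≤-trans (n≤1+n (1 + n)) 2+n≤V) ≤-refl (≤-trans k≤n n≤V) k≤n counted
      (λ {s} {st} s<w counted → run-assign coeffʳ (pairᵉ (lit 0) v₀) (lit 1 ⊖ v₀)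
        {Sets coeffʳ 0 s (λ x → Residue x (coeff n d 0 s)) Counted st}
        (pair<X {0} z≤n (m<n⇒m<1+n s<w)) (≤-trans (m∸n≤m 1 s) 1≤V) (counted , _ , row₀ s , λ _ → refl))
      λ {j} {s} {st} j<k s<w counted row → let next = row₊ {j} {s} {st} counted row s<w in
        run-assign coeffʳ (pairᵉ (lit 1 ⊕ v₂) v₀)
          (modᵉ ((n′ ⊕ -1ᵉ ⊗ (lit 2 ⊗ d′) ⊕ lit 4 ⊗ (lit 1 ⊕ v₂)) ⊗ arr coeffʳ (pairᵉ v₂ v₀) ⊕
            -1ᵉ ⊗ (v₀ ⊗ arr coeffʳ (pairᵉ v₂ (v₀ ⊖ lit 1)) ⊕ (n′ ⊖ v₀) ⊗ arr coeffʳ (pairᵉ v₂ (lit 1 ⊕ v₀)))))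
        {Sets coeffʳ (suc j) s (λ x → Residue x (coeff n d (suc j) s)) Counted st}
        (pair<X {suc j} (≤-trans j<k k≤n) (m<n⇒m<1+n s<w)) (residue≤V next) (counted , _ , next , λ _ → refl))
    ≤-refl λ (counted , rows) → counted , λ s → rows k s ≤-refl
    where
    row₀ : ∀ s → Residue (1 ∸ s) (coeff n d 0 s)
    row₀ zero    = residue-1
    row₀ (suc s) = subst (λ x → Residue x 0ℤ) (sym (0∸n≡0 s)) residue-0
    row₊ : ∀ {j s st} → Counted st → (∀ s → s < 1 + n → Residue (st coeffʳ (pair j s)) (coeff n d j s)) → s < 1 + n →
      let x = (n + (st 0 0 ∸ 1) * (2 * d) + 4 * (1 + j)) * st coeffʳ (pair j s) +
              (st 0 0 ∸ 1) * (s * st coeffʳ (pair j (s ∸ 1)) + (n ∸ s) * st coeffʳ (pair j (suc s)))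
      in Residue (x ∸ st 0 0 * ⟦ div ⟧ᵒ x (st 0 0)) (coeff n d (suc j) s)
    row₊ {j} {s} {st} ((M≡ , _) , _) row s<w = residue-reduce M≡ (∼-resp
      (lem (pos n) (pos d) (pos (suc j)) (pos s) (coeff n d j s) (coeff n d j (pred s)) (coeff n d j (suc s)))
      (∼-+ (∼-* (∼-+ (∼-+ (∼-refl {n}) (∼-* -1∼′ (∼-* (∼-refl {2}) (∼-refl {d})))) (∼-* (∼-refl {4}) (∼-refl {suc j}))) (proj₂ (row s s<w)))
           (∼-* -1∼′ (∼-+ (∼-* (∼-refl {s}) (proj₂ (row (s ∸ 1) (≤-<-trans (m∸n≤m s 1) s<w)))) upper))))
      where
      -1∼′ : st 0 0 ∸ 1 ∼ -1ℤ
      -1∼′ = proj₂ (residue--1 M≡)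
      upper : (n ∸ s) * st coeffʳ (pair j (suc s)) ∼ (pos n -ᶻ pos s) *ᶻ coeff n d j (suc s)
      upper with s ≟ n
      ... | no s≢n = ∼-* (n∸s∼n-s (s≤s⁻¹ s<w)) (proj₂ (row (suc s) (s≤s (≤∧≢⇒< (s≤s⁻¹ s<w) s≢n))))
      -- In the last column the neighbour n + 1 lies outside the row and nothing is known about its
      -- cell, but its factor n - s is 0.
      ... | yes refl rewrite n∸n≡0 n | ℤ.+-inverseʳ (pos n) = ∼-reflexive (sym (ℤ.*-zeroˡ (coeff n d j (suc n))))
      lem : ∀ n d j s c c₋ c₊ →
        ((n +ᶻ -1ℤ *ᶻ (pos 2 *ᶻ d)) +ᶻ pos 4 *ᶻ j) *ᶻ c +ᶻ -1ℤ *ᶻ (s *ᶻ c₋ +ᶻ (n -ᶻ s) *ᶻ c₊) ≡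
        (n -ᶻ pos 2 *ᶻ d +ᶻ pos 4 *ᶻ j) *ᶻ c -ᶻ (s *ᶻ c₋ +ᶻ (n -ᶻ s) *ᶻ c₊)
      lem = ℤ-Solver.solve-∀

  Globals : State → Set
  Globals st = st modulusʳ 0 ≡ m × st factorʳ 0 ≡ factor k × Counts (st countʳ) × Coefficients (st coeffʳ)

  a : ℕ → ℕ → ℕ
  a u w = read σ₀ (2 + (u * n + w))

  K B : ℕ
  K = suc k
  B = #subsets n K

  term : ℕ → ℤ
  term r = coeff n d k (K ∸ rest n K r) *ᶻ ∑ n (λ v → walks n a (sign n K r) v d v)

  -- The invariant of the main loop
  Summed : ℕ → State → Set
  Summed r st = Globals st × Residue (st totalʳ 0) (∑ r term)

  private
    K≤1+n : K ≤ 1 + n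
    K≤1+n = s≤s k≤n

    B≤V : B ≤ V
    B≤V = ≤-trans (#subsets≤2^ n K) 2^n≤V

  -- The state of unranking r once the positions from i upwards have been decided: the rest of
  -- the subset has rank q among those with budget s.
  record Decided (r i : ℕ) (x : ℕ → ℕ) (s q : ℕ) : Set where
    field
      q<    : q < #subsets i s
      s≤    : s ≤ K
      rest≡ : rest n K r ≡ rest i s q
      sign≡ : ∀ u → u < i → sign n K r u ≡ sign i s q u
      done  : ∀ u → i ≤ u → u < n → Residue (x u) (sign n K r u)

  module _ {r i x s q} (D : Decided r (suc i) x s q) where
    open Decided D

    private
      set : ∀ {y z} → Residue y z → sign n K r i ≡ z →
        ∀ u → i ≤ u → u < n → Residue ((x [ i ↦ y ]) u) (sign n K r u)
      set y∼z eq u i≤u u<n with i ≟ u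
      ... | yes refl rewrite ≡ᵇ-refl i = subst (Residue _) (sym eq) y∼z
      ... | no  i≢u  rewrite ≡ᵇ-false i≢u = done u (≤∧≢⇒< i≤u i≢u) u<n

    -- The first `#subsets i s` ranks belong to the subsets that avoid i, so rank and budget carry
    -- over unchanged.
    decide-out : q < #subsets i s → Decided r i (x [ i ↦ 1 ]) s q
    decide-out q<b = record
      { q< = q<b ; s≤ = s≤
      ; rest≡ = trans rest≡ (cong (λ t → ifᵇ t then rest i s q else rest i (pred s) (q ∸ #subsets i s)) q<ᵇb)
      ; sign≡ = λ u u<i → trans (sign≡ u (m<n⇒m<1+n u<i)) (sign-below u u<i)
      ; done = set residue-1 (trans (sign≡ i (n<1+n i)) sign-at)
      }
      where
      q<ᵇb : (q <ᵇ #subsets i s) ≡ true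
      q<ᵇb = T⇒≡true (<⇒<ᵇ q<b)
      sign-below : ∀ u → u < i → sign (suc i) s q u ≡ sign i s q u
      sign-below u u<i rewrite q<ᵇb | ≡ᵇ-false (<⇒≢ u<i) = refl
      sign-at : sign (suc i) s q i ≡ 1ℤ
      sign-at rewrite q<ᵇb | ≡ᵇ-refl i = refl

    decide-in : ∀ {y} → Residue y -1ℤ → ¬ q < #subsets i s → Decided r i (x [ i ↦ y ]) (s ∸ 1) (q ∸ #subsets i s)
    decide-in y∼-1 q≮b = record
      { q< = bound s q< (≮⇒≥ q≮b) ; s≤ = ≤-trans (m∸n≤m s 1) s≤
      ; rest≡ = trans rest≡ (cong (λ t → ifᵇ t then rest i s q else rest i (pred s) (q ∸ #subsets i s)) q≮ᵇb)
      ; sign≡ = λ u u<i → trans (sign≡ u (m<n⇒m<1+n u<i)) (sign-below u u<i)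
      ; done = set y∼-1 (trans (sign≡ i (n<1+n i)) sign-at)
      }
      where
      q≮ᵇb : (q <ᵇ #subsets i s) ≡ false
      q≮ᵇb = ¬T⇒≡false (q≮b ∘ <ᵇ⇒< q (#subsets i s))
      sign-below : ∀ u → u < i → sign (suc i) s q u ≡ sign i (pred s) (q ∸ #subsets i s) u
      sign-below u u<i rewrite q≮ᵇb | ≡ᵇ-false (<⇒≢ u<i) = refl
      sign-at : sign (suc i) s q i ≡ -1ℤ
      sign-at rewrite q≮ᵇb | ≡ᵇ-refl i = refl
      bound : ∀ s → q < #subsets (suc i) s → #subsets i s ≤ q → q ∸ #subsets i s < #subsets i (s ∸ 1)
      bound (suc s) q< b≤q = +-cancelˡ-< (#subsets i (suc s)) _ _ (subst (_< #subsets i (suc s) + #subsets i s) (sym (m+[n∸m]≡n b≤q)) q<)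

  Unranked : ℕ → ℕ → State → Set
  Unranked r i st = Summed r st × Decided r i (st signʳ) (st restʳ 0) (st rankʳ 0)

  unrank-time : ℕ
  unrank-time = 1 + (1 + (3 + n * (4 + 2)))

  run-decide : ∀ {r v st} {lim : ℕ} → v < n → Unranked r (suc (n ∸ 1 ∸ v)) st →
    Run (if compile (countᵉ ⊖ scalar rankʳ) then (signʳ ⟪ positionᵉ ⟫≔ lit 1)
      else (signʳ ⟪ positionᵉ ⟫≔ -1ᵉ ⨟ rankʳ ⟪ lit 0 ⟫≔ scalar rankʳ ⊖ countᵉ ⨟ restʳ ⟪ lit {4} 0 ⟫≔ scalar restʳ ⊖ lit 1))
      (v ∷ n ∷ r ∷ lim ∷ []) 4 st (Unranked r (n ∸ 1 ∸ v))
  run-decide {r} {v} {st} v<n (summed@((M≡ , _ , counts , _) , _) , D) = run-if (countᵉ ⊖ scalar rankʳ)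
    (λ ≢0 → run-conseq
      (run-assign signʳ positionᵉ (lit 1) {Unranked r i} i<X 1≤V (summed , decide-out D (q< ≢0)))
      (s≤s z≤n) λ u → u)
    (λ ≡0 → run-assign-⨟ signʳ positionᵉ -1ᵉ i<X (residue≤V (residue--1 M≡))
      (run-assign-⨟ rankʳ (lit 0) (scalar rankʳ ⊖ countᵉ) 0<X
        (≤-trans (m∸n≤m (st rankʳ 0) (st countʳ (pair i (st restʳ 0)))) q≤V)
      (run-assign restʳ (lit 0) (scalar restʳ ⊖ lit 1) {Unranked r i} 0<X
        (≤-trans (m∸n≤m (st restʳ 0) 1) s≤V)
        (summed , subst (Decided r i _ _) (cong (st rankʳ 0 ∸_) (sym count≡)) (decide-in D (residue--1 M≡) (q≮ ≡0))))))
    where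
    i : ℕ
    i = n ∸ 1 ∸ v
    i<n : i < n
    i<n = ≤-<-trans (m∸n≤m (n ∸ 1) v) (∸-monoʳ-< {n} {1} {0} (s≤s z≤n) n>0)
    i<X : i < X
    i<X = ≤-<-trans (≤-trans (m≤n+m i _) (≤-reflexive refl)) (pair<X {i} {0} (<⇒≤ i<n) (s≤s z≤n))
    s≤ : st restʳ 0 ≤ K
    s≤ = Decided.s≤ D
    s≤V : st restʳ 0 ≤ V
    s≤V = ≤-trans s≤ (≤-trans K≤1+n (≤-trans (n≤1+n _) 2+n≤V))
    count≡ : st countʳ (pair i (st restʳ 0)) ≡ #subsets i (st restʳ 0)
    count≡ = counts i (st restʳ 0) (<⇒≤ i<n) (s≤s (≤-trans s≤ K≤1+n))
    q≤V : st rankʳ 0 ≤ V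
    q≤V = ≤-trans (<⇒≤ (Decided.q< D)) (≤-trans (#subsets≤2^ (suc i) (st restʳ 0)) (≤-trans (^-monoʳ-≤ 2 i<n) 2^n≤V))
    q< : st countʳ (pair i (st restʳ 0)) ∸ st rankʳ 0 ≢ 0 → st rankʳ 0 < #subsets i (st restʳ 0)
    q< ≢0 = ≰⇒> λ b≤q → ≢0 (trans (cong (_∸ st rankʳ 0) count≡) (m≤n⇒m∸n≡0 b≤q))
    q≮ : st countʳ (pair i (st restʳ 0)) ∸ st rankʳ 0 ≡ 0 → ¬ st rankʳ 0 < #subsets i (st restʳ 0)
    q≮ ≡0 = ≤⇒≯ (m∸n≡0⇒m≤n (trans (cong (_∸ st rankʳ 0) (sym count≡)) ≡0))

  run-unrank : ∀ {r st} → r < B → Summed r st → Run unrankᵖ (r ∷ B ∷ []) unrank-time st (Unranked r 0)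
  run-unrank {r} {st} r<B summed = run-assign-⨟ restʳ (lit 0) (lit 1 ⊕ halfᵉ) 0<X
    (≤-trans K≤1+n (≤-trans (n≤1+n _) 2+n≤V))
    (run-assign-⨟ rankʳ (lit 0) v₀ 0<X (≤-trans (<⇒≤ r<B) B≤V)
    -- Before round v, the positions from n - v upwards have been decided.
    (run-for′ n′ n n 4 (λ v → Unranked r (n ∸ v)) refl n≤V ≤-refl
      (summed , record { q< = r<B ; s≤ = ≤-refl ; rest≡ = refl ; sign≡ = λ _ _ → refl
                       ; done = λ u n≤u u<n → contradiction u<n (≤⇒≯ n≤u) })
      (λ {v} {st′} v<n unranked → run-conseq
        (run-decide v<n (subst (λ i → Unranked r i st′) (n∸v≡ v<n) unranked)) ≤-refl
        λ {st″} → subst (λ i → Unranked r i st″) (∸-+-assoc n 1 v))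
      λ {st′} → subst (λ i → Unranked r i st′) (n∸n≡0 n)))
    where
    n∸v≡ : ∀ {v} → v < n → n ∸ v ≡ suc (n ∸ 1 ∸ v)
    n∸v≡ {v} v<n = trans (+-∸-assoc 1 v<n) (cong suc (sym (∸-+-assoc n 1 v)))

  module Iteration (r : ℕ) where

    x : ℕ → ℤ
    x = sign n K r

    Signed : State → Set
    Signed st = Summed r st × (∀ u → u < n → Residue (st signʳ u) (x u)) × st restʳ 0 ≡ rest n K r

    Traced : ℕ → State → Set
    Traced v st = Signed st × Residue (st traceʳ 0) (∑ v (λ v → walks n a x v d v))

    Walks : (v j u c : ℕ) → Set
    Walks v j u c = Residue c (walks n a x v j u)

    entry-time walks-time trace-time : ℕ
    entry-time = 1 + ((3 + n * (1 + 2)) + 1)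
    walks-time = 3 + n * (1 + 2) + (3 + n * (3 + n * (entry-time + 2) + 2))
    trace-time = 1 + (3 + n * ((walks-time + 1) + 2))

    private
      adj≡ : ∀ {u w} → u < n → w < n → let z = u * n + w in read σ₀ (2 + (z ∸ (z ∸ (n * n ∸ 1)))) ≡ a u w
      adj≡ {u} {w} u<n w<n = cong (λ y → read σ₀ (2 + (u * n + w ∸ y))) (m≤n⇒m∸n≡0 (∸-monoˡ-≤ 1 (begin-strict
        u * n + w   <⟨ +-monoʳ-< (u * n) w<n ⟩
        u * n + n   ≡⟨ +-comm (u * n) n ⟩
        suc u * n   ≤⟨ *-monoˡ-≤ n u<n ⟩
        n * n       ∎)))
        where open ≤-Reasoning

      ∸+∸≢0 : ∀ u v → u ≢ v → (u ∸ v) + (v ∸ u) ≢ 0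
      ∸+∸≢0 u v u≢v eq = u≢v (≤-antisym (m∸n≡0⇒m≤n (m+n≡0⇒m≡0 (u ∸ v) eq)) (m∸n≡0⇒m≤n (m+n≡0⇒n≡0 (u ∸ v) eq)))

      walks-0 : ∀ u v → Walks v 0 u (1 ∸ ((u ∸ v) + (v ∸ u)))
      walks-0 u v with u ≟ v
      ... | yes refl rewrite n∸n≡0 u | δ-refl u = residue-1
      ... | no u≢v rewrite δ-≢ u≢v | m≤n⇒m∸n≡0 {1} (n≢0⇒n>0 (∸+∸≢0 u v u≢v)) = residue-0

    run-entry : ∀ {v j u st} → j < d → u < n → Traced v st →
      (∀ w → w < n → Walks v j w (st walksʳ (pair j w))) →
      Run entryᵖ (u ∷ n ∷ j ∷ d ∷ v ∷ n ∷ r ∷ B ∷ []) entry-time st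
        (Sets walksʳ (suc j) u (Walks v (suc j) u) (Traced v) st)
    run-entry {v} {j} {u} {st} j<d u<n traced row = run-assign-⨟ entryʳ (lit 0) (lit 0) 0<X z≤n (run-seq
      (run-for′ n′ n n 1 Partial refl n≤V ≤-refl (traced , refl , residue-0)
        (λ {w} {st′} w<n q → let sum = partial {w} {st′} w<n q in
          run-assign entryʳ (lit 0) (modᵉ (scalar entryʳ ⊕ adj (v₂ ⊗ n′ ⊕ v₀) ⊗ arr signʳ v₀ ⊗ arr walksʳ (pairᵉ v₄ v₀)))
            {Partial (suc w)} 0<X (residue≤V sum) (proj₁ q , proj₁ (proj₂ q) , sum))
        λ q → q)
      λ (traced , same , sum) → run-assign walksʳ (pairᵉ (lit 1 ⊕ v₂) v₀) (scalar entryʳ)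
        {Sets walksʳ (suc j) u (Walks v (suc j) u) (Traced v) st}
        (pair<X {suc j} (≤-trans j<d d≤n) (≤-trans u<n (m≤n+m n 2))) (residue≤V sum)
        (traced , _ , sum , λ i → cong (λ f → (f [ pair (suc j) u ↦ _ ]) i) same))
      where
      -- The hypothesis on row j is about the table in `st`, so the invariant has to record that the
      -- accumulation leaves the table alone.
      Partial : ℕ → State → Set
      Partial w st′ = Traced v st′ × st′ walksʳ ≡ st walksʳ ×
        Residue (st′ entryʳ 0) (∑ w (λ w → pos (a u w) *ᶻ x w *ᶻ walks n a x v j w))
      partial : ∀ {w st′} → w < n → Partial w st′ →
        let z = u * n + w
            y = st′ entryʳ 0 + read σ₀ (2 + (z ∸ (z ∸ (n * n ∸ 1)))) * st′ signʳ w * st′ walksʳ (pair j w)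
        in Residue (y ∸ st′ 0 0 * ⟦ div ⟧ᵒ y (st′ 0 0)) (∑ (suc w) (λ w → pos (a u w) *ᶻ x w *ᶻ walks n a x v j w))
      partial {w} {st′} w<n (((((M≡ , _) , _) , signs , _) , _) , same , sum) = residue-reduce M≡
        (∼-+ (proj₂ sum) (∼-* (∼-* (∼-reflexive (cong pos (adj≡ u<n w<n))) (proj₂ (signs w w<n)))
          (subst (λ f → f (pair j w) ∼ walks n a x v j w) (sym same) (proj₂ (row w w<n)))))

    run-walks : ∀ {v st} → v < n → Traced v st →
      Run walksᵖ (v ∷ n ∷ r ∷ B ∷ []) walks-time st
        (λ st′ → Traced v st′ × (∀ j u → j ≤ d → u < n → Walks v j u (st′ walksʳ (pair j u))))
    run-walks {v} v<n traced = run-table walksʳ (v ∷ n ∷ r ∷ B ∷ []) n′ d′ n′ n n d n (Walks v) (Traced v)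
      (λ _ → refl) (λ _ → refl) (λ _ _ → refl) n≤V ≤-refl (≤-trans d≤n n≤V) d≤n traced
      (λ {u} {st} u<n traced → run-assign walksʳ (pairᵉ (lit 0) v₀) (lit 1 ⊖ ((v₀ ⊖ v₂) ⊕ (v₂ ⊖ v₀)))
        {Sets walksʳ 0 u (Walks v 0 u) (Traced v) st}
        (pair<X {0} z≤n (≤-trans u<n (m≤n+m n 2))) (≤-trans (m∸n≤m 1 ((u ∸ v) + (v ∸ u))) 1≤V)
        (traced , _ , walks-0 u v , λ _ → refl))
      λ j<d u<n traced row → run-entry j<d u<n traced row

    run-trace : ∀ {st} → Signed st →
      Run traceᵖ (r ∷ B ∷ []) trace-time st (Traced n)
    run-trace signed = run-assign-⨟ traceʳ (lit 0) (lit 0) 0<X z≤n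
      (run-for′ n′ n n (walks-time + 1) Traced refl n≤V ≤-refl (signed , residue-0)
        (λ {v} v<n traced → run-seq (run-walks v<n traced)
          λ {st′} (traced′ , table) → let sum = trace {v} {st′} v<n (traced′ , table) in
            run-assign traceʳ (lit 0) (modᵉ (scalar traceʳ ⊕ arr walksʳ (pairᵉ d′ v₀)))
              {Traced (suc v)} 0<X (residue≤V sum) (proj₁ traced′ , sum))
        λ q → q)
      where
      trace : ∀ {v st} → v < n → Traced v st × (∀ j u → j ≤ d → u < n → Walks v j u (st walksʳ (pair j u))) →
        let y = st traceʳ 0 + st walksʳ (pair d v)
        in Residue (y ∸ st 0 0 * ⟦ div ⟧ᵒ y (st 0 0)) (∑ (suc v) (λ v → walks n a x v d v))
      trace {v} v<n (((((M≡ , _) , _) , _) , sum) , table) = residue-reduce M≡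
        (∼-+ (proj₂ sum) (proj₂ (table d v ≤-refl v<n)))

    iteration-time : ℕ
    iteration-time = unrank-time + (trace-time + 1)

    run-iteration : ∀ {st} → r < B → Summed r st →
      Run (unrankᵖ ⨟ traceᵖ ⨟ totalʳ ⟪ lit {2} 0 ⟫≔ modᵉ
             (scalar totalʳ ⊕ arr coeffʳ (pairᵉ halfᵉ (lit 1 ⊕ halfᵉ ⊖ scalar restʳ)) ⊗ scalar traceʳ))
        (r ∷ B ∷ []) iteration-time st (Summed (suc r))
    run-iteration r<B summed = run-seq (run-unrank r<B summed)
      λ (summed , D) → run-seq (run-trace (summed , (λ u → Decided.done D u z≤n) , sym (Decided.rest≡ D)))
      λ {st} traced → let sum = total {st} traced in
        run-assign totalʳ (lit 0) (modᵉ (scalar totalʳ ⊕ arr coeffʳ (pairᵉ halfᵉ (lit 1 ⊕ halfᵉ ⊖ scalar restʳ)) ⊗ scalar traceʳ))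
          {Summed (suc r)} 0<X (residue≤V sum) (proj₁ (proj₁ (proj₁ traced)) , sum)
      where
      -- Even the crude bound K on the size is a column of the coefficient table: k < d because d is
      -- positive, so K ≤ d ≤ n.
      K<1+n : K < 1 + n
      K<1+n = s≤s (<-≤-trans (m/n<m d 2 {{>-nonZero 0<d}} (s≤s (s≤s z≤n))) d≤n)
      total : ∀ {st} → Traced n st →
        let y = st totalʳ 0 + st coeffʳ (pair k (K ∸ st restʳ 0)) * st traceʳ 0
        in Residue (y ∸ st 0 0 * ⟦ div ⟧ᵒ y (st 0 0)) (∑ (suc r) term)
      total {st} ((((M≡ , _ , _ , coefficients) , total) , _ , rest≡) , trace) = residue-reduce M≡
        (∼-+ (proj₂ total) (∼-* (subst (λ s → st coeffʳ (pair k (K ∸ s)) ∼ coeff n d k (K ∸ rest n K r)) (sym rest≡)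
          (proj₂ (coefficients (K ∸ rest n K r) (≤-<-trans (m∸n≤m K (rest n K r)) K<1+n)))) (proj₂ trace)))

  main-time : ℕ
  -- The time of an iteration is the same for all ranks; 0 is an arbitrary choice.
  main-time = init-time + (count-time + (coeff-time + (3 + B * (Iteration.iteration-time 0 + 2))))

  run-main : Run mainᵖ [] main-time (λ _ _ → 0) (Summed B)
  run-main = run-seq run-init λ init → run-seq (run-count init) λ counted → run-seq (run-coeff counted)
    λ (((M≡ , K≡ , Z≡) , counts) , coefficients) →
      run-for′ (arr countʳ (pairᵉ n′ (lit 1 ⊕ halfᵉ))) B B (Iteration.iteration-time 0) Summed
        (counts n K ≤-refl (s≤s K≤1+n)) B≤V ≤-refl
        ((M≡ , K≡ , counts , coefficients) , subst (λ t → Residue t 0ℤ) (sym Z≡) residue-0)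
        (λ {r} r<B summed → Iteration.run-iteration r r<B summed)
        λ q → q

-- Binomial coefficients

nC0≡1 : ∀ n → n C 0 ≡ 1
nC0≡1 n = trans (nCk≡nC[n∸k] {n = n} z≤n) (nCn≡1 n)

nCk>0 : ∀ {n k} → k ≤ n → 1 ≤ n C k
nCk>0 {n}     {zero}  _         = ≤-reflexive (sym (nC0≡1 n))
nCk>0 {suc n} {suc k} (s≤s k≤n) =
  ≤-trans (nCk>0 k≤n) (≤-trans (m≤m+n (n C k) (n C suc k)) (≤-reflexive (nCk+nC[k+1]≡[n+1]C[k+1] n k)))

-- In the inductive step, Pascal's rule on both sides leaves n C k ≤ n C (k + 2) for the smaller n.
-- If n = 2k + 2, these are equal by symmetry; otherwise both steps from k to k + 2 stay within the
-- first half of the row.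
nCk≤nC[k+1] : ∀ n k → suc (k + k) ≤ n → n C k ≤ n C suc k
nCk≤nC[k+1] (suc n) zero    _ = subst₂ _≤_ (sym (nC0≡1 (suc n))) (sym (nC1≡n (suc n))) (s≤s z≤n)
nCk≤nC[k+1] (suc n) (suc k) (s≤s h) = begin
  suc n C suc k                   ≡⟨ nCk+nC[k+1]≡[n+1]C[k+1] n k ⟨
  n C k + n C suc k               ≡⟨ +-comm (n C k) (n C suc k) ⟩
  n C suc k + n C k               ≤⟨ +-monoʳ-≤ (n C suc k) twice ⟩
  n C suc k + n C suc (suc k)     ≡⟨ nCk+nC[k+1]≡[n+1]C[k+1] n (suc k) ⟩
  suc n C suc (suc k)             ∎
  where
  open ≤-Reasoning
  2+k+k≤n : suc (suc (k + k)) ≤ n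
  2+k+k≤n = subst (_≤ n) (cong suc (+-suc k k)) h
  twice : n C k ≤ n C suc (suc k)
  twice with n ≟ suc (suc (k + k))
  ... | no n≢ = ≤-trans (nCk≤nC[k+1] n k (≤-trans (n≤1+n _) 2+k+k≤n))
    (nCk≤nC[k+1] n (suc k) (subst (_≤ n) (cong (λ x → suc (suc x)) (sym (+-suc k k))) (≤∧≢⇒< 2+k+k≤n (≢-sym n≢))))
  ... | yes refl = ≤-reflexive (trans (cong (n C_) (sym (m+n∸m≡n (suc (suc k)) k))) (sym (nCk≡nC[n∸k] {n = n} (m≤m+n (suc (suc k)) k))))

nC-mono : ∀ n {j k} → j ≤ k → k + k ≤ n → n C j ≤ n C k
nC-mono n {j} j≤k k+k≤n with m≤n⇒∃[o]m+o≡n j≤k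
... | o , refl = go o k+k≤n
  where
  go : ∀ o → (j + o) + (j + o) ≤ n → n C j ≤ n C (j + o)
  go zero    _ = ≤-reflexive (cong (n C_) (sym (+-identityʳ j)))
  go (suc o) h rewrite +-suc j o = ≤-trans (go o (≤-trans (n≤1+n _) h′)) (nCk≤nC[k+1] n (j + o) h′)
    where
    h′ : suc ((j + o) + (j + o)) ≤ n
    h′ = ≤-trans (n≤1+n _) (subst (_≤ n) (cong suc (+-suc (j + o) (j + o))) h)

#subsets-suc : ∀ i s → #subsets i (suc s) ≡ #subsets i s + i C s
#subsets-suc zero    zero          = refl
#subsets-suc zero    (suc s)       = refl
#subsets-suc (suc i) zero          = begin
  #subsets i 1 + #subsets i 0      ≡⟨ cong₂ _+_ (#subsets-suc i 0) (#subsets-0 i) ⟩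
  #subsets i 0 + i C 0 + 0  ≡⟨ cong₂ (λ x y → x + y + 0) (#subsets-0 i) (nC0≡1 i) ⟩
  1                  ≡⟨ nC0≡1 (suc i) ⟨
  suc i C 0          ∎
  where
  open ≡-Reasoning
#subsets-suc (suc i) (suc s)       = begin
  #subsets i (suc (suc s)) + #subsets i (suc s)                 ≡⟨ cong₂ _+_ (#subsets-suc i (suc s)) (#subsets-suc i s) ⟩
  (#subsets i (suc s) + i C suc s) + (#subsets i s + i C s)     ≡⟨ lem (#subsets i (suc s)) (i C suc s) (#subsets i s) (i C s) ⟩
  (#subsets i (suc s) + #subsets i s) + (i C s + i C suc s)     ≡⟨ cong (#subsets i (suc s) + #subsets i s +_) (nCk+nC[k+1]≡[n+1]C[k+1] i s) ⟩
  #subsets (suc i) (suc s) + suc i C suc s               ∎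
  where
  open ≡-Reasoning
  lem : ∀ a b c d → (a + b) + (c + d) ≡ (a + c) + (d + b)
  lem = solve-∀

-- Up to the middle of the row the binomial coefficients increase, so each of the k + 1 sizes
-- contributes at most as many subsets as size k.
#subsets≤ : ∀ n k → k + k ≤ n → #subsets n (suc k) ≤ suc k * (n C k)
#subsets≤ n k k+k≤n = go (suc k) ≤-refl
  where
  go : ∀ s → s ≤ suc k → #subsets n s ≤ s * (n C k)
  go zero    _         = ≤-reflexive (#subsets-0 n)
  go (suc s) (s≤s s≤k) = begin
    #subsets n (suc s)                ≡⟨ #subsets-suc n s ⟩
    #subsets n s + n C s              ≤⟨ +-mono-≤ (go s (m≤n⇒m≤1+n s≤k)) (nC-mono n s≤k k+k≤n) ⟩
    s * (n C k) + n C k        ≡⟨ +-comm (s * (n C k)) (n C k) ⟩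
    suc s * (n C k)            ∎
    where open ≤-Reasoning

#subsets>0 : ∀ i s → 1 ≤ #subsets i (suc s)
#subsets>0 zero    s = s≤s z≤n
#subsets>0 (suc i) s = ≤-trans (#subsets>0 i s) (m≤m+n _ _)

-- The number of simple cycles

length-cartesianProductWith : ∀ {A B C : Set} (f : A → B → C) xs ys →
  length (cartesianProductWith f xs ys) ≡ length xs * length ys
length-cartesianProductWith f []       ys = refl
length-cartesianProductWith f (x ∷ xs) ys = trans (List.length-++ (map (f x) ys))
  (cong₂ _+_ (List.length-map (f x) ys) (length-cartesianProductWith f xs ys))

length-allFin : ∀ n → length (allFin n) ≡ n
length-allFin n = List.length-tabulate {n = n} (λ i → i)

length-sequences : ∀ n d → length (sequences n d) ≡ n ^ d
length-sequences n zero    = refl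
length-sequences n (suc d) = trans (length-cartesianProductWith _∷_ (allFin n) (sequences n d))
  (cong₂ _*_ (length-allFin n) (length-sequences n d))

#simpleCycles≤n^d : ∀ {n} (G : Digraph n) d .{{_ : NonZero d}} → #simpleCycles G d ≤ n ^ d
#simpleCycles≤n^d {n} G d = ≤-trans (List.length-filter (isSimpleCycle? G) (sequences n d)) (≤-reflexive (length-sequences n d))

-- The pigeonhole principle by double counting: d is the sum of the n multiplicities, each at most
-- 1.
Unique⇒d≤n : ∀ {n d} {w : Vec (Fin n) d} → Unique w → d ≤ n
Unique⇒d≤n {n} {d} {w} uniq = subst₂ _≤_ (∑ℕ-multiplicity w) (∑ℕ-1 n) (∑ℕ-mono n (Unique⇒multiplicity≤1 uniq))
  where
  ∑ℕ-1 : ∀ n → ∑ℕ n (λ _ → 1) ≡ n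
  ∑ℕ-1 zero    = refl
  ∑ℕ-1 (suc n) = trans (+-comm _ 1) (cong suc (∑ℕ-1 n))

#simpleCycles≡0 : ∀ {n} (G : Digraph n) d .{{_ : NonZero d}} → n < d → #simpleCycles G d ≡ 0
#simpleCycles≡0 {n} G d n<d = cong length (List.filter-none (isSimpleCycle? G)
  (All.universal (λ w (_ , uniq) → <⇒≱ n<d (Unique⇒d≤n uniq)) (sequences n d)))

-- The initial memory

read-≥length : ∀ σ a → length σ ≤ a → read σ a ≡ 0
read-≥length []      a       _         = refl
read-≥length (x ∷ σ) (suc a) (s≤s h)   = read-≥length σ a h

read-++ˡ : ∀ σ τ a → a < length σ → read (σ ++ τ) a ≡ read σ a
read-++ˡ (x ∷ σ) τ zero    _       = refl
read-++ˡ (x ∷ σ) τ (suc a) (s≤s h) = read-++ˡ σ τ a h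

read-++ʳ : ∀ σ τ a → read (σ ++ τ) (length σ + a) ≡ read τ a
read-++ʳ []      τ a = refl
read-++ʳ (x ∷ σ) τ a = read-++ʳ σ τ a

read-≤ : ∀ {c} σ a → All.All (_≤ c) σ → read σ a ≤ c
read-≤ []      a       _           = z≤n
read-≤ (x ∷ σ) zero    (h All.∷ _) = h
read-≤ (x ∷ σ) (suc a) (_ All.∷ h) = read-≤ σ a h

read-map-tabulate : ∀ {A : Set} n (g : Fin n → A) (f : A → ℕ) v → read (map f (tabulate g)) (toℕ v) ≡ f (g v)
read-map-tabulate (suc n) g f zero    = refl
read-map-tabulate (suc n) g f (suc v) = read-map-tabulate n (g ∘ suc) f v

read-cartesianProductWith : ∀ {A B : Set} m (g : Fin m → A) (ys : List B) (f : A → B → ℕ) u j → j < length ys →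
  read (cartesianProductWith f (tabulate g) ys) (toℕ u * length ys + j) ≡ read (map (f (g u)) ys) j
read-cartesianProductWith (suc m) g ys f zero    j j< =
  read-++ˡ (map (f (g zero)) ys) _ j (subst (j <_) (sym (List.length-map (f (g zero)) ys)) j<)
read-cartesianProductWith (suc m) g ys f (suc u) j j< = begin
  read (row ++ rows) (length ys + toℕ u * length ys + j)
    ≡⟨ cong (read (row ++ rows)) (trans (+-assoc (length ys) (toℕ u * length ys) j)
         (cong (_+ (toℕ u * length ys + j)) (sym (List.length-map (f (g zero)) ys)))) ⟩
  read (row ++ rows) (length row + (toℕ u * length ys + j))
    ≡⟨ read-++ʳ row rows (toℕ u * length ys + j) ⟩
  read rows (toℕ u * length ys + j)
    ≡⟨ read-cartesianProductWith m (g ∘ suc) ys f u j j< ⟩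
  read (map (f (g (suc u))) ys) j ∎
  where
  open ≡-Reasoning
  row rows : List ℕ
  row  = map (f (g zero)) ys
  rows = cartesianProductWith f (tabulate (g ∘ suc)) ys

module _ {n} (G : Digraph n) (d : ℕ) where

  private
    matrix : List ℕ
    matrix = cartesianProductWith (λ u v → bit (G u v)) (allFin n) (allFin n)

  read-input : ∀ u v → read (input G d) (2 + (toℕ u * n + toℕ v)) ≡ bit (G u v)
  read-input u v = begin
    read matrix (toℕ u * n + toℕ v)
      ≡⟨ cong (λ l → read matrix (toℕ u * l + toℕ v)) (length-allFin n) ⟨
    read matrix (toℕ u * length (allFin n) + toℕ v)
      ≡⟨ read-cartesianProductWith n (λ i → i) (allFin n) (λ u v → bit (G u v)) u (toℕ v)
           (subst (toℕ v <_) (sym (length-allFin n)) (Fin.toℕ<n v)) ⟩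
    read (map (λ v → bit (G u v)) (allFin n)) (toℕ v)
      ≡⟨ read-map-tabulate n (λ i → i) (λ v → bit (G u v)) v ⟩
    bit (G u v) ∎
    where open ≡-Reasoning

  length-input : length (input G d) ≡ n * n + 2
  length-input = trans (cong (2 +_) (trans (length-cartesianProductWith _ (allFin n) (allFin n))
    (cong₂ _*_ (length-allFin n) (length-allFin n)))) (+-comm 2 (n * n))

  input-≤ : ∀ {V} → n ≤ V → d ≤ V → 1 ≤ V → ∀ a → read (input G d) a ≤ V
  input-≤ n≤V d≤V 1≤V zero          = n≤V
  input-≤ n≤V d≤V 1≤V (suc zero)    = d≤V
  input-≤ n≤V d≤V 1≤V (suc (suc a)) = ≤-trans (read-≤ matrix a (bits (allFin n))) 1≤V
    where
    bit≤1 : ∀ x → bit x ≤ 1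
    bit≤1 true  = ≤-refl
    bit≤1 false = z≤n
    row : ∀ u vs {σ} → All.All (_≤ 1) σ → All.All (_≤ 1) (map (λ v → bit (G u v)) vs ++ σ)
    row u []       h = h
    row u (v ∷ vs) h = bit≤1 (G u v) All.∷ row u vs h
    bits : ∀ us → All.All (_≤ 1) (cartesianProductWith (λ u v → bit (G u v)) us (allFin n))
    bits []       = All.[]
    bits (u ∷ us) = row u (allFin n) (bits us)

-- Lengths of the numbers that bound the contents of the memory

∥^∥ : ∀ x i → ∥ x ^ i ∥ ≤ 1 + i * ∥ x ∥
∥^∥ x zero    = ≤-refl
∥^∥ x (suc i) = begin
  ∥ x * x ^ i ∥                ≤⟨ ∥*∥ x (x ^ i) ⟩
  ∥ x ∥ + ∥ x ^ i ∥            ≤⟨ +-monoʳ-≤ ∥ x ∥ (∥^∥ x i) ⟩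
  ∥ x ∥ + (1 + i * ∥ x ∥)      ≡⟨ +-suc ∥ x ∥ (i * ∥ x ∥) ⟩
  1 + suc i * ∥ x ∥            ∎
  where open ≤-Reasoning

∥factor∥ : ∀ {n} i → i ≤ n → ∥ factor i ∥ ≤ 1 + i * (1 + 4 * n)
∥factor∥ zero    _ = ≤-refl
∥factor∥ {n} (suc i) i<n = begin
  ∥ factor i * (4 * suc i) ∥                    ≤⟨ ∥*∥ (factor i) (4 * suc i) ⟩
  ∥ factor i ∥ + ∥ 4 * suc i ∥                  ≤⟨ +-mono-≤ (∥factor∥ i (<⇒≤ i<n))
                                                     (≤-trans (∥x∥≤1+x (4 * suc i)) (s≤s (*-monoʳ-≤ 4 i<n))) ⟩
  1 + i * (1 + 4 * n) + (1 + 4 * n)             ≡⟨ cong suc (+-comm (i * (1 + 4 * n)) (1 + 4 * n)) ⟩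
  1 + suc i * (1 + 4 * n)                       ∎
  where open ≤-Reasoning

-- Polynomials

infixl 6 _⊞_
infixl 7 _⊠_

-- Syntax is used besides coefficient lists because its evaluation unfolds to ordinary arithmetic
-- and so matches the time expressions of the program directly; `coefficients` then produces the
-- lists that the statement asks for.
data Polynomial : Set where
  X       : Polynomial
  con     : ℕ → Polynomial
  _⊞_ _⊠_ : Polynomial → Polynomial → Polynomial

⟦_⟧ₚ : Polynomial → ℕ → ℕ
⟦ X ⟧ₚ     n = n
⟦ con a ⟧ₚ n = a
⟦ p ⊞ q ⟧ₚ n = ⟦ p ⟧ₚ n + ⟦ q ⟧ₚ n
⟦ p ⊠ q ⟧ₚ n = ⟦ p ⟧ₚ n * ⟦ q ⟧ₚ n

plus : Poly → Poly → Poly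
plus []      q       = q
plus (a ∷ p) []      = a ∷ p
plus (a ∷ p) (b ∷ q) = a + b ∷ plus p q

times : Poly → Poly → Poly
times []      q = []
times (a ∷ p) q = plus (map (a *_) q) (0 ∷ times p q)

coefficients : Polynomial → Poly
coefficients X       = 0 ∷ 1 ∷ []
coefficients (con a) = a ∷ []
coefficients (p ⊞ q) = plus (coefficients p) (coefficients q)
coefficients (p ⊠ q) = times (coefficients p) (coefficients q)

poly-plus : ∀ p q x → poly (plus p q) x ≡ poly p x + poly q x
poly-plus []      q       x = refl
poly-plus (a ∷ p) []      x = sym (+-identityʳ _)
poly-plus (a ∷ p) (b ∷ q) x = trans (cong (λ y → a + b + x * y) (poly-plus p q x)) (lem a b x (poly p x) (poly q x))
  where
  lem : ∀ a b x p q → a + b + x * (p + q) ≡ (a + x * p) + (b + x * q)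
  lem = solve-∀

poly-map : ∀ a q x → poly (map (a *_) q) x ≡ a * poly q x
poly-map a []      x = sym (*-zeroʳ a)
poly-map a (b ∷ q) x = trans (cong (λ y → a * b + x * y) (poly-map a q x)) (lem a b x (poly q x))
  where
  lem : ∀ a b x q → a * b + x * (a * q) ≡ a * (b + x * q)
  lem = solve-∀

poly-times : ∀ p q x → poly (times p q) x ≡ poly p x * poly q x
poly-times []      q x = refl
poly-times (a ∷ p) q x = begin
  poly (plus (map (a *_) q) (0 ∷ times p q)) x      ≡⟨ poly-plus (map (a *_) q) (0 ∷ times p q) x ⟩
  poly (map (a *_) q) x + x * poly (times p q) x    ≡⟨ cong₂ (λ y z → y + x * z) (poly-map a q x) (poly-times p q x) ⟩
  a * poly q x + x * (poly p x * poly q x)          ≡⟨ lem a x (poly p x) (poly q x) ⟩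
  (a + x * poly p x) * poly q x                     ∎
  where
  open ≡-Reasoning
  lem : ∀ a x p q → a * q + x * (p * q) ≡ (a + x * p) * q
  lem = solve-∀

poly-coefficients : ∀ p n → poly (coefficients p) n ≡ ⟦ p ⟧ₚ n
poly-coefficients X       n = trans (cong (n *_) (trans (cong suc (*-zeroʳ n)) refl)) (*-identityʳ n)
poly-coefficients (con a) n = trans (cong (a +_) (*-zeroʳ n)) (+-identityʳ a)
poly-coefficients (p ⊞ q) n = trans (poly-plus (coefficients p) (coefficients q) n)
  (cong₂ _+_ (poly-coefficients p n) (poly-coefficients q n))
poly-coefficients (p ⊠ q) n = trans (poly-times (coefficients p) (coefficients q) n)
  (cong₂ _*_ (poly-coefficients p n) (poly-coefficients q n))

⟦⟧ₚ-mono : ∀ p {m n} → m ≤ n → ⟦ p ⟧ₚ m ≤ ⟦ p ⟧ₚ n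
⟦⟧ₚ-mono X       m≤n = m≤n
⟦⟧ₚ-mono (con a) m≤n = ≤-refl
⟦⟧ₚ-mono (p ⊞ q) m≤n = +-mono-≤ (⟦⟧ₚ-mono p m≤n) (⟦⟧ₚ-mono q m≤n)
⟦⟧ₚ-mono (p ⊠ q) m≤n = *-mono-≤ (⟦⟧ₚ-mono p m≤n) (⟦⟧ₚ-mono q m≤n)

-- These mirror the bounds above, so that their values at n are equal to them by computation.
lengthₚ sizeₚ setupₚ iterationₚ mainTimeₚ mainSpaceₚ : Polynomial
lengthₚ = con 1 ⊞ ((con 1 ⊞ X ⊠ (con 1 ⊞ con 4 ⊠ X)) ⊞ (con 1 ⊞ X ⊠ (con 1 ⊞ X))) ⊞ ((con 1 ⊞ X) ⊞ (con 3 ⊞ X))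

sizeₚ = X ⊠ X ⊞ con 2 ⊞ (con 20 ⊞ (con 3 ⊞ con 2 ⊠ X) ⊠ (con 3 ⊞ con 2 ⊠ X)) ⊠ con 16

loopₚ : Polynomial → Polynomial → Polynomial
loopₚ N τ = con 3 ⊞ N ⊠ (τ ⊞ con 2)

setupₚ =
  (con 1 ⊞ (loopₚ X (con 1) ⊞ (con 1 ⊞ (loopₚ X (con 1) ⊞ con 1)))) ⊞
  (loopₚ (con 2 ⊞ X) (con 1) ⊞ loopₚ X (loopₚ (con 2 ⊞ X) (con 1))) ⊞
  (loopₚ (con 1 ⊞ X) (con 1) ⊞ loopₚ X (loopₚ (con 1 ⊞ X) (con 1)))

iterationₚ = (con 1 ⊞ (con 1 ⊞ loopₚ X (con 4))) ⊞ ((con 1 ⊞ loopₚ X (walksₚ ⊞ con 1)) ⊞ con 1)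
  where
  walksₚ : Polynomial
  walksₚ = loopₚ X (con 1) ⊞ loopₚ X (loopₚ X (con 1 ⊞ (loopₚ X (con 1) ⊞ con 1)))

mainTimeₚ = (con 1 ⊞ X) ⊠ (setupₚ ⊞ iterationₚ ⊞ con 7) ⊠ (con costCap ⊠ lengthₚ)

mainSpaceₚ = (sizeₚ ⊞ con costCap) ⊠ lengthₚ

-- Polynomial bounds and the final value for d ≤ n

module Analysis (n d : ℕ) (G : Digraph n) (0<d : 1 ≤ d) (d≤n : d ≤ n) where

  open Main n d G 0<d d≤n renaming (X to capacity)
  open Machine n d σ₀ V capacity costCap n>0 n≤V refl refl
  open Residue (factor k * n ^ d)

  private instance
    d≢0 : NonZero d
    d≢0 = >-nonZero 0<d

  k≡ : k ≡ ⌊ d /2⌋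
  k≡ = d/2≡⌊d/2⌋ d

  ∥V∥≤ : ∥ V ∥ ≤ ⟦ lengthₚ ⟧ₚ n
  ∥V∥≤ = begin
    ∥ m + (2 ^ n + (2 + n)) ∥                     ≤⟨ ∥+∥ m (2 ^ n + (2 + n)) ⟩
    ∥ m ∥ + ∥ 2 ^ n + (2 + n) ∥                   ≤⟨ +-mono-≤ ∥m∥≤ (≤-trans (∥+∥ (2 ^ n) (2 + n))
      (+-mono-≤ (x<2^m⇒∥x∥≤m (s≤s z≤n) (^-monoʳ-< 2 (s≤s (s≤s z≤n)) (n<1+n n))) (∥x∥≤1+x (2 + n)))) ⟩
    ⟦ lengthₚ ⟧ₚ n ∎
    where
    open ≤-Reasoning
    ∥m∥≤ : ∥ m ∥ ≤ 1 + ((1 + n * (1 + 4 * n)) + (1 + n * (1 + n)))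
    ∥m∥≤ = ≤-trans (∥+∥ 1 (factor k * n ^ d)) (s≤s (≤-trans (∥*∥ (factor k) (n ^ d)) (+-mono-≤
      (≤-trans (∥factor∥ k k≤n) (s≤s (*-monoˡ-≤ (1 + 4 * n) k≤n)))
      (≤-trans (∥^∥ n d) (s≤s (*-mono-≤ d≤n (∥x∥≤1+x n)))))))

  space≤ : space ≤ ⟦ mainSpaceₚ ⟧ₚ n
  space≤ = begin
    L * ∥ V ∥ + costCap * ∥ V ∥             ≡⟨ *-distribʳ-+ ∥ V ∥ L costCap ⟨
    (L + costCap) * ∥ V ∥                   ≤⟨ *-monoʳ-≤ (L + costCap) ∥V∥≤ ⟩
    ⟦ mainSpaceₚ ⟧ₚ n                       ∎
    where open ≤-Reasoning

  B≤ : B ≤ suc n * (n C ⌊ d /2⌋)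
  B≤ = begin
    #subsets n (suc k)                    ≤⟨ #subsets≤ n k k+k≤n ⟩
    suc k * (n C k)                ≤⟨ *-monoˡ-≤ (n C k) (s≤s k≤n) ⟩
    suc n * (n C k)                ≡⟨ cong (λ j → suc n * (n C j)) k≡ ⟩
    suc n * (n C ⌊ d /2⌋)          ∎
    where
    open ≤-Reasoning
    k+k≤n : k + k ≤ n
    k+k≤n = ≤-trans (subst₂ _≤_ (sym (cong₂ _+_ k≡ k≡)) (⌊n/2⌋+⌈n/2⌉≡n d) (+-monoʳ-≤ ⌊ d /2⌋ (⌊n/2⌋≤⌈n/2⌉ d))) d≤n

  time≤ : (1 + (main-time + 1)) * unit ≤ (n C ⌊ d /2⌋) * ⟦ mainTimeₚ ⟧ₚ n
  time≤ = begin
    (1 + (main-time + 1)) * unit                      ≤⟨ *-monoˡ-≤ unit main≤ ⟩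
    B * c * unit                                      ≤⟨ *-mono-≤ (*-monoˡ-≤ c B≤) (*-monoʳ-≤ costCap ∥V∥≤) ⟩
    suc n * C₀ * c * (costCap * ⟦ lengthₚ ⟧ₚ n)       ≡⟨ lem (suc n) C₀ c (costCap * ⟦ lengthₚ ⟧ₚ n) ⟩
    C₀ * ⟦ mainTimeₚ ⟧ₚ n                             ∎
    where
    open ≤-Reasoning
    C₀ S I c : ℕ
    C₀ = n C ⌊ d /2⌋
    S  = ⟦ setupₚ ⟧ₚ n
    I  = ⟦ iterationₚ ⟧ₚ n
    c  = S + I + 7
    lem : ∀ a b c d → a * b * c * d ≡ b * (a * c * d)
    lem = solve-∀
    lem₁ : ∀ i c f B I → 1 + ((i + (c + (f + (3 + B * (I + 2))))) + 1) ≡ (i + c + f + 5) + B * (I + 2)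
    lem₁ = solve-∀
    lem₂ : ∀ B S I → B * (S + 5) + B * (I + 2) ≡ B * (S + I + 7)
    lem₂ = solve-∀
    main≤ : 1 + (main-time + 1) ≤ B * c
    main≤ = begin
      1 + (main-time + 1)                ≡⟨ lem₁ init-time count-time coeff-time B I ⟩
      -- The set-up is absorbed into the main loop: B ≥ 1, since the empty set is always among the
      -- subsets.
      (S + 5) + B * (I + 2)              ≤⟨ +-monoˡ-≤ (B * (I + 2)) (m≤n*m (S + 5) B {{>-nonZero (#subsets>0 n k)}}) ⟩
      B * (S + 5) + B * (I + 2)          ≡⟨ lem₂ B S I ⟩
      B * c                              ∎

  -- All registers lie beyond the end of the input, where the memory reads as 0.
  initially : Represents [] (λ _ _ → 0) σ₀
  initially = record
    { inp = λ _ → refl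
    ; reg = λ {r} i _ → read-≥length σ₀ (register r i) (≤-trans (≤-reflexive (length-input G d)) (m≤m+n _ _))
    ; env = tt
    ; len = ≤-trans (≤-reflexive (length-input G d)) (m≤m+n _ _)
    ; bnd = input-≤ G d n≤V (≤-trans d≤n n≤V) (≤-trans (s≤s z≤n) 2+n≤V)
    }

  private
    c : ℕ
    c = #simpleCycles G d

  factor*c<m : factor k * c < m
  factor*c<m = s≤s (*-monoʳ-≤ (factor k) (#simpleCycles≤n^d G d))

  ∑-term : ∑ B term ≡ pos (factor k * c)
  ∑-term = begin
    ∑ B term                        ≡⟨ cong (λ j → ∑ (#subsets n (suc j)) (term′ j)) k≡ ⟩
    signedSum G a a≡G d             ≡⟨ signed d ⟩
    pos (factor ⌊ d /2⌋) *ᶻ pos c   ≡⟨ cong (λ j → pos (factor j) *ᶻ pos c) k≡ ⟨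
    pos (factor k) *ᶻ pos c         ≡⟨ ℤ.pos-* (factor k) c ⟨
    pos (factor k * c)              ∎
    where
    open ≡-Reasoning
    a≡G : ∀ u v → a (toℕ u) (toℕ v) ≡ bit (G u v)
    a≡G = read-input G d
    term′ : ℕ → ℕ → ℤ
    term′ j r = coeff n d j (suc j ∸ rest n (suc j) r) *ᶻ ∑ n (λ v → walks n a (sign n (suc j) r) v d v)
    signed : ∀ d .{{_ : NonZero d}} → signedSum G a a≡G d ≡ pos (factor ⌊ d /2⌋) *ᶻ pos (#simpleCycles G d)
    signed (suc d) = signedSum≡ G a a≡G d

  -- The total and `factor k * c` are congruent and both below m, hence equal, so the division by
  -- `factor k` is exact.
  summed⇒output : ∀ {st} → Summed B st → ⟦ op div (scalar totalʳ) (scalar factorʳ) ⟧ [] st ≡ c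
  summed⇒output {st} ((_ , K≡ , _) , t<m , t∼) = trans
    (cong₂ ⟦ div ⟧ᵒ (∼-injective t<m factor*c<m (∼-resp ∑-term t∼)) K≡) (quotient≡ (factor k) (1≤factor k))
    where
    quotient≡ : ∀ f → 1 ≤ f → ⟦ div ⟧ᵒ (f * c) f ≡ c
    quotient≡ (suc f) _ = trans (cong (_/ suc f) (*-comm (suc f) c)) (m*n/n≡m c (suc f))

outputᵉ : Exp 0
outputᵉ = op div (scalar totalʳ) (scalar factorʳ)

-- The test comes first because the loops with limit d are affordable only for d ≤ n: d itself may
-- be exponential in ∥ d ∥. The output is written last, as it destroys n in cell 0.
algorithm : Program
algorithm =
  if compile {0} (d′ ⊖ n′)
  then (lit 0 ≔ lit 0)
  else (mainᵖ ⨟ lit 0 ≔ compile outputᵉ)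

-- The long polynomials bound the case d > n in terms of n + ∥ d ∥, which is at most 2 + 3 * n
-- if ⌊ d /2⌋ ≤ n.
longTimeₚ longSpaceₚ timeₚ spaceₚ reparametrise : Polynomial
longTimeₚ  = con 10 ⊠ (con 2 ⊞ X) ⊞ con 2
longSpaceₚ = (X ⊠ X ⊞ con 2) ⊠ (con 2 ⊞ X) ⊞ longTimeₚ
reparametrise = con 2 ⊞ con 3 ⊠ X

substitute : Polynomial → Polynomial → Polynomial
substitute r X       = r
substitute r (con a) = con a
substitute r (p ⊞ q) = substitute r p ⊞ substitute r q
substitute r (p ⊠ q) = substitute r p ⊠ substitute r q

⟦substitute⟧ₚ : ∀ r p n → ⟦ substitute r p ⟧ₚ n ≡ ⟦ p ⟧ₚ (⟦ r ⟧ₚ n)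
⟦substitute⟧ₚ r X       n = refl
⟦substitute⟧ₚ r (con a) n = refl
⟦substitute⟧ₚ r (p ⊞ q) n = cong₂ _+_ (⟦substitute⟧ₚ r p n) (⟦substitute⟧ₚ r q n)
⟦substitute⟧ₚ r (p ⊠ q) n = cong₂ _*_ (⟦substitute⟧ₚ r p n) (⟦substitute⟧ₚ r q n)

timeₚ  = mainTimeₚ ⊞ substitute reparametrise longTimeₚ
spaceₚ = mainSpaceₚ ⊞ substitute reparametrise longSpaceₚ

toPoly : ∀ p → ∃[ l ] (∀ n → poly l n ≡ ⟦ p ⟧ₚ n)
toPoly p = coefficients p , poly-coefficients p

-- Unfolded, the coefficients are too large for the type checker.
abstract

  timeBound : ∃[ l ] (∀ n → poly l n ≡ ⟦ timeₚ ⟧ₚ n)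
  timeBound = toPoly timeₚ

  spaceBound : ∃[ l ] (∀ n → poly l n ≡ ⟦ spaceₚ ⟧ₚ n)
  spaceBound = toPoly spaceₚ

timePoly spacePoly : Poly
timePoly  = proj₁ timeBound
spacePoly = proj₁ spaceBound

Correct : (n : ℕ) → Digraph n → (d : ℕ) .{{_ : NonZero d}} → Set
Correct n G d = ∃[ σ ] ∃[ t ] ∃[ s ]
  ⟨ algorithm , input G d ⟩⇓⟨ σ , t , s ⟩
  × output σ ≡ #simpleCycles G d
  × (⌊ d /2⌋ ≤ n → t ≤ (n C ⌊ d /2⌋) * poly timePoly n × s ≤ poly spacePoly n)
  × (n < ⌊ d /2⌋ → t ≤ poly timePoly (n + ∥ d ∥) × s ≤ poly spacePoly (n + ∥ d ∥))

main≤time : ∀ n → ⟦ mainTimeₚ ⟧ₚ n ≤ poly timePoly n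
main≤time n = ≤-trans (m≤m+n _ _) (≤-reflexive (sym (proj₂ timeBound n)))

main≤space : ∀ n → ⟦ mainSpaceₚ ⟧ₚ n ≤ poly spacePoly n
main≤space n = ≤-trans (m≤m+n _ _) (≤-reflexive (sym (proj₂ spaceBound n)))

longTime≤ : ∀ {N} n → N ≤ ⟦ reparametrise ⟧ₚ n → ⟦ longTimeₚ ⟧ₚ N ≤ poly timePoly n
longTime≤ {N} n N≤ = begin
  ⟦ longTimeₚ ⟧ₚ N                               ≤⟨ ⟦⟧ₚ-mono longTimeₚ N≤ ⟩
  ⟦ longTimeₚ ⟧ₚ (⟦ reparametrise ⟧ₚ n)          ≡⟨ ⟦substitute⟧ₚ reparametrise longTimeₚ n ⟨
  ⟦ substitute reparametrise longTimeₚ ⟧ₚ n      ≤⟨ m≤n+m _ (⟦ mainTimeₚ ⟧ₚ n) ⟩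
  ⟦ timeₚ ⟧ₚ n                                   ≡⟨ proj₂ timeBound n ⟨
  poly timePoly n                                ∎
  where open ≤-Reasoning

longSpace≤ : ∀ {N} n → N ≤ ⟦ reparametrise ⟧ₚ n → ⟦ longSpaceₚ ⟧ₚ N ≤ poly spacePoly n
longSpace≤ {N} n N≤ = begin
  ⟦ longSpaceₚ ⟧ₚ N                              ≤⟨ ⟦⟧ₚ-mono longSpaceₚ N≤ ⟩
  ⟦ longSpaceₚ ⟧ₚ (⟦ reparametrise ⟧ₚ n)         ≡⟨ ⟦substitute⟧ₚ reparametrise longSpaceₚ n ⟨
  ⟦ substitute reparametrise longSpaceₚ ⟧ₚ n     ≤⟨ m≤n+m _ (⟦ mainSpaceₚ ⟧ₚ n) ⟩
  ⟦ spaceₚ ⟧ₚ n                                  ≡⟨ proj₂ spaceBound n ⟨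
  poly spacePoly n                               ∎
  where open ≤-Reasoning

correct-d≤n : ∀ n G d .{{_ : NonZero d}} → d ≤ n → Correct n G d
correct-d≤n n G d d≤n = finish (run-main initially)
  where
  open Main n d G (>-nonZero⁻¹ d) d≤n renaming (X to capacity)
  open Machine n d σ₀ V capacity costCap n>0 n≤V refl refl
  open Analysis n d G (>-nonZero⁻¹ d) d≤n

  condᵉ : Expr
  condᵉ = compile {0} (d′ ⊖ n′)

  cond≤ : cost condᵉ σ₀ ≤ unit
  cond≤ = ≤-trans (cost≤ {σ = σ₀} (Represents.bnd initially) condᵉ) (*-monoˡ-≤ ∥ V ∥ (≤ᵇ⇒≤ (costFactor condᵉ) costCap tt))

  size₀≤ : size σ₀ ≤ L * ∥ V ∥
  size₀≤ = ≤-trans (size≤ σ₀ (Represents.bnd initially)) (*-monoˡ-≤ ∥ V ∥ (Represents.len initially))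

  quotient≤ : ∀ x y → ⟦ div ⟧ᵒ x y ≤ x
  quotient≤ x zero    = z≤n
  quotient≤ x (suc y) = m/n≤m x (suc y)

  finish′ : Outputs (mainᵖ ⨟ lit 0 ≔ compile outputᵉ) (main-time + 1) σ₀ (#simpleCycles G d) → Correct n G d
  finish′ (σ , t , s , run , out≡ , t≤ , s≤) = σ , _ , _ , if-false (m≤n⇒m∸n≡0 d≤n) run , out≡
    , (λ _ → ≤-trans (+-mono-≤ cond≤ t≤) (≤-trans time≤ (*-monoʳ-≤ (n C ⌊ d /2⌋) (main≤time n)))
           , ≤-trans (⊔-lub (+-mono-≤ size₀≤ cond≤) s≤) (≤-trans space≤ (main≤space n)))
    , λ n<⌊d/2⌋ → contradiction (≤-trans (⌊n/2⌋≤n d) d≤n) (<⇒≱ n<⌊d/2⌋)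

  finish : Outcome mainᵖ [] main-time σ₀ (Summed B) → Correct n G d
  finish O = finish′ (attach (run-output outputᵉ O.rep
    (≤-trans (quotient≤ (O.state totalʳ 0) (O.state factorʳ 0)) (residue≤V (proj₂ O.post)))))
    where
    module O = Outcome O
    attach : Outputs (lit 0 ≔ compile outputᵉ) 1 O.final (⟦ outputᵉ ⟧ [] O.state) →
      Outputs (mainᵖ ⨟ lit 0 ≔ compile outputᵉ) (main-time + 1) σ₀ (#simpleCycles G d)
    attach (σ , t , s , run , out≡ , t≤ , s≤) = σ , _ , _ , seq O.run run , trans out≡ (summed⇒output {O.state} O.post)
      , ≤-trans (+-mono-≤ O.t≤ t≤) (≤-reflexive (sym (*-distribʳ-+ unit main-time 1))) , ⊔-lub O.s≤ s≤

correct-d>n : ∀ n G d .{{_ : NonZero d}} → n < d → Correct n G d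
correct-d>n n G d n<d = _ , _ , _ , if-true (λ ≡0 → <⇒≱ n<d (m∸n≡0⇒m≤n ≡0)) assign
  , sym (#simpleCycles≡0 G d n<d)
  , (λ ⌊d/2⌋≤n → ≤-trans (≤-trans t≤ (longTime≤ n (N≤ ⌊d/2⌋≤n)))
        -- The binomial coefficient is at least 1 here, so the polynomial bound may be multiplied by
        -- it.
        (≤-trans (≤-reflexive (sym (+-identityʳ _))) (*-monoˡ-≤ _ (nCk>0 ⌊d/2⌋≤n)))
      , ≤-trans s≤ (longSpace≤ n (N≤ ⌊d/2⌋≤n)))
  , λ _ → ≤-trans t≤ (longTime≤ N (N≤⟦⟧ N)) , ≤-trans s≤ (longSpace≤ N (N≤⟦⟧ N))
  where
  σ₀ : Memory
  σ₀ = input G d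
  N V : ℕ
  N = n + ∥ d ∥
  V = 1 + (n + d)
  condᵉ : Expr
  condᵉ = compile {0} (d′ ⊖ n′)
  ∥V∥≤ : ∥ V ∥ ≤ 2 + N
  ∥V∥≤ = ≤-trans (∥+∥ 1 (n + d)) (s≤s (≤-trans (∥+∥ n d) (+-monoˡ-≤ ∥ d ∥ (∥x∥≤1+x n))))
  σ₀≤V : ∀ a → read σ₀ a ≤ V
  σ₀≤V = input-≤ G d (≤-trans (m≤m+n n d) (n≤1+n _)) (≤-trans (m≤n+m d n) (n≤1+n _)) (s≤s z≤n)
  cond≤ : cost condᵉ σ₀ ≤ 10 * (2 + N)
  cond≤ = ≤-trans (cost≤ {σ = σ₀} σ₀≤V condᵉ) (*-mono-≤ (≤ᵇ⇒≤ (costFactor condᵉ) 10 tt) ∥V∥≤)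
  size≤′ : ∀ σ → length σ ≤ n * n + 2 → (∀ a → read σ a ≤ V) → size σ ≤ (N * N + 2) * (2 + N)
  size≤′ σ len bnd = ≤-trans (size≤ σ bnd) (*-mono-≤ (≤-trans len (+-monoˡ-≤ 2 (*-mono-≤ (m≤m+n n ∥ d ∥) (m≤m+n n ∥ d ∥)))) ∥V∥≤)
  len₀ : length σ₀ ≤ n * n + 2
  len₀ = ≤-reflexive (length-input G d)
  size₀≤ : size σ₀ ≤ (N * N + 2) * (2 + N)
  size₀≤ = size≤′ σ₀ len₀ σ₀≤V
  size₁≤ : size (write σ₀ 0 0) ≤ (N * N + 2) * (2 + N)
  size₁≤ = size≤′ (write σ₀ 0 0) (length-write σ₀ 0 0 len₀ (m≤n⇒m≤o+n (n * n) (s≤s z≤n))) (write-≤ σ₀ 0 0 σ₀≤V z≤n)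
  -- The summand 2 is the cost of `lit 0 ≔ lit 0`, one bit for each of the two zeros.
  t≤ : cost condᵉ σ₀ + 2 ≤ ⟦ longTimeₚ ⟧ₚ N
  t≤ = +-monoˡ-≤ 2 cond≤
  s≤ : (size σ₀ + cost condᵉ σ₀) ⊔ ((size σ₀ ⊔ size (write σ₀ 0 0)) + 2) ≤ ⟦ longSpaceₚ ⟧ₚ N
  s≤ = ⊔-lub (+-mono-≤ size₀≤ (≤-trans cond≤ (m≤m+n (10 * (2 + N)) 2))) (+-mono-≤ (⊔-lub size₀≤ size₁≤) (m≤n+m 2 (10 * (2 + N))))
  N≤⟦⟧ : ∀ l → l ≤ 2 + 3 * l
  N≤⟦⟧ l = ≤-trans (m≤m+n l (2 * l)) (m≤n+m (3 * l) 2)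
  N≤ : ⌊ d /2⌋ ≤ n → N ≤ 2 + 3 * n
  N≤ ⌊d/2⌋≤n = begin
    n + ∥ d ∥                        ≤⟨ +-monoʳ-≤ n (∥x∥≤1+x d) ⟩
    n + suc d                        ≡⟨ cong (λ x → n + suc x) (⌊n/2⌋+⌈n/2⌉≡n d) ⟨
    n + suc (⌊ d /2⌋ + ⌈ d /2⌉)      ≤⟨ +-monoʳ-≤ n (s≤s (+-mono-≤ ⌊d/2⌋≤n (≤-trans (⌈d/2⌉≤ d) (s≤s ⌊d/2⌋≤n)))) ⟩
    n + suc (n + suc n)              ≡⟨ lem n ⟩
    2 + 3 * n                        ∎
    where
    open ≤-Reasoning
    lem : ∀ n → n + suc (n + suc n) ≡ 2 + 3 * n
    lem = solve-∀
    ⌈d/2⌉≤ : ∀ d → ⌈ d /2⌉ ≤ suc ⌊ d /2⌋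
    ⌈d/2⌉≤ zero          = z≤n
    ⌈d/2⌉≤ (suc zero)    = s≤s z≤n
    ⌈d/2⌉≤ (suc (suc d)) = s≤s (⌈d/2⌉≤ d)

mainTheorem4 : ∃[ P ] ∃[ p ] ∃[ q ]
    ((n : ℕ) (G : Digraph n) (d : ℕ) .{{_ : NonZero d}} →
    ∃[ σ ] ∃[ t ] ∃[ s ]
    ⟨ P , input G d ⟩⇓⟨ σ , t , s ⟩
    × output σ ≡ #simpleCycles G d
    × (⌊ d /2⌋ ≤ n → t ≤ (n C ⌊ d /2⌋) * poly p n × s ≤ poly q n)
    × (n < ⌊ d /2⌋ → t ≤ poly p (n + ∥ d ∥) × s ≤ poly q (n + ∥ d ∥)))
mainTheorem4 = algorithm , timePoly , spacePoly , correct
  where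
  correct : (n : ℕ) (G : Digraph n) (d : ℕ) .{{_ : NonZero d}} → Correct n G d
  correct n G d with d ≤? n
  ... | yes d≤n = correct-d≤n n G d d≤n
  ... | no  d≰n = correct-d>n n G d (≰⇒> d≰n)
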